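{- The following decision problem is NP-complete: given a 4-regular graph $G$, decide whether $\overleftrightarrow{\chi}(G) \leq 3$.
   Context: All graphs are finite and simple. An orientation $D$ of a graph $G$ is a digraph obtained by replacing each edge of $G$ by exactly one of the two possible arcs with the same endvertices. For a vertex $v$, $d_D^-(v)$ (in-degree) is the number of arcs with head $v$, $d_D^+(v)$ (out-degree) is the number of arcs with tail $v$, and the in-out-degree is $d_D^{\pm}(v) = d_D^-(v) - d_D^+(v)$. An orientation $D$ of $G$ is in-out-proper if $d_D^{\pm}(u) \neq d_D^{\pm}(v)$ for any two adjacent vertices $u,v$. The in-out-proper orientation number of $G$ is $\overleftrightarrow{\chi}(G) = \min_{D\in\Gamma}\max_{v\in V(G)} |d_D^{\pm}(v)|$, where $\Gamma$ is the set of in-out-proper orientations of $G$ (it is known that $\Gamma$ is nonempty for every graph $G$). -}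

module Defs where

open import Data.Bool.Base using (Bool; true; false; not; T)
open import Data.Fin.Base using (Fin)
open import Data.Fin.Subset using (∣_∣)
open import Data.Integer.Base as ℤ using (ℤ; +_)
open import Data.List.Base as List using (List; []; _∷_; _++_; length)
open import Data.Maybe.Base using (Maybe; just; nothing)
open import Data.Nat.Base using (ℕ; suc; _+_; _*_; _⊔_; _≤_)
open import Data.Product.Base using (Σ-syntax; ∃-syntax; _×_; _,_; proj₁; proj₂)
open import Data.Vec.Base as Vec using (Vec; []; _∷_)
import Data.Vec.Functional as Functional
open import Function.Bundles using (_⇔_)
open import Relation.Binary.PropositionalEquality using (_≡_; _≢_)
open import Relation.Nullary.Negation.Core using (¬_)

record Graph : Set where
  field
    order     : ℕ
    adj       : Fin order → Fin order → Bool
    adj-sym   : ∀ u v → adj u v ≡ adj v u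
    adj-irref : ∀ v → ¬ T (adj v v)

  Vertex : Set
  Vertex = Fin order

  degree : Vertex → ℕ
  degree v = ∣ Vec.tabulate (adj v) ∣

open Graph public using (order; adj; Vertex; degree)

Regular : ℕ → Graph → Set
Regular r G = ∀ (v : Vertex G) → degree G v ≡ r

-- arc u v holds when there is an arc with tail u and head v.
record Orientation (G : Graph) : Set where
  field
    arc         : Vertex G → Vertex G → Bool
    arc⇒adj     : ∀ u v → T (arc u v) → T (adj G u v)
    exactly-one : ∀ u v → T (adj G u v) → arc u v ≡ not (arc v u)

  d⁻ : Vertex G → ℕ
  d⁻ v = ∣ Vec.tabulate (λ u → arc u v) ∣

  d⁺ : Vertex G → ℕ
  d⁺ v = ∣ Vec.tabulate (λ w → arc v w) ∣

  d± : Vertex G → ℤ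
  d± v = + d⁻ v ℤ.- + d⁺ v

  InOutProper : Set
  InOutProper = ∀ u v → T (adj G u v) → d± u ≢ d± v

  -- For the graph without vertices this is 0.
  max∣d±∣ : ℕ
  max∣d±∣ = Functional.foldr _⊔_ 0 (λ v → ℤ.∣ d± v ∣)

open Orientation public using (InOutProper; max∣d±∣)

-- "The minimum of max∣d±∣ over the in-out-proper orientations of G is k",
-- as a relation, since a function would need the theorem that such an
-- orientation always exists.  The value k is unique.
InOutProperOrientationNumber : Graph → ℕ → Set
InOutProperOrientationNumber G k =
    (Σ[ D ∈ Orientation G ] InOutProper D × max∣d±∣ D ≡ k)
  × (∀ (D : Orientation G) → InOutProper D → k ≤ max∣d±∣ D)

χ↔[_]≤_ : Graph → ℕ → Set
χ↔[ G ]≤ b = ∃[ k ] InOutProperOrientationNumber G k × k ≤ b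

data Symbol (g : ℕ) : Set where
  blank : Symbol g
  bit   : Bool → Symbol g
  aux   : Fin g → Symbol g

data Move : Set where
  left stay right : Move

-- A two-way infinite tape, blank outside the stored part.  The cells to
-- the left of the head are listed starting from the one next to it.
record Tape (g : ℕ) : Set where
  constructor ⟨_,_,_⟩
  field
    before  : List (Symbol g)
    scanned : Symbol g
    after   : List (Symbol g)

open Tape public

module _ {g : ℕ} where

  move : Move → Tape g → Tape g
  move left  ⟨ []     , s , rs     ⟩ = ⟨ []     , blank , s ∷ rs ⟩
  move left  ⟨ l ∷ ls , s , rs     ⟩ = ⟨ ls     , l     , s ∷ rs ⟩
  move stay  t                       = t
  move right ⟨ ls     , s , []     ⟩ = ⟨ s ∷ ls , blank , []     ⟩
  move right ⟨ ls     , s , r ∷ rs ⟩ = ⟨ s ∷ ls , r     , rs     ⟩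

  act : Symbol g × Move → Tape g → Tape g
  act (s , m) t = move m ⟨ before t , s , after t ⟩

  inputTape : List Bool → Tape g
  inputTape []       = ⟨ [] , blank , [] ⟩
  inputTape (b ∷ bs) = ⟨ [] , bit b , List.map bit bs ⟩

  leadingBits : List (Symbol g) → List Bool
  leadingBits (bit b ∷ ss) = b ∷ leadingBits ss
  leadingBits _            = []

  -- The word written from the head rightwards, up to the first non-bit.
  outputWord : Tape g → List Bool
  outputWord t = leadingBits (scanned t ∷ after t)

-- δ q ss ≡ nothing means that the machine halts in state q reading ss.
record TM (tapes : ℕ) : Set where
  field
    states    : ℕ
    auxiliary : ℕ
    start     : Fin states
    accepting : Fin states → Bool
    δ         : Fin states → Vec (Symbol auxiliary) tapes →
                Maybe (Fin states × Vec (Symbol auxiliary × Move) tapes)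

  Config : Set
  Config = Fin states × Vec (Tape auxiliary) tapes

  initial : Vec (List Bool) tapes → Config
  initial ws = start , Vec.map inputTape ws

  step : Config → Maybe Config
  step (q , ts) with δ q (Vec.map scanned ts)
  ... | nothing        = nothing
  ... | just (q′ , as) = just (q′ , Vec.zipWith act as ts)

  data HaltsWithin : ℕ → Config → Config → Set where
    halt : ∀ {t c} → step c ≡ nothing → HaltsWithin t c c
    next : ∀ {t c c′ d} → step c ≡ just c′ → HaltsWithin t c′ d →
           HaltsWithin (suc t) c d

open TM public

-- Polynomials with coefficients in ℕ, constant term first.
Polynomial : Set
Polynomial = List ℕ

eval : Polynomial → ℕ → ℕ
eval []      n = 0
eval (a ∷ p) n = a + n * eval p n

Language : Set₁
Language = List Bool → Set

-- Input and output are both on the first tape.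
PolyTimeFunction : (List Bool → List Bool) → Set
PolyTimeFunction f =
  ∃[ k ] Σ[ M ∈ TM (1 + k) ] Σ[ p ∈ Polynomial ]
    ∀ x → ∃[ c ]
        HaltsWithin M (eval p (length x))
          (initial M (x ∷ Vec.replicate k [])) c
      × outputWord (Vec.head (proj₂ c)) ≡ f x

-- The two arguments are on the first two tapes.
PolyTimeRelation : (List Bool → List Bool → Bool) → Set
PolyTimeRelation R =
  ∃[ k ] Σ[ M ∈ TM (2 + k) ] Σ[ p ∈ Polynomial ]
    ∀ x y → ∃[ c ]
        HaltsWithin M (eval p (length x + length y))
          (initial M (x ∷ y ∷ Vec.replicate k [])) c
      × accepting M (proj₁ c) ≡ R x y

-- y is the certificate and R the verifier.
NP : Language → Set
NP L =
  Σ[ R ∈ (List Bool → List Bool → Bool) ] PolyTimeRelation R ×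
  Σ[ p ∈ Polynomial ]
    (∀ x → L x ⇔ (∃[ y ] length y ≤ eval p (length x) × R x y ≡ true))

-- Polynomial-time many-one (Karp) reducibility.
_≤ₚ_ : Language → Language → Set
L ≤ₚ L′ = Σ[ f ∈ (List Bool → List Bool) ]
            PolyTimeFunction f × (∀ x → L x ⇔ L′ (f x))

NP-hard : Language → Set₁
NP-hard L = ∀ (L′ : Language) → NP L′ → L′ ≤ₚ L

NP-complete : Language → Set₁
NP-complete L = NP L × NP-hard L

record DecisionProblem : Set₁ where
  field
    Instance : Set
    encode   : Instance → List Bool
    Yes      : Instance → Set

  -- A word that encodes no instance is not in the language.
  language : Language
  language w = Σ[ I ∈ Instance ] encode I ≡ w × Yes I

open DecisionProblem public using (language)

-- The number n of vertices in unary, as 1ⁿ0, followed by the n rows of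
-- the adjacency matrix.
encodeGraph : Graph → List Bool
encodeGraph G =
  List.replicate (order G) true ++
  false ∷ List.concat (List.tabulate (λ u → List.tabulate (adj G u)))

RegularInOutProperOrientation : (r b : ℕ) → DecisionProblem
RegularInOutProperOrientation r b = record
  { Instance = Σ[ G ∈ Graph ] Regular r G
  ; encode   = λ (G , _) → encodeGraph G
  ; Yes      = λ (G , _) → χ↔[ G ]≤ b
  }

{-# OPTIONS --safe #-}
-- A 4-regular graph has an in-out-proper orientation with |d±| ≤ 3 iff it has
-- one with all in-degrees in {1, 2, 3} and different on adjacent vertices; so
-- such a graph is 3-colourable.  Conversely, if the vertices of a 4-regular
-- graph are partitioned into triangles, every proper 3-colouring is realised:
-- orient each triangle by colour and the remaining cycles cyclically.
--
-- Hardness is therefore reduced to the 3-colourability of such graphs.  A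
-- variable is a ring of triangles (a, b, c) in which the next a is joined to b
-- and c, so that all a have the same colour; the remaining edges at b and c
-- copy this colour once more, to a vertex of a triangle that stands for an
-- all-different constraint.  These constraints express the local rules of the
-- Cook-Levin tableau of a verifier, laid out on a torus whose columns are the
-- tape positions relative to the heads.
--
-- Polynomial time is handled by arithmetic terms with bounded sums and access
-- to the bits of the input, evaluated by multitape machines that hold numbers
-- as head positions.  Both the verifier for membership in NP and the adjacency
-- relation produced by the reduction are such terms.
module Submission where

-- For in-degree d in a 4-regular graph the in-out-degree is 2d - 4, an even number, so the bound 3
-- excludes exactly the in-degrees 0 and 4. A triangle oriented by increasing colour gives
-- in-degrees 0, 1, 2 and a directed cycle adds 1 everywhere: in-degree = colour + 1. Regularity
-- shapes the gadgets. Outside its triangle a vertex has exactly two more edges, so no gadget may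
-- have free ends, and a provider of a colour must be matched with exactly one consumer. Hence every
-- occurrence of a variable has its own provider, the number of occurrences is absorbed by the
-- length of the ring, and shifts between cells must be bijections, whence a torus. The adjacency
-- relation must be a term of fixed size. Therefore all cells carry the same finite set of
-- constraints; the input and the borders of the tableau enter only as flags of a cell, and a false
-- flag merely exchanges two plugs. Coordinates relative to the heads remove head markers from the
-- tableau: a column changes according to its two neighbours, the state and the scanned symbols, and
-- the latter two are copied along the row.

-- Explicitly enumerated types.

module Finiteness where

  open import Data.Bool.Base using (Bool; true; false)
  open import Data.Fin.Base using (Fin; zero; suc; splitAt; join; combine; remQuot)
  open import Data.Fin.Properties using (splitAt-join; join-splitAt; remQuot-combine; combine-remQuot; _≟_)
  open import Data.Nat.Base using (ℕ; zero; suc; _+_; _*_)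
  open import Data.Product.Base using (_×_; _,_)
  open import Data.Sum.Base as Sum using (_⊎_; inj₁; inj₂)
  open import Data.Unit.Base using (⊤; tt)
  open import Data.Vec.Base using (Vec; []; _∷_)
  open import Relation.Binary.Definitions using (DecidableEquality)
  open import Relation.Binary.PropositionalEquality using (_≡_; refl; sym; trans; cong; cong₂)
  open import Relation.Nullary.Decidable using (map′)

  -- The numbering is data, not mere existence: it yields the states of compiled machines, the
  -- numbers of the vertices and the literals in the adjacency term.
  record Finite (A : Set) : Set where
    field
      size    : ℕ
      to      : A → Fin size
      from    : Fin size → A
      from-to : ∀ a → from (to a) ≡ a
      to-from : ∀ i → to (from i) ≡ i

    to-injective : ∀ {a b} → to a ≡ to b → a ≡ b
    to-injective {a} {b} eq = trans (sym (from-to a)) (trans (cong from eq) (from-to b))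

    equal? : DecidableEquality A
    equal? a b = map′ to-injective (cong to) (to a ≟ to b)

  open Finite

  finite-Fin : ∀ n → Finite (Fin n)
  finite-Fin n = record { size = n ; to = λ i → i ; from = λ i → i ; from-to = λ _ → refl ; to-from = λ _ → refl }

  finite-⊤ : Finite ⊤
  finite-⊤ = record { size = 1 ; to = λ _ → zero ; from = λ _ → tt ; from-to = λ _ → refl
                    ; to-from = λ { zero → refl } }

  finite-Bool : Finite Bool
  finite-Bool = record
    { size = 2 ; to = λ { false → zero ; true → suc zero }
    ; from = λ { zero → false ; (suc zero) → true }
    ; from-to = λ { false → refl ; true → refl }
    ; to-from = λ { zero → refl ; (suc zero) → refl } }

  finite-⊎ : ∀ {A B} → Finite A → Finite B → Finite (A ⊎ B)
  finite-⊎ {A} {B} F G = record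
    { size = size F + size G
    ; to = λ x → join (size F) (size G) (Sum.map (to F) (to G) x)
    ; from = λ i → Sum.map (from F) (from G) (splitAt (size F) i)
    ; from-to = λ x → trans (cong (Sum.map (from F) (from G)) (splitAt-join (size F) (size G) (Sum.map (to F) (to G) x)))
                            (back x)
    ; to-from = λ i → trans (cong (join (size F) (size G)) (forth (splitAt (size F) i))) (join-splitAt (size F) (size G) i) }
    where
    forth : ∀ x → Sum.map (to F) (to G) (Sum.map (from F) (from G) x) ≡ x
    forth (inj₁ i) = cong inj₁ (to-from F i)
    forth (inj₂ j) = cong inj₂ (to-from G j)
    back : ∀ x → Sum.map (from F) (from G) (Sum.map (to F) (to G) x) ≡ x
    back (inj₁ a) = cong inj₁ (from-to F a)
    back (inj₂ b) = cong inj₂ (from-to G b)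

  finite-× : ∀ {A B} → Finite A → Finite B → Finite (A × B)
  finite-× {A} {B} F G = record
    { size = size F * size G
    ; to = λ (a , b) → combine (to F a) (to G b)
    ; from = λ i → pair (remQuot (size G) i)
    ; from-to = λ (a , b) → trans (cong pair (remQuot-combine (to F a) (to G b)))
                                  (cong₂ _,_ (from-to F a) (from-to G b))
    ; to-from = λ i → trans (cong₂ combine (to-from F _) (to-from G _)) (combine-remQuot {size F} (size G) i) }
    where
    pair : Fin (size F) × Fin (size G) → A × B
    pair (i , j) = from F i , from G j

  finite-iso : ∀ {A B} (f : A → B) (g : B → A) → (∀ a → g (f a) ≡ a) → (∀ b → f (g b) ≡ b) → Finite B → Finite A
  finite-iso f g gf fg F = record
    { size = size F
    ; to = λ a → to F (f a)
    ; from = λ i → g (from F i)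
    ; from-to = λ a → trans (cong g (from-to F (f a))) (gf a)
    ; to-from = λ i → trans (cong (to F) (fg (from F i))) (to-from F i) }

  finite-Vec : ∀ {A} → Finite A → ∀ n → Finite (Vec A n)
  finite-Vec F zero    = finite-iso (λ _ → tt) (λ _ → []) (λ { [] → refl }) (λ _ → refl) finite-⊤
  finite-Vec F (suc n) =
    finite-iso (λ { (x ∷ xs) → x , xs }) (λ (x , xs) → x ∷ xs) (λ { (x ∷ xs) → refl }) (λ _ → refl)
      (finite-× F (finite-Vec F n))

-- Structured programs and their compilation to multitape Turing machines.

module Programs where

  open import Data.Bool.Base using (Bool; true; false; if_then_else_)
  open import Data.Maybe.Base as Maybe using (Maybe; just; nothing)
  open import Data.Nat.Base using (ℕ; suc; _+_; _≤_; s≤s)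
  open import Data.Nat.Properties using (+-comm)
  open import Data.Product.Base using (∃-syntax; _×_; _,_; proj₁; proj₂; map₁)
  open import Data.Sum.Base using (_⊎_; inj₁; inj₂)
  open import Data.Unit.Base using (⊤; tt)
  open import Data.Vec.Base as Vec using (Vec; []; _∷_)
  open import Function.Base using (_∘_)
  open import Relation.Binary.PropositionalEquality using (_≡_; refl; sym; trans; cong; subst)
  open import Defs
  open Finiteness
  open Finite

  Tapes : ℕ → ℕ → Set
  Tapes g n = Vec (Tape g) n

  Heads : ℕ → ℕ → Set
  Heads g n = Vec (Symbol g) n

  Actions : ℕ → ℕ → Set
  Actions g n = Vec (Symbol g × Move) n

  keep : ∀ {g} → Symbol g → Symbol g × Move
  keep s = s , stay

  perform : ∀ {g n} → Actions g n → Tapes g n → Tapes g n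
  perform = Vec.zipWith act

  heads : ∀ {g n} → Tapes g n → Heads g n
  heads = Vec.map scanned

  perform-keep : ∀ {g n} (ts : Tapes g n) → perform (Vec.map keep (heads ts)) ts ≡ ts
  perform-keep []       = refl
  perform-keep (t ∷ ts) = cong (t ∷_) (perform-keep ts)

  infixr 6 _⨾_

  -- Instructions and tests depend on the scanned symbols alone, so that each of them is a single
  -- transition of the compiled machine.
  data Prog (g n : ℕ) : Set where
    prim  : (Heads g n → Actions g n) → Prog g n
    _⨾_   : Prog g n → Prog g n → Prog g n
    cond  : (Heads g n → Bool) → Prog g n → Prog g n → Prog g n
    while : (Heads g n → Bool) → Prog g n → Prog g n

  -- The number is an upper bound on the number of machine steps.
  data Run {g n : ℕ} : Prog g n → ℕ → Tapes g n → Tapes g n → Set where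
    prim       : ∀ {f ts} → Run (prim f) 1 ts (perform (f (heads ts)) ts)
    _⨾_        : ∀ {P Q a b ts us vs} → Run P a ts us → Run Q b us vs → Run (P ⨾ Q) (a + b) ts vs
    cond-true  : ∀ {b P Q t ts us} → b (heads ts) ≡ true → Run P t ts us → Run (cond b P Q) (suc t) ts us
    cond-false : ∀ {b P Q t ts us} → b (heads ts) ≡ false → Run Q t ts us → Run (cond b P Q) (suc t) ts us
    while-stop : ∀ {b P ts} → b (heads ts) ≡ false → Run (while b P) 1 ts ts
    while-more : ∀ {b P s t ts us vs} → b (heads ts) ≡ true →
                 Run P s ts us → Run (while b P) t us vs → Run (while b P) (suc (s + t)) ts vs
    weaken     : ∀ {P s t ts us} → s ≤ t → Run P s ts us → Run P t ts us

  module Compiler {g n : ℕ} where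

    -- One control point for each instruction and each test. The body of a loop exits to the control
    -- point of its test.
    Location : Prog g n → Set
    Location (prim _)     = ⊤
    Location (P ⨾ Q)      = Location P ⊎ Location Q
    Location (cond _ P Q) = ⊤ ⊎ (Location P ⊎ Location Q)
    Location (while _ P)  = ⊤ ⊎ Location P

    finite-Location : ∀ P → Finite (Location P)
    finite-Location (prim _)     = finite-⊤
    finite-Location (P ⨾ Q)      = finite-⊎ (finite-Location P) (finite-Location Q)
    finite-Location (cond _ P Q) = finite-⊎ finite-⊤ (finite-⊎ (finite-Location P) (finite-Location Q))
    finite-Location (while _ P)  = finite-⊎ finite-⊤ (finite-Location P)

    entry : ∀ P → Location P
    entry (prim _)     = tt
    entry (P ⨾ Q)      = inj₁ (entry P)
    entry (cond _ P Q) = inj₁ tt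
    entry (while _ P)  = inj₁ tt

    -- ι embeds the locations of the program into the states of an enclosing
    -- machine, and e is the state of that machine entered at the end.
    code : ∀ {S : Set} P → (Location P → S) → S → Location P → Heads g n → S × Actions g n
    code (prim f)     ι e _               ss = e , f ss
    code (P ⨾ Q)      ι e (inj₁ l)        ss = code P (ι ∘ inj₁) (ι (inj₂ (entry Q))) l ss
    code (P ⨾ Q)      ι e (inj₂ l)        ss = code Q (ι ∘ inj₂) e l ss
    code (cond b P Q) ι e (inj₁ _)        ss =
      (if b ss then ι (inj₂ (inj₁ (entry P))) else ι (inj₂ (inj₂ (entry Q)))) , Vec.map keep ss
    code (cond b P Q) ι e (inj₂ (inj₁ l)) ss = code P (ι ∘ inj₂ ∘ inj₁) e l ss
    code (cond b P Q) ι e (inj₂ (inj₂ l)) ss = code Q (ι ∘ inj₂ ∘ inj₂) e l ss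
    code (while b P)  ι e (inj₁ _)        ss =
      (if b ss then ι (inj₂ (entry P)) else e) , Vec.map keep ss
    code (while b P)  ι e (inj₂ l)        ss = code P (ι ∘ inj₂) (ι (inj₁ tt)) l ss

    module Simulation {S : Set} (δ′ : S → Heads g n → Maybe (S × Actions g n)) where

      data _⟶[_]_ : S × Tapes g n → ℕ → S × Tapes g n → Set where
        stop : ∀ {c t} → c ⟶[ t ] c
        go : ∀ {q ts q′ as d t} → δ′ q (heads ts) ≡ just (q′ , as) →
               (q′ , perform as ts) ⟶[ t ] d → (q , ts) ⟶[ suc t ] d

      ⟶-weaken : ∀ {c d s t} → s ≤ t → c ⟶[ s ] d → c ⟶[ t ] d
      ⟶-weaken s≤t       stop       = stop
      ⟶-weaken (s≤s s≤t) (go e r) = go e (⟶-weaken s≤t r)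

      ⟶-trans : ∀ {b c d s t} → b ⟶[ s ] c → c ⟶[ t ] d → b ⟶[ s + t ] d
      ⟶-trans {b} {d = d} {s} {t} stop q = subst (λ k → b ⟶[ k ] d) (+-comm t s) (grow s q)
        where
        grow : ∀ {c d t} k → c ⟶[ t ] d → c ⟶[ t + k ] d
        grow k stop       = stop
        grow k (go e r) = go e (grow k r)
      ⟶-trans (go e r) q = go e (⟶-trans r q)

      step-keep : ∀ {q q′ ts d t} → δ′ q (heads ts) ≡ just (q′ , Vec.map keep (heads ts)) →
                  (q′ , ts) ⟶[ t ] d → (q , ts) ⟶[ suc t ] d
      step-keep {q′ = q′} {ts} {d} {t} e r = go e (subst (λ us → (q′ , us) ⟶[ t ] d) (sym (perform-keep ts)) r)

      -- The embedding and the exit state vary in the induction, because a subprogram runs inside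
      -- the machine of the whole program and leaves to wherever its context continues.
      simulate : ∀ {P t ts us} (ι : Location P → S) (e : S) →
                 (∀ l ss → δ′ (ι l) ss ≡ just (code P ι e l ss)) →
                 Run P t ts us → (ι (entry P) , ts) ⟶[ t ] (e , us)
      simulate ι e emb prim = go (emb _ _) stop
      simulate {P ⨾ Q} ι e emb (r ⨾ s) =
        ⟶-trans (simulate (ι ∘ inj₁) (ι (inj₂ (entry Q))) (emb ∘ inj₁) r)
                (simulate (ι ∘ inj₂) e (emb ∘ inj₂) s)
      simulate {cond b P Q} {ts = ts} ι e emb (cond-true eq r) =
        step-keep (trans (emb _ _) (cong (λ x → just ((if x then _ else _) , _)) eq))
          (simulate (ι ∘ inj₂ ∘ inj₁) e (emb ∘ inj₂ ∘ inj₁) r)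
      simulate {cond b P Q} ι e emb (cond-false eq r) =
        step-keep (trans (emb _ _) (cong (λ x → just ((if x then _ else _) , _)) eq))
          (simulate (ι ∘ inj₂ ∘ inj₂) e (emb ∘ inj₂ ∘ inj₂) r)
      simulate {while b P} ι e emb (while-stop eq) =
        step-keep (trans (emb _ _) (cong (λ x → just ((if x then _ else _) , _)) eq)) stop
      simulate {while b P} ι e emb (while-more eq r s) =
        step-keep (trans (emb _ _) (cong (λ x → just ((if x then _ else _) , _)) eq))
          (⟶-trans (simulate (ι ∘ inj₂) (ι (inj₁ tt)) (emb ∘ inj₂) r) (simulate ι e emb s))
      simulate ι e emb (weaken s≤t r) = ⟶-weaken s≤t (simulate ι e emb r)

    module _ (P : Prog g n) (verdict : Heads g n → Bool) where

      -- Besides the control points there is one state that evaluates the verdict on the final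
      -- heads, and one halting state for each answer.
      State : Set
      State = Location P ⊎ (⊤ ⊎ Bool)

      finite-State : Finite State
      finite-State = finite-⊎ (finite-Location P) (finite-⊎ finite-⊤ finite-Bool)

      transition : State → Heads g n → Maybe (State × Actions g n)
      transition (inj₁ l)        ss = just (code P inj₁ (inj₂ (inj₁ tt)) l ss)
      transition (inj₂ (inj₁ _)) ss = just (inj₂ (inj₂ (verdict ss)) , Vec.map keep ss)
      transition (inj₂ (inj₂ _)) ss = nothing

      accept : State → Bool
      accept (inj₂ (inj₂ b)) = b
      accept _               = false

      compile : TM n
      compile = record
        { states    = size finite-State
        ; auxiliary = g
        ; start     = to finite-State (inj₁ (entry P))
        ; accepting = accept ∘ from finite-State
        ; δ         = λ q ss → Maybe.map (map₁ (to finite-State)) (transition (from finite-State q) ss)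
        }

      open Simulation transition

      step-just : ∀ {q ts q′ as} → transition q (heads ts) ≡ just (q′ , as) →
                  step compile (to finite-State q , ts) ≡ just (to finite-State q′ , perform as ts)
      step-just {q} {ts} eq rewrite from-to finite-State q | eq = refl

      step-nothing : ∀ {q ts} → transition q (heads ts) ≡ nothing →
                     step compile (to finite-State q , ts) ≡ nothing
      step-nothing {q} {ts} eq rewrite from-to finite-State q | eq = refl

      halts : ∀ {q ts q′ us t} → transition q′ (heads us) ≡ nothing → (q , ts) ⟶[ t ] (q′ , us) →
              HaltsWithin compile t (to finite-State q , ts) (to finite-State q′ , us)
      halts stuck stop       = halt (step-nothing stuck)
      halts stuck (go e r) = next (step-just e) (halts stuck r)

      -- The additional step is the evaluation of the verdict, which leaves the tapes as they are.
      compile-correct : ∀ {ws t us} → Run P t (Vec.map inputTape ws) us →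
        ∃[ c ] HaltsWithin compile (t + 1) (initial compile ws) c
             × proj₂ c ≡ us × accepting compile (proj₁ c) ≡ verdict (heads us)
      compile-correct {ws} {t} {us} r = (to finite-State (inj₂ (inj₂ (verdict (heads us)))) , us) ,
        halts refl (⟶-trans (simulate inj₁ (inj₂ (inj₁ tt)) (λ _ _ → refl) r) (step-keep refl stop)) ,
        refl , cong accept (from-to finite-State (inj₂ (inj₂ (verdict (heads us)))))

-- Closure properties of polynomials.

module Polynomials where

  open import Data.List.Base using ([]; _∷_)
  open import Data.Nat.Base using (ℕ; _+_; _*_; _≤_; z≤n)
  open import Data.Nat.Properties
  open import Data.Nat.Tactic.RingSolver using (solve-∀)
  open import Relation.Binary.PropositionalEquality
  open import Defs using (Polynomial; eval)

  -- Time bounds are written as plain functions and certified as polynomial afterwards, following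
  -- their syntax.
  record PolyFun (f : ℕ → ℕ) : Set where
    constructor polyFun
    field
      poly  : Polynomial
      agree : ∀ n → eval poly n ≡ f n

  open PolyFun public

  eval-mono : ∀ p {m n} → m ≤ n → eval p m ≤ eval p n
  eval-mono []      m≤n = z≤n
  eval-mono (a ∷ p) m≤n = +-monoʳ-≤ a (*-mono-≤ m≤n (eval-mono p m≤n))

  private
    addP : Polynomial → Polynomial → Polynomial
    addP []      q       = q
    addP (a ∷ p) []      = a ∷ p
    addP (a ∷ p) (b ∷ q) = a + b ∷ addP p q

    eval-addP : ∀ p q n → eval (addP p q) n ≡ eval p n + eval q n
    eval-addP []      q       n = refl
    eval-addP (a ∷ p) []      n = sym (+-identityʳ _)
    eval-addP (a ∷ p) (b ∷ q) n = trans (cong (λ z → a + b + n * z) (eval-addP p q n)) (eq a b n (eval p n) (eval q n))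
      where
      eq : ∀ a b n x y → a + b + n * (x + y) ≡ a + n * x + (b + n * y)
      eq = solve-∀

    scaleP : ℕ → Polynomial → Polynomial
    scaleP c []      = []
    scaleP c (a ∷ p) = c * a ∷ scaleP c p

    eval-scaleP : ∀ c p n → eval (scaleP c p) n ≡ c * eval p n
    eval-scaleP c []      n = sym (*-zeroʳ c)
    eval-scaleP c (a ∷ p) n = trans (cong (λ z → c * a + n * z) (eval-scaleP c p n)) (eq c a n (eval p n))
      where
      eq : ∀ c a n x → c * a + n * (c * x) ≡ c * (a + n * x)
      eq = solve-∀

    mulP : Polynomial → Polynomial → Polynomial
    mulP []      q = []
    mulP (a ∷ p) q = addP (scaleP a q) (0 ∷ mulP p q)

    eval-mulP : ∀ p q n → eval (mulP p q) n ≡ eval p n * eval q n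
    eval-mulP []      q n = refl
    eval-mulP (a ∷ p) q n =
      trans (eval-addP (scaleP a q) (0 ∷ mulP p q) n)
        (trans (cong₂ (λ x y → x + n * y) (eval-scaleP a q n) (eval-mulP p q n)) (eq a n (eval p n) (eval q n)))
      where
      eq : ∀ a n x y → a * y + n * (x * y) ≡ (a + n * x) * y
      eq = solve-∀

  poly-const : ∀ c → PolyFun (λ _ → c)
  poly-const c = polyFun (c ∷ []) (λ n → trans (cong (c +_) (*-zeroʳ n)) (+-identityʳ c))

  poly-id : PolyFun (λ n → n)
  poly-id = polyFun (0 ∷ 1 ∷ []) (λ n → trans (cong (λ z → n * (1 + z)) (*-zeroʳ n)) (*-identityʳ n))

  poly-+ : ∀ {f g} → PolyFun f → PolyFun g → PolyFun (λ n → f n + g n)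
  poly-+ F G = polyFun (addP (poly F) (poly G)) (λ n → trans (eval-addP (poly F) (poly G) n) (cong₂ _+_ (agree F n) (agree G n)))

  poly-* : ∀ {f g} → PolyFun f → PolyFun g → PolyFun (λ n → f n * g n)
  poly-* F G = polyFun (mulP (poly F) (poly G)) (λ n → trans (eval-mulP (poly F) (poly G) n) (cong₂ _*_ (agree F n) (agree G n)))

  poly-∘ : ∀ {f g} → PolyFun f → PolyFun g → PolyFun (λ n → f (g n))
  poly-∘ {f} {g} F G = polyFun (poly (comp (poly F)))
    (λ n → trans (agree (comp (poly F)) n) (agree F (g n)))
    where
    -- Horner's scheme, with `g n` in place of the variable.
    comp : ∀ p → PolyFun (λ n → eval p (g n))
    comp []      = poly-const 0
    comp (a ∷ p) = poly-+ (poly-const a) (poly-* G (comp p))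

-- Counter registers on tapes and a timed program logic for them.

module Registers where

  open import Data.Bool.Base using (Bool; true; false; if_then_else_)
  open import Data.Fin.Base using (Fin; zero; suc; toℕ; fromℕ<)
  open import Data.Fin.Properties using (toℕ-fromℕ<; toℕ-injective) renaming (_≟_ to _≟ᶠ_)
  open import Data.List.Base as List using (List; []; _∷_)
  open import Data.Nat.Base using (ℕ; zero; suc; _+_; _≤_; _<_; pred)
  open import Data.Nat.Properties
  open import Data.Product.Base using (∃-syntax; _×_; _,_)
  open import Data.Vec.Base as Vec using (Vec; []; _∷_; lookup; updateAt; tabulate)
  open import Data.Vec.Properties using (lookup-zipWith; lookup∘tabulate; lookup-map; lookup∘updateAt)
  open import Relation.Binary.PropositionalEquality
  open import Relation.Nullary.Decidable using (yes; no; does)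
  open import Relation.Nullary.Negation using (contradiction)
  open import Defs
  open Programs

  nth : ∀ {g} → List (Symbol g) → ℕ → Symbol g
  nth []       _       = blank
  nth (s ∷ ss) zero    = s
  nth (s ∷ ss) (suc i) = nth ss i

  word : ∀ {g} → List Bool → ℕ → Symbol g
  word w = nth (List.map bit w)

  -- The head is at position p of a tape with content f; nothing is said about
  -- the cells at negative positions.
  record At {g} (f : ℕ → Symbol g) (p : ℕ) (t : Tape g) : Set where
    constructor at
    field
      under : scanned t ≡ f p
      ahead : ∀ j → nth (after t) j ≡ f (p + suc j)
      behind : ∀ i j → i + suc j ≡ p → nth (before t) j ≡ f i

  At-right : ∀ {g} {f : ℕ → Symbol g} {p t} → At f p t → At f (suc p) (move right t)
  At-right {f = f} {p} {⟨ ls , s , rs ⟩} (at h n q) = fits rs n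
    where
    before′ : ∀ i j → i + suc j ≡ suc p → nth (s ∷ ls) j ≡ f i
    before′ i zero    eq = trans h (cong f (sym (suc-injective (trans (+-comm 1 i) eq))))
    before′ i (suc j) eq = q i j (suc-injective (trans (sym (+-suc i (suc j))) eq))
    fits : ∀ rs → (∀ j → nth rs j ≡ f (p + suc j)) → At f (suc p) (move right ⟨ ls , s , rs ⟩)
    fits []       n = at (trans (n 0) (cong f (+-comm p 1))) (λ j → trans (n (suc j)) (cong f (+-suc p (suc j)))) before′
    fits (r ∷ rs) n = at (trans (n 0) (cong f (+-comm p 1))) (λ j → trans (n (suc j)) (cong f (+-suc p (suc j)))) before′

  At-left : ∀ {g} {f : ℕ → Symbol g} {p t} → At f (suc p) t → At f p (move left t)
  At-left {f = f} {p} {⟨ ls , s , rs ⟩} (at h n q) = fits ls q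
    where
    after′ : ∀ j → nth (s ∷ rs) j ≡ f (p + suc j)
    after′ zero    = trans h (cong f (+-comm 1 p))
    after′ (suc j) = trans (n j) (cong f (sym (+-suc p (suc j))))
    fits : ∀ ls → (∀ i j → i + suc j ≡ suc p → nth ls j ≡ f i) → At f p (move left ⟨ ls , s , rs ⟩)
    fits []       q = at (q p 0 (+-comm p 1)) after′ (λ i j eq → q i (suc j) (trans (+-suc i (suc j)) (cong suc eq)))
    fits (l ∷ ls) q = at (q p 0 (+-comm p 1)) after′ (λ i j eq → q i (suc j) (trans (+-suc i (suc j)) (cong suc eq)))

  mark : Symbol 1
  mark = aux zero

  -- The content of every register tape. The value of a register is the position of its head, and
  -- the mark at 0 turns the test for zero into a look at the scanned symbol.
  counter : ℕ → Symbol 1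
  counter zero    = mark
  counter (suc _) = blank

  -- Registers are numbered by de Bruijn indices, but lie on the tape given by
  -- their level, so that a new local register leaves the others in place.
  level : ∀ {M} → Fin M → ℕ
  level {suc M} zero    = M
  level {suc M} (suc i) = level i

  level<M : ∀ {M} (i : Fin M) → level i < M
  level<M {suc M} zero    = ≤-refl
  level<M {suc M} (suc i) = m≤n⇒m≤1+n (level<M i)

  -- Levels not in use hold 0.
  value : ∀ {M} → Vec ℕ M → ℕ → ℕ
  value []              j = 0
  value (_∷_ {M} a τ) j with j ≟ M
  ... | yes _ = a
  ... | no  _ = value τ j

  value-unused : ∀ {M} (τ : Vec ℕ M) j → M ≤ j → value τ j ≡ 0
  value-unused []              j M≤j = refl
  value-unused (_∷_ {M} a τ) j M<j with j ≟ M
  ... | yes refl = contradiction M<j (<-irrefl refl)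
  ... | no  _    = value-unused τ j (<⇒≤ M<j)

  value-local : ∀ {M} (τ : Vec ℕ M) j → value (0 ∷ τ) j ≡ value τ j
  value-local {M} τ j with j ≟ M
  ... | yes refl = sym (value-unused τ j ≤-refl)
  ... | no  _    = refl

  value-level : ∀ {M} (τ : Vec ℕ M) i → value τ (level i) ≡ lookup τ i
  value-level (_∷_ {M} a τ) zero with M ≟ M
  ... | yes _ = refl
  ... | no  ne = contradiction refl ne
  value-level (_∷_ {M} a τ) (suc i) with level i ≟ M
  ... | yes eq = contradiction (subst (_< M) eq (level<M i)) (<-irrefl refl)
  ... | no  _  = value-level τ i

  value-other : ∀ {M} (τ : Vec ℕ M) i {f} j → j ≢ level i → value (updateAt τ i f) j ≡ value τ j
  value-other (_∷_ {M} a τ) zero j ne with j ≟ M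
  ... | yes eq = contradiction eq ne
  ... | no  _  = refl
  value-other (_∷_ {M} a τ) (suc i) j ne with j ≟ M
  ... | yes _ = refl
  ... | no  _ = value-other τ i j ne

  -- The input words never change, so `inputs` records only the positions of their heads. `output`
  -- has its latest bit first, since the written part lies to the left of the head.
  record Regs (M : ℕ) : Set where
    constructor ⟪_,_,_⟫
    field
      inputs : Vec ℕ 2
      output : List Bool
      locals : Vec ℕ M

  -- The tapes are the two inputs, the output and K registers.
  module RegisterPrograms (K : ℕ) where

    Program : Set
    Program = Prog 1 (3 + K)

    skip : Program
    skip = prim (Vec.map keep)

    onRegister : Fin K → Move → Heads 1 K → Actions 1 K
    onRegister k m cs = tabulate (λ j → lookup cs j , (if does (j ≟ᶠ k) then m else stay))

    moveRegister : Fin K → Move → Program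
    moveRegister k m = prim (λ { (x ∷ y ∷ o ∷ cs) → keep x ∷ keep y ∷ keep o ∷ onRegister k m cs })

    positive : Fin K → Heads 1 (3 + K) → Bool
    positive k (_ ∷ _ ∷ _ ∷ cs) with lookup cs k
    ... | blank = true
    ... | _     = false

    module Register {M} (M≤K : M ≤ K) (i : Fin M) where

      tape : Fin K
      tape = fromℕ< (<-≤-trans (level<M i) M≤K)

      inc dec : Program
      inc = moveRegister tape right
      dec = moveRegister tape left

      loop : Program → Program
      loop = while (positive tape)

      ifPositive : Program → Program → Program
      ifPositive = cond (positive tape)

    moveHead : Fin 2 → Move → Program
    moveHead zero       m = prim (λ { (x ∷ y ∷ os) → (x , m) ∷ keep y ∷ Vec.map keep os })
    moveHead (suc zero) m = prim (λ { (x ∷ y ∷ os) → keep x ∷ (y , m) ∷ Vec.map keep os })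

    isBit isOne : Symbol 1 → Bool
    isBit (bit _) = true
    isBit _       = false
    isOne (bit true) = true
    isOne _          = false

    scan : (Symbol 1 → Bool) → Fin 2 → Heads 1 (3 + K) → Bool
    scan b zero       (x ∷ _)     = b x
    scan b (suc zero) (_ ∷ y ∷ _) = b y

    emit : Bool → Program
    emit v = prim (λ { (x ∷ y ∷ _ ∷ cs) → keep x ∷ keep y ∷ (bit v , right) ∷ Vec.map keep cs })

  module RegisterSpecs (K : ℕ) (words : Vec (List Bool) 2) where

    open RegisterPrograms K

    data Rep {M : ℕ} : Regs M → Tapes 1 (3 + K) → Set where
      rep : ∀ {h₀ h₁ o τ tx ty} {tc : Vec (Tape 1) K} →
            At (word (lookup words zero)) h₀ tx → At (word (lookup words (suc zero))) h₁ ty →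
            (∀ j → At counter (value τ (toℕ j)) (lookup tc j)) →
            Rep ⟪ h₀ ∷ h₁ ∷ [] , o , τ ⟫ (tx ∷ ty ∷ ⟨ List.map bit o , blank , [] ⟩ ∷ tc)

    infix 4 _∶_⟶[_]_

    -- A Hoare triple with a time bound. It speaks of all tapes that represent the first state,
    -- because these are not unique: cells at negative positions are unspecified.
    _∶_⟶[_]_ : ∀ {M} → Program → Regs M → ℕ → Regs M → Set
    P ∶ s ⟶[ t ] s′ = ∀ {ts} → Rep s ts → ∃[ us ] Run P t ts us × Rep s′ us

    then′ : ∀ {M P Q a b} {r s u : Regs M} → P ∶ r ⟶[ a ] s → Q ∶ s ⟶[ b ] u → P ⨾ Q ∶ r ⟶[ a + b ] u
    then′ p q R with p R
    ... | _ , r₁ , R₁ with q R₁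
    ...   | _ , r₂ , R₂ = _ , r₁ ⨾ r₂ , R₂

    weaken′ : ∀ {M P a b} {r s : Regs M} → a ≤ b → P ∶ r ⟶[ a ] s → P ∶ r ⟶[ b ] s
    weaken′ a≤b p R with p R
    ... | _ , r₁ , R₁ = _ , weaken a≤b r₁ , R₁

    private
      Rep-local : ∀ {M hs o} {τ : Vec ℕ M} {ts} → Rep ⟪ hs , o , τ ⟫ ts → Rep ⟪ hs , o , 0 ∷ τ ⟫ ts
      Rep-local {τ = τ} (rep x y c) =
        rep x y (λ j → subst (λ v → At counter v _) (sym (value-local τ (toℕ j))) (c j))

      Rep-unlocal : ∀ {M hs o} {τ : Vec ℕ M} {ts} → Rep ⟪ hs , o , 0 ∷ τ ⟫ ts → Rep ⟪ hs , o , τ ⟫ ts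
      Rep-unlocal {τ = τ} (rep x y c) =
        rep x y (λ j → subst (λ v → At counter v _) (value-local τ (toℕ j)) (c j))

    -- Opening and closing a local register takes no step: levels not in use hold 0, so a register
    -- that starts and ends with 0 can be added to the description or dropped from it.
    local′ : ∀ {M P t hs hs′ o o′} {τ τ′ : Vec ℕ M} →
             P ∶ ⟪ hs , o , 0 ∷ τ ⟫ ⟶[ t ] ⟪ hs′ , o′ , 0 ∷ τ′ ⟫ → P ∶ ⟪ hs , o , τ ⟫ ⟶[ t ] ⟪ hs′ , o′ , τ′ ⟫
    local′ p R with p (Rep-local R)
    ... | _ , r₁ , R₁ = _ , r₁ , Rep-unlocal R₁

    private
      prim-to : ∀ {f : Heads 1 (3 + K) → Actions 1 (3 + K)} {ts us} →
                perform (f (heads ts)) ts ≡ us → Run (prim f) 1 ts us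
      prim-to refl = prim

    skip′ : ∀ {M} {s : Regs M} → skip ∶ s ⟶[ 1 ] s
    skip′ {ts = ts} R = ts , prim-to (perform-keep ts) , R

    onRegister-same : ∀ k m (tc : Tapes 1 K) →
      lookup (perform (onRegister k m (heads tc)) tc) k ≡ move m (lookup tc k)
    onRegister-same k m tc
      rewrite lookup-zipWith act k (onRegister k m (heads tc)) tc
            | lookup∘tabulate (λ j → lookup (heads tc) j , (if does (j ≟ᶠ k) then m else stay)) k
            | lookup-map k scanned tc with k ≟ᶠ k
    ... | yes _ = refl
    ... | no ne = contradiction refl ne

    onRegister-other : ∀ k m (tc : Tapes 1 K) j → j ≢ k →
      lookup (perform (onRegister k m (heads tc)) tc) j ≡ lookup tc j
    onRegister-other k m tc j ne
      rewrite lookup-zipWith act j (onRegister k m (heads tc)) tc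
            | lookup∘tabulate (λ j → lookup (heads tc) j , (if does (j ≟ᶠ k) then m else stay)) j
            | lookup-map j scanned tc with j ≟ᶠ k
    ... | yes eq = contradiction eq ne
    ... | no _   = refl

    module _ {M} (M≤K : M ≤ K) (i : Fin M) where

      open Register M≤K i

      private
        toℕ-tape : toℕ tape ≡ level i
        toℕ-tape = toℕ-fromℕ< (<-≤-trans (level<M i) M≤K)

        update-Rep : ∀ {τ m f} {tc : Tapes 1 K} →
          (At counter (lookup τ i) (lookup tc tape) → At counter (f (lookup τ i)) (move m (lookup tc tape))) →
          (∀ j → At counter (value τ (toℕ j)) (lookup tc j)) →
          ∀ j → At counter (value (updateAt τ i f) (toℕ j)) (lookup (perform (onRegister tape m (heads tc)) tc) j)
        update-Rep {τ} {m} {f} {tc} g c j with j ≟ᶠ tape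
        ... | yes refl rewrite onRegister-same tape m tc | toℕ-tape | value-level (updateAt τ i f) i | lookup∘updateAt i {f} τ =
          g (subst (λ v → At counter v (lookup tc tape)) (trans (cong (value τ) toℕ-tape) (value-level τ i)) (c tape))
        ... | no ne rewrite onRegister-other tape m tc j ne
                          | value-other τ i {f} (toℕ j) (λ e → ne (toℕ-injective (trans e (sym toℕ-tape)))) = c j

      inc′ : ∀ {hs o τ} → inc ∶ ⟪ hs , o , τ ⟫ ⟶[ 1 ] ⟪ hs , o , updateAt τ i suc ⟫
      inc′ {τ = τ} (rep {tc = tc} x y c) = _ , prim , rep x y (update-Rep {τ} {right} {suc} {tc} At-right c)

      dec′ : ∀ {hs o τ k} → lookup τ i ≡ suc k → dec ∶ ⟪ hs , o , τ ⟫ ⟶[ 1 ] ⟪ hs , o , updateAt τ i pred ⟫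
      dec′ {τ = τ} {k} eq (rep {tc = tc} x y c) = _ , prim , rep x y (update-Rep {τ} {left} {pred} {tc} g c)
        where
        g : At counter (lookup τ i) (lookup tc tape) → At counter (pred (lookup τ i)) (move left (lookup tc tape))
        g a rewrite eq = At-left a

      positive-counter : ∀ {hs o τ ts} → Rep ⟪ hs , o , τ ⟫ ts → ∀ v → lookup τ i ≡ v →
                         positive tape (heads ts) ≡ (if does (v ≟ 0) then false else true)
      positive-counter {τ = τ} (rep {tc = tc} x y c) v eq
        rewrite lookup-map tape scanned tc | At.under (c tape) | toℕ-tape | value-level τ i | eq with v
      ... | zero  = refl
      ... | suc _ = refl

      loop-stop : ∀ {P hs o τ} → lookup τ i ≡ 0 → loop P ∶ ⟪ hs , o , τ ⟫ ⟶[ 1 ] ⟪ hs , o , τ ⟫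
      loop-stop eq R = _ , while-stop (positive-counter R 0 eq) , R

      loop-more : ∀ {P hs o τ a b k} {s u : Regs M} → lookup τ i ≡ suc k →
        P ∶ ⟪ hs , o , τ ⟫ ⟶[ a ] s → loop P ∶ s ⟶[ b ] u → loop P ∶ ⟪ hs , o , τ ⟫ ⟶[ suc (a + b) ] u
      loop-more eq p q R with p R
      ... | _ , r₁ , R₁ with q R₁
      ...   | _ , r₂ , R₂ = _ , while-more (positive-counter R _ eq) r₁ r₂ , R₂

      ifPositive-zero : ∀ {P Q hs o τ a} {s : Regs M} → lookup τ i ≡ 0 →
        Q ∶ ⟪ hs , o , τ ⟫ ⟶[ a ] s → ifPositive P Q ∶ ⟪ hs , o , τ ⟫ ⟶[ suc a ] s
      ifPositive-zero eq q R with q R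
      ... | _ , r₁ , R₁ = _ , cond-false (positive-counter R 0 eq) r₁ , R₁

      ifPositive-suc : ∀ {P Q hs o τ a k} {s : Regs M} → lookup τ i ≡ suc k →
        P ∶ ⟪ hs , o , τ ⟫ ⟶[ a ] s → ifPositive P Q ∶ ⟪ hs , o , τ ⟫ ⟶[ suc a ] s
      ifPositive-suc eq p R with p R
      ... | _ , r₁ , R₁ = _ , cond-true (positive-counter R _ eq) r₁ , R₁

    headRight : ∀ {M} d {hs o} {τ : Vec ℕ M} →
                moveHead d right ∶ ⟪ hs , o , τ ⟫ ⟶[ 1 ] ⟪ updateAt hs d suc , o , τ ⟫
    headRight zero (rep {tx = tx} {ty} {tc} x y c) = _ ,
      prim-to (cong (λ tc′ → move right tx ∷ ty ∷ _ ∷ tc′) (perform-keep tc)) ,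
      rep (At-right x) y c
    headRight (suc zero) (rep {tx = tx} {ty} {tc} x y c) = _ ,
      prim-to (cong (λ tc′ → tx ∷ move right ty ∷ _ ∷ tc′) (perform-keep tc)) ,
      rep x (At-right y) c

    headLeft : ∀ {M} d {hs k o} {τ : Vec ℕ M} → lookup hs d ≡ suc k →
               moveHead d left ∶ ⟪ hs , o , τ ⟫ ⟶[ 1 ] ⟪ updateAt hs d pred , o , τ ⟫
    headLeft zero refl (rep {tx = tx} {ty} {tc} x y c) = _ ,
      prim-to (cong (λ tc′ → move left tx ∷ ty ∷ _ ∷ tc′) (perform-keep tc)) ,
      rep (At-left x) y c
    headLeft (suc zero) refl (rep {tx = tx} {ty} {tc} x y c) = _ ,
      prim-to (cong (λ tc′ → tx ∷ move left ty ∷ _ ∷ tc′) (perform-keep tc)) ,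
      rep x (At-left y) c

    private
      scan-word : ∀ {M} b d {hs o} {τ : Vec ℕ M} {ts} → Rep ⟪ hs , o , τ ⟫ ts →
                  scan b d (heads ts) ≡ b (word (lookup words d) (lookup hs d))
      scan-word b zero       (rep x y c) = cong b (At.under x)
      scan-word b (suc zero) (rep x y c) = cong b (At.under y)

    loopScan-stop : ∀ {M b d P hs o} {τ : Vec ℕ M} → b (word (lookup words d) (lookup hs d)) ≡ false →
                    while (scan b d) P ∶ ⟪ hs , o , τ ⟫ ⟶[ 1 ] ⟪ hs , o , τ ⟫
    loopScan-stop {b = b} {d} eq R = _ , while-stop (trans (scan-word b d R) eq) , R

    loopScan-more : ∀ {M b d P hs o c e} {τ : Vec ℕ M} {s u : Regs M} → b (word (lookup words d) (lookup hs d)) ≡ true →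
      P ∶ ⟪ hs , o , τ ⟫ ⟶[ c ] s → while (scan b d) P ∶ s ⟶[ e ] u →
      while (scan b d) P ∶ ⟪ hs , o , τ ⟫ ⟶[ suc (c + e) ] u
    loopScan-more {b = b} {d} eq p q R with p R
    ... | _ , r₁ , R₁ with q R₁
    ...   | _ , r₂ , R₂ = _ , while-more (trans (scan-word b d R) eq) r₁ r₂ , R₂

    ifScan : ∀ {M b d P Q hs o t} {τ : Vec ℕ M} {s : Regs M} v →
      b (word (lookup words d) (lookup hs d)) ≡ v →
      (if v then P else Q) ∶ ⟪ hs , o , τ ⟫ ⟶[ t ] s → cond (scan b d) P Q ∶ ⟪ hs , o , τ ⟫ ⟶[ suc t ] s
    ifScan {b = b} {d} true eq p R with p R
    ... | _ , r₁ , R₁ = _ , cond-true (trans (scan-word b d R) eq) r₁ , R₁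
    ifScan {b = b} {d} false eq p R with p R
    ... | _ , r₁ , R₁ = _ , cond-false (trans (scan-word b d R) eq) r₁ , R₁

    emit′ : ∀ {M v hs o} {τ : Vec ℕ M} → emit v ∶ ⟪ hs , o , τ ⟫ ⟶[ 1 ] ⟪ hs , v ∷ o , τ ⟫
    emit′ {v = v} (rep {o = o} {tx = tx} {ty} {tc} x y c) = _ ,
      prim-to (cong (λ tc′ → tx ∷ ty ∷ ⟨ bit v ∷ List.map bit o , blank , [] ⟩ ∷ tc′) (perform-keep tc)) ,
      rep x y c

-- Arithmetic terms and their evaluation in polynomial time.

module Terms where

  open import Data.Bool.Base using (Bool; true; false; if_then_else_)
  open import Data.Fin.Base using (Fin; zero; suc)
  open import Data.Fin.Properties renaming (suc-injective to suc-injectiveᶠ) using ()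
  open import Data.List.Base as List using (List; []; _∷_; length)
  open import Data.Nat.Base using (ℕ; zero; suc; _+_; _*_; _∸_; _⊔_; _≤_; _<_; pred; z≤n; s≤s)
  open import Data.Nat.Properties
  open import Data.Product.Base using (_,_)
  open import Data.Vec.Base as Vec using (Vec; []; _∷_; lookup; updateAt)
  open import Data.Vec.Properties
  open import Data.Vec.Relation.Unary.All using (All; []; _∷_)
  open import Function.Base using (const; _∘_)
  open import Relation.Binary.PropositionalEquality
  open import Defs
  open Programs
  open Polynomials
  open Registers

  infixl 6 _⊕_ _⊖_
  infixl 7 _⊗_

  -- For a fixed term the value is at most a polynomial in the variables and the word lengths, which
  -- is why evaluation by unary counters is affordable.
  data Term (m : ℕ) : Set where
    var   : Fin m → Term m
    lit   : ℕ → Term m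
    len   : Fin 2 → Term m
    bitAt : Fin 2 → Term m → Term m
    _⊕_ _⊗_ _⊖_ : Term m → Term m → Term m
    Σ<    : Term m → Term (suc m) → Term m

  -- The last summand is split off because the loop that computes a sum counts down and meets it
  -- first.
  sumBelow : ℕ → (ℕ → ℕ) → ℕ
  sumBelow zero    f = 0
  sumBelow (suc n) f = sumBelow n f + f n

  -- Positions outside the word count as false.
  _‼_ : List Bool → ℕ → Bool
  []      ‼ _     = false
  (b ∷ w) ‼ zero  = b
  (b ∷ w) ‼ suc i = w ‼ i

  toNat : Bool → ℕ
  toNat b = if b then 1 else 0

  toNat≤1 : ∀ b → toNat b ≤ 1
  toNat≤1 true  = ≤-refl
  toNat≤1 false = z≤n

  sumBelow-cong : ∀ n {f g} → (∀ i → f i ≡ g i) → sumBelow n f ≡ sumBelow n g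
  sumBelow-cong zero    eq = refl
  sumBelow-cong (suc n) eq = cong₂ _+_ (sumBelow-cong n eq) (eq n)

  sumBelow-≤ : ∀ n {f c} → (∀ i → i < n → f i ≤ c) → sumBelow n f ≤ n * c
  sumBelow-≤ zero    le = z≤n
  sumBelow-≤ (suc n) {f} {c} le =
    ≤-trans (+-mono-≤ (sumBelow-≤ n (λ i i<n → le i (m≤n⇒m≤1+n i<n))) (le n ≤-refl)) (≤-reflexive (+-comm (n * c) c))

  module Semantics (words : Vec (List Bool) 2) where

    ⟦_⟧ : ∀ {m} → Term m → Vec ℕ m → ℕ
    ⟦ var i ⟧     ρ = lookup ρ i
    ⟦ lit c ⟧     ρ = c
    ⟦ len d ⟧     ρ = length (lookup words d)
    ⟦ bitAt d t ⟧ ρ = toNat (lookup words d ‼ ⟦ t ⟧ ρ)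
    ⟦ s ⊕ t ⟧     ρ = ⟦ s ⟧ ρ + ⟦ t ⟧ ρ
    ⟦ s ⊗ t ⟧     ρ = ⟦ s ⟧ ρ * ⟦ t ⟧ ρ
    ⟦ s ⊖ t ⟧     ρ = ⟦ s ⟧ ρ ∸ ⟦ t ⟧ ρ
    ⟦ Σ< e t ⟧    ρ = sumBelow (⟦ e ⟧ ρ) (λ i → ⟦ t ⟧ (i ∷ ρ))

  -- `B` bounds the variables and the word lengths. The index of a sum is below `bound e B`, so its
  -- body is estimated at `B + bound e B`, which dominates old and new variables alike.
  bound : ∀ {m} → Term m → ℕ → ℕ
  bound (var i)     B = B
  bound (lit c)     B = c
  bound (len d)     B = B
  bound (bitAt d t) B = 1
  bound (s ⊕ t)     B = bound s B + bound t B
  bound (s ⊗ t)     B = bound s B * bound t B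
  bound (s ⊖ t)     B = bound s B
  bound (Σ< e t)    B = bound e B * bound t (B + bound e B)

  bound-poly : ∀ {m} (t : Term m) → PolyFun (bound t)
  bound-poly (var i)     = poly-id
  bound-poly (lit c)     = poly-const c
  bound-poly (len d)     = poly-id
  bound-poly (bitAt d t) = poly-const 1
  bound-poly (s ⊕ t)     = poly-+ (bound-poly s) (bound-poly t)
  bound-poly (s ⊗ t)     = poly-* (bound-poly s) (bound-poly t)
  bound-poly (s ⊖ t)     = bound-poly s
  bound-poly (Σ< e t)    = poly-* (bound-poly e) (poly-∘ (bound-poly t) (poly-+ poly-id (bound-poly e)))

  -- A loop with N rounds costs N times the steps of a round, its test included, plus 1 for the
  -- failing test: 4 stands for a test and three steps, 3 for a test and two, and 2 for the test and
  -- the decrement before the body.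
  cost : ∀ {m} → Term m → ℕ → ℕ
  cost (var i)     B = (B * 4 + 1) + (B * 3 + 1)
  cost (lit c)     B = c + 1
  cost (len d)     B = (B * 4 + 1) + (B * 3 + 1)
  cost (bitAt d t) B = (cost t B + (bound t B * 4 + 1)) + (2 + (bound t B * 3 + 1))
  cost (s ⊕ t)     B = cost s B + cost t B
  cost (s ⊗ t)     B = cost s B + (bound s B * (2 + cost t B) + 1)
  cost (s ⊖ t)     B = cost s B + ((cost t B + (bound t B * 4 + 1)) + (bound s B * 3 + 1))
  cost (Σ< e t)    B = cost e B + (bound e B * (2 + cost t (B + bound e B)) + 1)

  cost-poly : ∀ {m} (t : Term m) → PolyFun (cost t)
  cost-poly (var i)     = poly-+ (poly-+ (poly-* poly-id (poly-const 4)) (poly-const 1)) (poly-+ (poly-* poly-id (poly-const 3)) (poly-const 1))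
  cost-poly (lit c)     = poly-const (c + 1)
  cost-poly (len d)     = poly-+ (poly-+ (poly-* poly-id (poly-const 4)) (poly-const 1)) (poly-+ (poly-* poly-id (poly-const 3)) (poly-const 1))
  cost-poly (bitAt d t) = poly-+ (poly-+ (cost-poly t) (poly-+ (poly-* (bound-poly t) (poly-const 4)) (poly-const 1)))
                            (poly-+ (poly-const 2) (poly-+ (poly-* (bound-poly t) (poly-const 3)) (poly-const 1)))
  cost-poly (s ⊕ t)     = poly-+ (cost-poly s) (cost-poly t)
  cost-poly (s ⊗ t)     = poly-+ (cost-poly s) (poly-+ (poly-* (bound-poly s) (poly-+ (poly-const 2) (cost-poly t))) (poly-const 1))
  cost-poly (s ⊖ t)     = poly-+ (cost-poly s) (poly-+ (poly-+ (cost-poly t) (poly-+ (poly-* (bound-poly t) (poly-const 4)) (poly-const 1)))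
                            (poly-+ (poly-* (bound-poly s) (poly-const 3)) (poly-const 1)))
  cost-poly (Σ< e t)    = poly-+ (cost-poly e) (poly-+ (poly-* (bound-poly e) (poly-+ (poly-const 2)
                            (poly-∘ (cost-poly t) (poly-+ poly-id (bound-poly e))))) (poly-const 1))

  -- Scratch registers in use at the same time. They are returned with value 0, so two operands can
  -- share them, whence the maxima.
  need : ∀ {m} → Term m → ℕ
  need (var i)     = 1
  need (lit c)     = 0
  need (len d)     = 1
  need (bitAt d t) = 2 + need t
  need (s ⊕ t)     = need s ⊔ need t
  need (s ⊗ t)     = 1 + (need s ⊔ need t)
  need (s ⊖ t)     = 1 + (need s ⊔ (1 + need t))
  need (Σ< e t)    = 1 + (need e ⊔ need t)

  private
    bump : ∀ {M} → Fin M → ℕ → Vec ℕ M → Vec ℕ M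
    bump z v τ = updateAt τ z (v +_)

    bump-bump : ∀ {M} z v w (τ : Vec ℕ M) → bump z v (bump z w τ) ≡ bump z (v + w) τ
    bump-bump z v w τ = trans (updateAt-updateAt z τ) (updateAt-cong z (λ a → sym (+-assoc v w a)) τ)

    bump-0 : ∀ {M} z (τ : Vec ℕ M) → bump z 0 τ ≡ τ
    bump-0 z τ = updateAt-id z τ

    env : ∀ {M m} → Vec ℕ M → Vec (Fin M) m → Vec ℕ m
    env τ ν = Vec.map (lookup τ) ν

    env-bump : ∀ {M m z v} {τ : Vec ℕ M} {ν : Vec (Fin M) m} → All (_≢ z) ν → env (bump z v τ) ν ≡ env τ ν
    env-bump []         = refl
    env-bump {τ = τ} (i≢z ∷ a) = cong₂ _∷_ (lookup∘updateAt′ _ _ i≢z τ) (env-bump {τ = τ} a)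

    env-suc : ∀ {M m a} {τ : Vec ℕ M} (ν : Vec (Fin M) m) → env (a ∷ τ) (Vec.map suc ν) ≡ env τ ν
    env-suc {a = a} {τ} ν = sym (map-∘ (lookup (a ∷ τ)) suc ν)

    fresh-suc : ∀ {M m z} {ν : Vec (Fin M) m} → All (_≢ z) ν → All (_≢ suc z) (Vec.map suc ν)
    fresh-suc []        = []
    fresh-suc (ne ∷ a) = ne ∘ suc-injectiveᶠ ∷ fresh-suc a

    fresh-zero : ∀ {M m} (ν : Vec (Fin M) m) → All (_≢ Fin.zero) (Vec.map Fin.suc ν)
    fresh-zero []      = []
    fresh-zero (i ∷ ν) = 1+i≢0 ∷ fresh-zero ν
      where
      1+i≢0 : ∀ {n} {i : Fin n} → suc i ≢ zero
      1+i≢0 ()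

    room : ∀ {a M K} → a + M ≤ K → M ≤ K
    room {a} {M} le = ≤-trans (m≤n+m M a) le

    roomˡ : ∀ a b {M K} → (a ⊔ b) + M ≤ K → a + M ≤ K
    roomˡ a b {M} le = ≤-trans (+-monoˡ-≤ M (m≤m⊔n a b)) le

    roomʳ : ∀ a b {M K} → (a ⊔ b) + M ≤ K → b + M ≤ K
    roomʳ a b {M} le = ≤-trans (+-monoˡ-≤ M (m≤n⊔m a b)) le

    shift : ∀ a {M K} → suc a + M ≤ K → a + suc M ≤ K
    shift a {M} {K} le = subst (_≤ K) (sym (+-suc a M)) le

  module TermPrograms (K : ℕ) where

    open RegisterPrograms K
    open Register

    -- Adds the value of a term to the register z; the variables of the term
    -- are held in the registers ν.
    add : ∀ {M m} (t : Term m) → need t + M ≤ K → Vec (Fin M) m → Fin M → Program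
    add (var i) le ν z =
      -- Reading a register destroys it. Its value is therefore moved to the target and to a scratch
      -- register at once, and then restored from the latter.
      loop le (suc (lookup ν i)) (dec le (suc (lookup ν i)) ⨾ inc le zero ⨾ inc le (suc z)) ⨾
      loop le zero (dec le zero ⨾ inc le (suc (lookup ν i)))
    add (lit zero)    le ν z = skip
    add (lit (suc c)) le ν z = inc le z ⨾ add (lit c) le ν z
    add (len d) le ν z =
      while (scan isBit d) (moveHead d right ⨾ inc le zero ⨾ inc le (suc z)) ⨾
      loop le zero (dec le zero ⨾ moveHead d left)
    add (bitAt d t) le ν z =
      let le₁ = shift (suc (need t)) le ; le₂ = shift (need t) le₁ ; M₁ = room {suc (need t)} le₁ ; M₂ = room {need t} le₂ in
      (add t le₂ (Vec.map suc (Vec.map suc ν)) zero ⨾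
       -- The second scratch register counts the moves of the head, for the way back.
       loop M₂ zero (dec M₂ zero ⨾ inc M₂ (suc zero) ⨾ moveHead d right)) ⨾
      cond (scan isOne d) (inc M₁ (suc z)) skip ⨾
      loop M₁ zero (dec M₁ zero ⨾ moveHead d left)
    add (s ⊕ t) le ν z = add s (roomˡ (need s) (need t) le) ν z ⨾ add t (roomʳ (need s) (need t) le) ν z
    add (s ⊗ t) le ν z =
      let le₁ = shift (need s ⊔ need t) le ; M₁ = room {need s ⊔ need t} le₁ in
      add s (roomˡ (need s) (need t) le₁) (Vec.map suc ν) zero ⨾
      loop M₁ zero (dec M₁ zero ⨾ add t (roomʳ (need s) (need t) le₁) (Vec.map suc ν) (suc z))
    add (s ⊖ t) le ν z =
      let le₁ = shift (need s ⊔ suc (need t)) le ; M₁ = room {need s ⊔ suc (need t)} le₁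
          le₂ = shift (need t) (roomʳ (need s) (suc (need t)) le₁) ; M₂ = room {need t} le₂ in
      add s (roomˡ (need s) (suc (need t)) le₁) (Vec.map suc ν) zero ⨾
      (add t le₂ (Vec.map suc (Vec.map suc ν)) zero ⨾
       loop M₂ zero (dec M₂ zero ⨾ ifPositive M₂ (suc zero) (dec M₂ (suc zero)) skip)) ⨾
      loop M₁ zero (dec M₁ zero ⨾ inc M₁ (suc z))
    add (Σ< e t) le ν z =
      let le₁ = shift (need e ⊔ need t) le ; M₁ = room {need e ⊔ need t} le₁ in
      add e (roomˡ (need e) (need t) le₁) (Vec.map suc ν) zero ⨾
      -- After the decrement the loop counter itself runs through the indices from the largest down
      -- to 0, so it serves as the bound variable.
      loop M₁ zero (dec M₁ zero ⨾ add t (roomʳ (need e) (need t) le₁) (zero ∷ Vec.map suc ν) (suc z))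

  module TermSpecs (K : ℕ) (words : Vec (List Bool) 2) where

    open RegisterSpecs K words public
    open RegisterPrograms K
    open Register
    open TermPrograms K
    open Semantics words

    cast : ∀ {M P t} {r s s′ : Regs M} → s ≡ s′ → P ∶ r ⟶[ t ] s → P ∶ r ⟶[ t ] s′
    cast refl p = p

    cast₀ : ∀ {M P t} {r r′ s : Regs M} → r ≡ r′ → P ∶ r ⟶[ t ] s → P ∶ r′ ⟶[ t ] s
    cast₀ refl p = p

    -- The rule for counting loops: `F j` is the state apart from the counter after j rounds. Time
    -- is measured by any upper bound `N` of the rounds, as only bounds for the values of terms
    -- enter `cost`.
    drainUp : ∀ {M Q N b} (le : suc M ≤ K) (F : ℕ → Regs M) →
      let push = λ k (r : Regs M) → ⟪ Regs.inputs r , Regs.output r , k ∷ Regs.locals r ⟫ in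
      ∀ a → (∀ k j → j < a → Q ∶ push k (F j) ⟶[ b ] push k (F (suc j))) → a ≤ N →
      loop le zero (dec le zero ⨾ Q) ∶ push a (F 0) ⟶[ N * (2 + b) + 1 ] push 0 (F a)
    drainUp {M} {Q} {b = b} le F a q a≤N = draining a 0 (+-identityʳ a) a≤N
      where
      draining : ∀ {N} k j → k + j ≡ a → k ≤ N → loop le zero (dec le zero ⨾ Q) ∶
        ⟪ Regs.inputs (F j) , Regs.output (F j) , k ∷ Regs.locals (F j) ⟫ ⟶[ N * (2 + b) + 1 ]
        ⟪ Regs.inputs (F a) , Regs.output (F a) , 0 ∷ Regs.locals (F a) ⟫
      draining {N} zero j refl k≤N = weaken′ (m≤n+m 1 (N * (2 + b))) (loop-stop le zero refl)
      draining {suc N} (suc k) j eq (s≤s k≤N) =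
        weaken′ (≤-reflexive (sym (+-assoc (2 + b) (N * (2 + b)) 1)))
          (loop-more le zero refl (then′ (dec′ le zero refl) (q k j (≤-trans (s≤s (m≤n+m j k)) (≤-reflexive eq))))
            (draining k (suc j) (trans (+-suc k j) eq) k≤N))

    -- Here `F` is indexed by the rounds still to come, which suits a body that undoes earlier
    -- moves, such as the way back of a head.
    drainDown : ∀ {M Q N b} (le : suc M ≤ K) (F : ℕ → Regs M) →
      let push = λ k (r : Regs M) → ⟪ Regs.inputs r , Regs.output r , k ∷ Regs.locals r ⟫ in
      (∀ k → Q ∶ push k (F (suc k)) ⟶[ b ] push k (F k)) → ∀ k → k ≤ N →
      loop le zero (dec le zero ⨾ Q) ∶ push k (F k) ⟶[ N * (2 + b) + 1 ] push 0 (F 0)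
    drainDown {N = N} {b} le F q zero k≤N = weaken′ (m≤n+m 1 (N * (2 + b))) (loop-stop le zero refl)
    drainDown {N = suc N} {b} le F q (suc k) (s≤s k≤N) =
      weaken′ (≤-reflexive (sym (+-assoc (2 + b) (N * (2 + b)) 1)))
        (loop-more le zero refl (then′ (dec′ le zero refl) (q k)) (drainDown le F q k k≤N))

    zero² : Vec ℕ 2
    zero² = 0 ∷ 0 ∷ []

    ‼-isOne : ∀ w i → isOne (word w i) ≡ w ‼ i
    ‼-isOne []          i       = refl
    ‼-isOne (true ∷ w)  zero    = refl
    ‼-isOne (false ∷ w) zero    = refl
    ‼-isOne (b ∷ w)     (suc i) = ‼-isOne w i

    private
      All-widen : ∀ {m B c} {ρ : Vec ℕ m} → All (_≤ B) ρ → All (_≤ B + c) ρ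
      All-widen []       = []
      All-widen (p ∷ ps) = ≤-trans p (m≤m+n _ _) ∷ All-widen ps

    bound-correct : ∀ {B m} (t : Term m) {ρ} → (∀ d → length (lookup words d) ≤ B) → All (_≤ B) ρ → ⟦ t ⟧ ρ ≤ bound t B
    bound-correct (var zero)    lens (p ∷ ps) = p
    bound-correct (var (suc i)) lens (p ∷ ps) = bound-correct (var i) lens ps
    bound-correct (lit c)       lens ps = ≤-refl
    bound-correct (len d)       lens ps = lens d
    bound-correct (bitAt d t)   lens ps = toNat≤1 _
    bound-correct (s ⊕ t)       lens ps = +-mono-≤ (bound-correct s lens ps) (bound-correct t lens ps)
    bound-correct (s ⊗ t)       lens ps = *-mono-≤ (bound-correct s lens ps) (bound-correct t lens ps)
    bound-correct (s ⊖ t) {ρ}   lens ps = ≤-trans (m∸n≤m _ (⟦ t ⟧ ρ)) (bound-correct s lens ps)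
    bound-correct {B} (Σ< e t) {ρ} lens ps =
      ≤-trans (sumBelow-≤ (⟦ e ⟧ ρ) (λ i i<e → bound-correct t (λ d → ≤-trans (lens d) (m≤m+n B _))
                 (≤-trans (<⇒≤ i<e) (≤-trans (bound-correct e lens ps) (m≤n+m _ B)) ∷ All-widen ps)))
              (*-monoˡ-≤ _ (bound-correct e lens ps))

    private
      module _ {M} (le : suc M ≤ K) (r z : Fin M) (r≢z : r ≢ z) where

        reading : ∀ {hs o N} k a τ → lookup τ r ≡ k → k ≤ N →
          loop le (suc r) (dec le (suc r) ⨾ inc le zero ⨾ inc le (suc z)) ∶
          ⟪ hs , o , a ∷ τ ⟫ ⟶[ N * 4 + 1 ] ⟪ hs , o , k + a ∷ bump z k (updateAt τ r (const 0)) ⟫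
        reading {hs} {o} {N} zero a τ eq _ =
          cast (cong (λ τ′ → ⟪ hs , o , a ∷ τ′ ⟫)
                 (trans (sym (updateAt-id-local r τ (sym eq))) (sym (bump-0 z _))))
            (weaken′ (m≤n+m 1 (N * 4)) (loop-stop le (suc r) eq))
        reading {hs} {o} {suc N} (suc k) a τ eq (s≤s k≤N) =
          cast (cong₂ (λ b τ′ → ⟪ hs , o , b ∷ τ′ ⟫) (+-suc k a) tail)
            (weaken′ (≤-reflexive (sym (+-assoc 4 (N * 4) 1)))
              (loop-more le (suc r) eq
                (then′ (dec′ le (suc r) eq) (then′ (inc′ le zero) (inc′ le (suc z))))
                (reading k (suc a) τ₁ eq₁ k≤N)))
          where
          τ₁ = updateAt (updateAt τ r pred) z suc
          eq₁ : lookup τ₁ r ≡ k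
          eq₁ = trans (lookup∘updateAt′ r z r≢z (updateAt τ r pred))
                  (trans (lookup∘updateAt r τ) (cong pred eq))
          tail : bump z k (updateAt τ₁ r (const 0)) ≡ bump z (suc k) (updateAt τ r (const 0))
          tail = trans (cong (bump z k) (trans (updateAt-commutes r z r≢z (updateAt τ r pred))
                          (cong (bump z 1) (updateAt-updateAt r τ))))
                   (trans (bump-bump z k 1 (updateAt τ r (const 0))) (cong (λ n → bump z n (updateAt τ r (const 0))) (+-comm k 1)))

        restoring : ∀ {hs o N} a τ → a ≤ N →
          loop le zero (dec le zero ⨾ inc le (suc r)) ∶
          ⟪ hs , o , a ∷ τ ⟫ ⟶[ N * 3 + 1 ] ⟪ hs , o , 0 ∷ bump r a τ ⟫
        restoring {hs} {o} a τ a≤N =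
          cast₀ (cong (λ τ′ → ⟪ hs , o , a ∷ τ′ ⟫) (bump-0 r τ))
            (drainUp le (λ j → ⟪ hs , o , bump r j τ ⟫) a
              (λ k j _ → cast (cong (λ τ′ → ⟪ hs , o , k ∷ τ′ ⟫) (bump-bump r 1 j τ)) (inc′ le (suc r))) a≤N)

    private
      lookup-fresh : ∀ {M m z} {ν : Vec (Fin M) m} i → All (_≢ z) ν → lookup ν i ≢ z
      lookup-fresh zero    (p ∷ ps) = p
      lookup-fresh (suc i) (p ∷ ps) = lookup-fresh i ps

      lookup-≤ : ∀ {m B} {ρ : Vec ℕ m} i → All (_≤ B) ρ → lookup ρ i ≤ B
      lookup-≤ zero    (p ∷ ps) = p
      lookup-≤ (suc i) (p ∷ ps) = lookup-≤ i ps

      position : Fin 2 → ℕ → Vec ℕ 2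
      position d n = updateAt zero² d (const n)

      lookup-position : ∀ d n → lookup (position d n) d ≡ n
      lookup-position d n = lookup∘updateAt d zero²

      position-0 : ∀ d → position d 0 ≡ zero²
      position-0 zero       = refl
      position-0 (suc zero) = refl

      position-suc : ∀ d n → updateAt (position d n) d suc ≡ position d (suc n)
      position-suc d n = updateAt-updateAt d zero²

      position-pred : ∀ d n → updateAt (position d (suc n)) d pred ≡ position d n
      position-pred d n = updateAt-updateAt d zero²

      module _ {M} (le : suc M ≤ K) where

        forward : ∀ d {o Q b} {F : ℕ → Vec ℕ M} → (∀ k j hs → Q ∶ ⟪ hs , o , k ∷ F j ⟫ ⟶[ b ] ⟪ hs , o , k ∷ F (suc j) ⟫) →
          ∀ {N} a → a ≤ N → loop le zero (dec le zero ⨾ Q ⨾ moveHead d right) ∶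
          ⟪ zero² , o , a ∷ F 0 ⟫ ⟶[ N * (2 + (b + 1)) + 1 ] ⟪ position d a , o , 0 ∷ F a ⟫
        forward d {o} {F = F} q a a≤N =
          cast₀ (cong (λ hs → ⟪ hs , o , a ∷ F 0 ⟫) (position-0 d))
            (drainUp le (λ j → ⟪ position d j , o , F j ⟫) a
              (λ k j _ → then′ (q k j (position d j))
                 (cast (cong (λ hs → ⟪ hs , o , k ∷ F (suc j) ⟫) (position-suc d j)) (headRight d))) a≤N)

        backward : ∀ d {o τ N} a → a ≤ N → loop le zero (dec le zero ⨾ moveHead d left) ∶
          ⟪ position d a , o , a ∷ τ ⟫ ⟶[ N * 3 + 1 ] ⟪ zero² , o , 0 ∷ τ ⟫
        backward d {o} {τ} a a≤N =
          cast (cong (λ hs → ⟪ hs , o , 0 ∷ τ ⟫) (position-0 d))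
            (drainDown le (λ j → ⟪ position d j , o , τ ⟫)
              (λ k → cast (cong (λ hs → ⟪ hs , o , k ∷ τ ⟫) (position-pred d k)) (headLeft d (lookup-position d (suc k)))) a a≤N)

        measuring : ∀ d {o N} z τ k j → k + j ≡ length (lookup words d) → k ≤ N →
          while (scan isBit d) (moveHead d right ⨾ inc le zero ⨾ inc le (suc z)) ∶
          ⟪ position d j , o , j ∷ τ ⟫ ⟶[ N * 4 + 1 ] ⟪ position d (k + j) , o , k + j ∷ bump z k τ ⟫
        measuring d {o} {N} z τ zero j eq _ =
          cast (cong (λ τ′ → ⟪ position d j , o , j ∷ τ′ ⟫) (sym (bump-0 z τ)))
            (weaken′ (m≤n+m 1 (N * 4)) (loopScan-stop {b = isBit} {d}
              (trans (cong (λ i → isBit (word (lookup words d) i)) (trans (lookup-position d j) eq)) (end (lookup words d)))))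
          where
          end : ∀ w → isBit (word w (length w)) ≡ false
          end []      = refl
          end (b ∷ w) = end w
        measuring d {o} {suc N} z τ (suc k) j eq (s≤s k≤N) =
          cast (trans (cong (λ n → ⟪ position d n , o , n ∷ bump z k (bump z 1 τ) ⟫) (+-suc k j))
                      (cong (λ τ′ → ⟪ position d (suc k + j) , o , suc k + j ∷ τ′ ⟫)
                        (trans (bump-bump z k 1 τ) (cong (λ n → bump z n τ) (+-comm k 1)))))
            (weaken′ (≤-reflexive (sym (+-assoc 4 (N * 4) 1)))
              (loopScan-more {b = isBit} {d}
                (trans (cong (λ i → isBit (word (lookup words d) i)) (lookup-position d j))
                       (inside (lookup words d) j (≤-trans (s≤s (m≤n+m j k)) (≤-reflexive eq))))
                (then′ (cast (cong (λ hs → ⟪ hs , o , j ∷ τ ⟫) (position-suc d j)) (headRight d))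
                       (then′ (inc′ le zero) (inc′ le (suc z))))
                (measuring d z (bump z 1 τ) k (suc j) (trans (+-suc k j) eq) k≤N)))
          where
          inside : ∀ w i → i < length w → isBit (word w i) ≡ true
          inside (b ∷ w) zero    _       = refl
          inside (b ∷ w) (suc i) (s≤s h) = inside w i h

    -- A new register holds 0, so adding to it leaves the value itself. Declared early for the
    -- mutual recursion with `add-correct`.
    add-fresh : ∀ {M m} (t : Term m) (le : need t + suc M ≤ K) (ν : Vec (Fin M) m) →
      ∀ {B o τ} → (∀ d → length (lookup words d) ≤ B) → All (_≤ B) (env τ ν) →
      add t le (Vec.map suc ν) zero ∶ ⟪ zero² , o , 0 ∷ τ ⟫ ⟶[ cost t B ] ⟪ zero² , o , ⟦ t ⟧ (env τ ν) ∷ τ ⟫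

    add-fresh² : ∀ {M m} (t : Term m) (le : need t + suc (suc M) ≤ K) (ν : Vec (Fin M) m) →
      ∀ {B o τ a} → (∀ d → length (lookup words d) ≤ B) → All (_≤ B) (env τ ν) →
      add t le (Vec.map suc (Vec.map suc ν)) zero ∶
      ⟪ zero² , o , 0 ∷ a ∷ τ ⟫ ⟶[ cost t B ] ⟪ zero² , o , ⟦ t ⟧ (env τ ν) ∷ a ∷ τ ⟫

    -- The target must not hold a variable, because the variables are read again while it grows.
    -- Both input heads start and end at position 0, which makes the programs for subterms
    -- composable.
    add-correct : ∀ {M m} (t : Term m) (le : need t + M ≤ K) (ν : Vec (Fin M) m) (z : Fin M) → All (_≢ z) ν →
      ∀ {B o τ} → (∀ d → length (lookup words d) ≤ B) → All (_≤ B) (env τ ν) →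
      add t le ν z ∶ ⟪ zero² , o , τ ⟫ ⟶[ cost t B ] ⟪ zero² , o , bump z (⟦ t ⟧ (env τ ν)) τ ⟫
    add-correct (var i) le ν z fr {B} {o} {τ} lens ps =
      cast (cong (λ τ′ → ⟪ zero² , o , τ′ ⟫) final)
        (local′ (then′ (reading le r z r≢z v 0 τ refl v≤B)
                       (restoring le r z r≢z (v + 0) τ₁ (≤-trans (≤-reflexive (+-identityʳ v)) v≤B))))
      where
      r = lookup ν i
      v = lookup τ r
      r≢z = lookup-fresh i fr
      v≤B : v ≤ B
      v≤B = subst (_≤ B) (lookup-map i (lookup τ) ν) (lookup-≤ i ps)
      τ₁ = bump z v (updateAt τ r (const 0))
      final : bump r (v + 0) τ₁ ≡ bump z (lookup (env τ ν) i) τ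
      final = trans (updateAt-commutes r z r≢z (updateAt τ r (const 0)))
                (trans (cong (bump z v) (trans (updateAt-updateAt r τ) (updateAt-id-local r τ (trans (+-identityʳ (v + 0)) (+-identityʳ v)))))
                  (cong (λ n → bump z n τ) (sym (lookup-map i (lookup τ) ν))))
    add-correct (lit zero) le ν z fr {o = o} {τ} lens ps =
      cast (cong (λ τ′ → ⟪ zero² , o , τ′ ⟫) (sym (bump-0 z τ))) skip′
    add-correct (lit (suc c)) le ν z fr {B} {o = o} {τ} lens ps =
      cast (cong (λ τ′ → ⟪ zero² , o , τ′ ⟫) (trans (bump-bump z c 1 τ) (cong (λ n → bump z n τ) (+-comm c 1))))
        (then′ (inc′ le z) (add-correct (lit c) le ν z fr lens (subst (All (_≤ B)) (sym (env-bump {v = 1} {τ} fr)) ps)))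
    add-correct (len d) le ν z fr {B} {o} {τ} lens ps =
      local′ (then′ (cast₀ (cong (λ hs → ⟪ hs , o , 0 ∷ τ ⟫) (position-0 d))
                      (cast (cong (λ n → ⟪ position d n , o , n ∷ bump z ℓ τ ⟫) (+-identityʳ ℓ))
                        (measuring le d z τ ℓ 0 (+-identityʳ ℓ) (lens d))))
                    (backward le d ℓ (lens d)))
      where ℓ = length (lookup words d)
    add-correct (bitAt d t) le ν z fr {B} {o} {τ} lens ps =
      local′ (then′
        (local′ (then′ (add-fresh² t le₂ ν lens ps)
                       (forward M₂ d {F = λ j → j ∷ τ} (λ k j hs → inc′ M₂ (suc zero)) v v≤)))
        (then′ (ifScan {b = isOne} {d} (lookup words d ‼ v)
                 (trans (cong (λ i → isOne (word (lookup words d) i)) (lookup-position d v)) (‼-isOne (lookup words d) v))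
                 (counted (lookup words d ‼ v)))
               (backward M₁ d v v≤)))
      where
      le₁ = shift (suc (need t)) le
      le₂ = shift (need t) le₁
      M₁ = room {suc (need t)} le₁
      M₂ = room {need t} le₂
      v = ⟦ t ⟧ (env τ ν)
      v≤ = bound-correct t lens ps
      counted : ∀ b → (if b then inc M₁ (suc z) else skip) ∶
                ⟪ position d v , o , v ∷ τ ⟫ ⟶[ 1 ] ⟪ position d v , o , v ∷ bump z (toNat b) τ ⟫
      counted true  = inc′ M₁ (suc z)
      counted false = cast (cong (λ τ′ → ⟪ position d v , o , v ∷ τ′ ⟫) (sym (bump-0 z τ))) skip′
    add-correct (s ⊕ t) le ν z fr {B} {o} {τ} lens ps =
      cast (cong (λ τ′ → ⟪ zero² , o , τ′ ⟫)
             (trans (bump-bump z _ _ τ) (cong (λ n → bump z n τ)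
               (trans (cong (λ ρ → ⟦ t ⟧ ρ + ⟦ s ⟧ (env τ ν)) (env-bump {τ = τ} fr)) (+-comm (⟦ t ⟧ (env τ ν)) _)))))
        (then′ (add-correct s (roomˡ (need s) (need t) le) ν z fr lens ps)
               (add-correct t (roomʳ (need s) (need t) le) ν z fr lens (subst (All (_≤ B)) (sym (env-bump {τ = τ} fr)) ps)))
    add-correct (s ⊗ t) le ν z fr {B} {o} {τ} lens ps =
      local′ (then′ (add-fresh s (roomˡ (need s) (need t) le₁) ν lens ps)
        (cast₀ (cong (λ τ′ → ⟪ zero² , o , ⟦ s ⟧ (env τ ν) ∷ τ′ ⟫) (bump-0 z τ))
          (drainUp M₁ (λ j → ⟪ zero² , o , bump z (j * ⟦ t ⟧ (env τ ν)) τ ⟫) _ (λ k j _ → once k j) (bound-correct s lens ps))))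
      where
      le₁ = shift (need s ⊔ need t) le
      M₁ = room {need s ⊔ need t} le₁
      same : ∀ k j → env (k ∷ bump z j τ) (Vec.map suc ν) ≡ env τ ν
      same k j = trans (env-suc ν) (env-bump {τ = τ} fr)
      once : ∀ k j → add t (roomʳ (need s) (need t) le₁) (Vec.map suc ν) (suc z) ∶
        ⟪ zero² , o , k ∷ bump z (j * ⟦ t ⟧ (env τ ν)) τ ⟫ ⟶[ cost t B ]
        ⟪ zero² , o , k ∷ bump z (suc j * ⟦ t ⟧ (env τ ν)) τ ⟫
      once k j =
        cast (cong (λ τ′ → ⟪ zero² , o , k ∷ τ′ ⟫)
               (trans (cong (λ ρ → bump z (⟦ t ⟧ ρ) _) (same k (j * ⟦ t ⟧ (env τ ν)))) (bump-bump z _ _ τ)))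
          (add-correct t (roomʳ (need s) (need t) le₁) (Vec.map suc ν) (suc z) (fresh-suc fr) lens
            (subst (All (_≤ B)) (sym (same k (j * ⟦ t ⟧ (env τ ν)))) ps))
    add-correct (s ⊖ t) le ν z fr {B} {o} {τ} lens ps =
      local′ (then′ (add-fresh s (roomˡ (need s) (suc (need t)) le₁) ν lens ps)
        (then′ (local′ (then′ (add-fresh² t le₂ ν lens ps)
                 (drainUp M₂ (λ j → ⟪ zero² , o , (a ∸ j) ∷ τ ⟫) b (λ k j _ → lower k j) (bound-correct t lens ps))))
               (cast₀ (cong (λ τ′ → ⟪ zero² , o , a ∸ b ∷ τ′ ⟫) (bump-0 z τ))
                 (drainUp M₁ (λ j → ⟪ zero² , o , bump z j τ ⟫) (a ∸ b)
                   (λ k j _ → cast (cong (λ τ′ → ⟪ zero² , o , k ∷ τ′ ⟫) (bump-bump z 1 j τ)) (inc′ M₁ (suc z)))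
                   (≤-trans (m∸n≤m a b) (bound-correct s lens ps))))))
      where
      le₁ = shift (need s ⊔ suc (need t)) le
      M₁ = room {need s ⊔ suc (need t)} le₁
      le₂ = shift (need t) (roomʳ (need s) (suc (need t)) le₁)
      M₂ = room {need t} le₂
      a = ⟦ s ⟧ (env τ ν)
      b = ⟦ t ⟧ (env τ ν)
      lower : ∀ k j → ifPositive M₂ (suc zero) (dec M₂ (suc zero)) skip ∶
        ⟪ zero² , o , k ∷ a ∸ j ∷ τ ⟫ ⟶[ 2 ] ⟪ zero² , o , k ∷ a ∸ suc j ∷ τ ⟫
      lower k j with a ∸ j in eq
      ... | zero  = cast (cong (λ n → ⟪ zero² , o , k ∷ n ∷ τ ⟫)
                           (sym (trans (sym (pred[m∸n]≡m∸[1+n] a j)) (cong pred eq))))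
                      (ifPositive-zero M₂ (suc zero) refl skip′)
      ... | suc n = cast (cong (λ n → ⟪ zero² , o , k ∷ n ∷ τ ⟫)
                           (sym (trans (sym (pred[m∸n]≡m∸[1+n] a j)) (cong pred eq))))
                      (ifPositive-suc M₂ (suc zero) refl (dec′ M₂ (suc zero) refl))
    add-correct (Σ< e t) le ν z fr {B} {o} {τ} lens ps =
      local′ (then′ (add-fresh e (roomˡ (need e) (need t) le₁) ν lens ps)
                    (summing (⟦ e ⟧ (env τ ν)) τ refl (bound-correct e lens ps) ≤-refl))
      where
      le₁ = shift (need e ⊔ need t) le
      M₁ = room {need e ⊔ need t} le₁
      -- `N` shrinks with the remaining rounds to give the time, while `bound e B` stays fixed, to
      -- keep the index in the range for which the body was estimated.
      summing : ∀ {N} k τ′ → env τ′ ν ≡ env τ ν → k ≤ N → N ≤ bound e B →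
        loop M₁ zero (dec M₁ zero ⨾ add t (roomʳ (need e) (need t) le₁) (zero ∷ Vec.map suc ν) (suc z)) ∶
        ⟪ zero² , o , k ∷ τ′ ⟫ ⟶[ N * (2 + cost t (B + bound e B)) + 1 ]
        ⟪ zero² , o , 0 ∷ bump z (sumBelow k (λ i → ⟦ t ⟧ (i ∷ env τ ν))) τ′ ⟫
      summing {N} zero τ′ eq _ _ =
        cast (cong (λ τ″ → ⟪ zero² , o , 0 ∷ τ″ ⟫) (sym (bump-0 z τ′)))
          (weaken′ (m≤n+m 1 (N * _)) (loop-stop M₁ zero refl))
      summing {suc N} (suc k) τ′ eq (s≤s k≤N) N≤ =
        cast (cong (λ τ″ → ⟪ zero² , o , 0 ∷ τ″ ⟫)
               (trans (bump-bump z _ _ τ′) (cong (λ ρ → bump z (sumBelow k (λ i → ⟦ t ⟧ (i ∷ env τ ν)) + ⟦ t ⟧ (k ∷ ρ)) τ′)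
                  (trans (env-suc ν) eq))))
          (weaken′ (≤-reflexive (sym (+-assoc (2 + cost t (B + bound e B)) (N * (2 + cost t (B + bound e B))) 1)))
            (loop-more M₁ zero refl
              (then′ (dec′ M₁ zero refl)
                (add-correct t (roomʳ (need e) (need t) le₁) (zero ∷ Vec.map suc ν) (suc z)
                  ((λ ()) ∷ fresh-suc fr) (λ d → ≤-trans (lens d) (m≤m+n B _))
                  (≤-trans k≤N (≤-trans (n≤1+n N) (≤-trans N≤ (m≤n+m _ B))) ∷
                   subst (All (_≤ B + bound e B)) (sym (trans (env-suc ν) eq)) (All-widen ps))))
              (summing k (bump z _ τ′) (trans (env-bump {τ = τ′} fr) eq) k≤N (≤-trans (n≤1+n N) N≤))))

    add-fresh t le ν {B} {o} {τ} lens ps =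
      cast (cong (λ n → ⟪ zero² , o , n ∷ τ ⟫) (trans (+-identityʳ _) (cong ⟦ t ⟧ (env-suc ν))))
        (add-correct t le (Vec.map suc ν) zero (fresh-zero ν) lens (subst (All (_≤ B)) (sym (env-suc ν)) ps))

    add-fresh² t le ν {B} {o} {τ} {a} lens ps =
      cast (cong (λ n → ⟪ zero² , o , n ∷ a ∷ τ ⟫) (cong ⟦ t ⟧ (env-suc ν)))
        (add-fresh t le (Vec.map suc ν) lens (subst (All (_≤ B)) (sym (env-suc ν)) ps))

-- Polynomial-time relations and matrix-valued functions from terms.

module PolyTime where

  open import Data.Bool.Base using (Bool; true; false; if_then_else_)
  open import Data.Fin.Base using (Fin; zero; suc; toℕ)
  open import Data.List.Base as List using (List; []; _∷_; _++_; length; applyUpTo; replicate; concat; _ʳ++_)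
  open import Data.List.Properties using (++-ʳ++; applyUpTo-∷ʳ; concat-++; ++-identityʳ; length-++; length-replicate; length-applyUpTo; reverse-involutive; length-reverse)
  open import Data.Nat.Base using (ℕ; zero; suc; _+_; _*_; _⊔_; _≤_; _<_; z≤n; s≤s)
  open import Data.Nat.Properties
  open import Data.Product.Base using (∃-syntax; _×_; _,_)
  open import Data.Vec.Base as Vec using (Vec; []; _∷_; lookup)
  open import Data.Vec.Relation.Unary.All using (All; []; _∷_)
  open import Function.Base using (_∘_)
  open import Relation.Binary.PropositionalEquality
  open import Relation.Nullary.Decidable using (does)
  open import Relation.Nullary.Negation using (contradiction)
  open import Defs
  open Programs
  open Polynomials
  open Registers
  open Terms

  isPositive : ℕ → Bool
  isPositive n = if does (n ≟ 0) then false else true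

  open Semantics using (⟦_⟧)

  private
    At-input : ∀ {g} w → At {g} (word w) 0 (inputTape w)
    At-input []      = at refl (λ j → refl) (λ i j eq → contradiction (trans (sym eq) (+-suc i j)) λ ())
    At-input (b ∷ w) = at refl (λ j → refl) (λ i j eq → contradiction (trans (sym eq) (+-suc i j)) λ ())

    At-counter : At counter 0 ⟨ [] , mark , [] ⟩
    At-counter = at refl (λ j → refl) (λ i j eq → contradiction (trans (sym eq) (+-suc i j)) λ ())

  setup : ∀ K → Prog 1 (3 + K)
  setup K = prim (λ { (x ∷ y ∷ o ∷ cs) → keep x ∷ keep y ∷ keep o ∷ Vec.replicate K (mark , stay) })

  setup-correct : ∀ K x y {M} (τ : Vec ℕ M) → (∀ j → value τ j ≡ 0) →
    ∃[ us ] Run (setup K) 1 (Vec.map inputTape (x ∷ y ∷ Vec.replicate (suc K) [])) us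
          × RegisterSpecs.Rep K (x ∷ y ∷ []) ⟪ 0 ∷ 0 ∷ [] , [] , τ ⟫ us
  setup-correct K x y τ τ≡0 = _ , prim , RegisterSpecs.rep (At-input x) (At-input y)
    (λ j → subst₂ (At counter) (sym (τ≡0 (toℕ j))) (sym (marked K j)) At-counter)
    where
    marked : ∀ K (j : Fin K) →
      lookup (perform (Vec.replicate K (mark , stay)) (Vec.map inputTape (Vec.replicate K []))) j ≡ ⟨ [] , mark , [] ⟩
    marked (suc K) zero    = refl
    marked (suc K) (suc j) = marked K j

  lengths-≤ : ∀ (x y : List Bool) d → length (lookup (x ∷ y ∷ []) d) ≤ length x + length y
  lengths-≤ x y zero       = m≤m+n _ _
  lengths-≤ x y (suc zero) = m≤n+m _ _

  run-PolyTimeRelation : ∀ {K T R} (P : Prog 1 (3 + K)) (verdict : Heads 1 (3 + K) → Bool) → PolyFun T →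
    (∀ x y → ∃[ us ] Run P (T (length x + length y)) (Vec.map inputTape (x ∷ y ∷ Vec.replicate (suc K) [])) us
                   × verdict (heads us) ≡ R x y) → PolyTimeRelation R
  run-PolyTimeRelation {K} P verdict T run = suc K , compile P verdict , poly (poly-+ T (poly-const 1)) , λ x y →
    let us , r , v = run x y
        c , halts , _ , acc = compile-correct P verdict {x ∷ y ∷ Vec.replicate (suc K) []} r
    in c , subst (λ k → HaltsWithin (compile P verdict) k (initial (compile P verdict) (x ∷ y ∷ Vec.replicate (suc K) [])) c)
             (sym (agree (poly-+ T (poly-const 1)) (length x + length y))) halts ,
       trans acc v
    where open Compiler

  run-PolyTimeFunction : ∀ {K T f} (P : Prog 1 (3 + K)) → PolyFun T →
    (∀ x → ∃[ us ] Run P (T (length x)) (Vec.map inputTape (x ∷ [] ∷ Vec.replicate (suc K) [])) us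
                 × outputWord (Vec.head us) ≡ f x) → PolyTimeFunction f
  run-PolyTimeFunction {K} P T run = 2 + K , compile P (λ _ → true) , poly (poly-+ T (poly-const 1)) , λ x →
    let us , r , v = run x
        c , halts , eq , _ = compile-correct P (λ _ → true) {x ∷ [] ∷ Vec.replicate (suc K) []} r
    in c , subst (λ k → HaltsWithin (compile P (λ _ → true)) k (initial (compile P (λ _ → true)) (x ∷ Vec.replicate (2 + K) [])) c)
             (sym (agree (poly-+ T (poly-const 1)) (length x))) halts ,
       trans (cong (outputWord ∘ Vec.head) eq) v
    where open Compiler

  term-PolyTimeRelation : (t : Term 0) → PolyTimeRelation (λ x y → isPositive (⟦_⟧ (x ∷ y ∷ []) t []))
  term-PolyTimeRelation t = run-PolyTimeRelation (setup K ⨾ TermPrograms.add K t ≤-refl [] zero)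
    (RegisterPrograms.positive K (RegisterPrograms.Register.tape K 1≤K zero)) (poly-+ (poly-const 1) (cost-poly t)) (λ x y →
    let us , r , R = setup-correct K x y (0 ∷ []) (value-local [])
        vs , r′ , R′ = TermSpecs.add-correct K (x ∷ y ∷ []) t ≤-refl [] zero [] (lengths-≤ x y) [] R
    in vs , r ⨾ r′ , RegisterSpecs.positive-counter K (x ∷ y ∷ []) 1≤K zero R′ _ (+-identityʳ _))
    where
    K = need t + 1
    1≤K = m≤n+m 1 (need t)

  matrixWord : ℕ → (ℕ → ℕ → Bool) → List Bool
  matrixWord n f = replicate n true ++ false ∷ concat (applyUpTo (λ u → applyUpTo (f u) n) n)

  private
    -- The output after j entries of a row, latest bit first; this recursion follows the loop of the
    -- machine, and `matrixWordʳ-reverse` relates it to the encoding.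
    rowʳ : (ℕ → Bool) → ℕ → List Bool → List Bool
    rowʳ f zero    o = o
    rowʳ f (suc j) o = f j ∷ rowʳ f j o

    rowʳ-applyUpTo : ∀ f j o → rowʳ f j o ≡ applyUpTo f j ʳ++ o
    rowʳ-applyUpTo f zero    o = refl
    rowʳ-applyUpTo f (suc j) o = trans (cong (f j ∷_) (rowʳ-applyUpTo f j o))
      (trans (sym (++-ʳ++ (applyUpTo f j) {f j ∷ []})) (cong (_ʳ++ o) (applyUpTo-∷ʳ f j)))

    rowsʳ : (ℕ → ℕ → Bool) → ℕ → ℕ → List Bool → List Bool
    rowsʳ f n zero    o = o
    rowsʳ f n (suc j) o = rowʳ (f j) n (rowsʳ f n j o)

    rowsʳ-concat : ∀ f n j o → rowsʳ f n j o ≡ concat (applyUpTo (λ u → applyUpTo (f u) n) j) ʳ++ o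
    rowsʳ-concat f n zero    o = refl
    rowsʳ-concat f n (suc j) o = begin
      rowʳ (f j) n (rowsʳ f n j o)          ≡⟨ rowʳ-applyUpTo (f j) n _ ⟩
      rows j ʳ++ rowsʳ f n j o              ≡⟨ cong (rows j ʳ++_) (rowsʳ-concat f n j o) ⟩
      rows j ʳ++ (concat (applyUpTo rows j) ʳ++ o)
        ≡⟨ ++-ʳ++ (concat (applyUpTo rows j)) ⟨
      (concat (applyUpTo rows j) ++ rows j) ʳ++ o
        ≡⟨ cong (λ r → (concat (applyUpTo rows j) ++ r) ʳ++ o) (++-identityʳ (rows j)) ⟨
      (concat (applyUpTo rows j) ++ concat (rows j ∷ [])) ʳ++ o
        ≡⟨ cong (_ʳ++ o) (concat-++ (applyUpTo rows j) (rows j ∷ [])) ⟩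
      concat (applyUpTo rows j List.∷ʳ rows j) ʳ++ o
        ≡⟨ cong (λ r → concat r ʳ++ o) (applyUpTo-∷ʳ rows j) ⟩
      concat (applyUpTo rows (suc j)) ʳ++ o ∎
      where
      open ≡-Reasoning
      rows = λ u → applyUpTo (f u) n

    replicate-applyUpTo : ∀ n → applyUpTo (λ _ → true) n ≡ replicate n true
    replicate-applyUpTo zero    = refl
    replicate-applyUpTo (suc n) = cong (true ∷_) (replicate-applyUpTo n)

    matrixWordʳ : ℕ → (ℕ → ℕ → Bool) → List Bool
    matrixWordʳ n f = rowsʳ f n n (false ∷ rowʳ (λ _ → true) n [])

    matrixWordʳ-reverse : ∀ n f → matrixWordʳ n f ʳ++ [] ≡ matrixWord n f
    matrixWordʳ-reverse n f = begin
      matrixWordʳ n f ʳ++ []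
        ≡⟨ cong (_ʳ++ []) (trans (rowsʳ-concat f n n _) (cong (λ o → concat rows ʳ++ (false ∷ o))
             (trans (rowʳ-applyUpTo _ n []) (cong (_ʳ++ []) (replicate-applyUpTo n))))) ⟩
      (concat rows ʳ++ (false ∷ (replicate n true ʳ++ []))) ʳ++ []
        ≡⟨ cong (_ʳ++ []) (++-ʳ++ (replicate n true) {false ∷ concat rows}) ⟨
      (matrixWord n f ʳ++ []) ʳ++ []
        ≡⟨ reverse-involutive (matrixWord n f) ⟩
      matrixWord n f ∎
      where
      open ≡-Reasoning
      rows = applyUpTo (λ u → applyUpTo (f u) n) n

  module MatrixPrograms (e : Term 0) (t : Term 2) where

    -- Room for the five registers of `cell` and for the scratch registers of either term.
    K : ℕ
    K = (need e ⊔ need t) + 5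

    e-fits : ∀ M → M ≤ 5 → need e + M ≤ K
    e-fits M M≤5 = +-mono-≤ (m≤m⊔n (need e) (need t)) M≤5

    t-fits : need t + 5 ≤ K
    t-fits = +-monoˡ-≤ 5 (m≤n⊔m (need e) (need t))

    fits : ∀ M → M ≤ 5 → M ≤ K
    fits M M≤5 = ≤-trans M≤5 (m≤n+m 5 (need e ⊔ need t))

    1≤5 : 1 ≤ 5
    1≤5 = s≤s z≤n
    2≤5 : 2 ≤ 5
    2≤5 = s≤s (s≤s z≤n)
    3≤5 : 3 ≤ 5
    3≤5 = s≤s (s≤s (s≤s z≤n))
    4≤5 : 4 ≤ 5
    4≤5 = s≤s (s≤s (s≤s (s≤s z≤n)))

    open TermPrograms K
    open RegisterPrograms K
    open Register

    clear : ∀ M → M ≤ 5 → 1 ≤ M → Program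
    clear (suc M) le _ = loop (fits (suc M) le) zero (dec (fits (suc M) le) zero ⨾ skip)

    repeat : ∀ M → M ≤ 5 → 1 ≤ M → Program → Program
    repeat (suc M) le _ Q = add e (e-fits (suc M) le) [] zero ⨾ loop (fits (suc M) le) zero (dec (fits (suc M) le) zero ⨾ Q)

    -- The registers are: value of t, columns left, column, rows left, row.
    cell row matrix : Program
    cell = add t t-fits (suc (suc zero) ∷ suc (suc (suc (suc zero))) ∷ []) zero ⨾
           ifPositive (fits 5 ≤-refl) zero (emit true) (emit false) ⨾
           clear 5 ≤-refl 1≤5
    row = repeat 4 4≤5 (s≤s z≤n) (cell ⨾ inc (fits 4 4≤5) (suc zero)) ⨾ clear 3 3≤5 (s≤s z≤n)
    matrix = repeat 1 1≤5 ≤-refl (emit true) ⨾ emit false ⨾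
             (repeat 2 2≤5 (s≤s z≤n) (row ⨾ inc (fits 2 2≤5) (suc zero)) ⨾ clear 1 1≤5 ≤-refl)

    bitLeft : Heads 1 (3 + K) → Bool
    bitLeft (x ∷ y ∷ o ∷ cs) = isBit o

    unloadBit : Program
    unloadBit = prim (λ { (x ∷ y ∷ o ∷ cs) → (o , left) ∷ keep y ∷ (o , left) ∷ Vec.map keep cs })

    -- Writes the output backwards onto the first tape, to the left of a blank.
    unload : Prog 1 (3 + K)
    unload = prim (λ { (x ∷ y ∷ o ∷ cs) → (blank , left) ∷ keep y ∷ (o , left) ∷ Vec.map keep cs }) ⨾
             while bitLeft unloadBit ⨾
             prim (λ { (x ∷ y ∷ o ∷ cs) → (x , right) ∷ keep y ∷ keep o ∷ Vec.map keep cs })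

    cellCost rowCost matrixCost : ℕ → ℕ
    cellCost B = cost t (B + bound e B) + (2 + (bound t (B + bound e B) * 3 + 1))
    rowCost B = (cost e B + (bound e B * (2 + (cellCost B + 1)) + 1)) + (bound e B * 3 + 1)
    matrixCost B = (cost e B + (bound e B * 3 + 1)) +
      (1 + ((cost e B + (bound e B * (2 + (rowCost B + 1)) + 1)) + (bound e B * 3 + 1)))

    poly-loop : ∀ {f c} → PolyFun f → PolyFun (λ B → f B * c + 1)
    poly-loop F = poly-+ (poly-* F (poly-const _)) (poly-const 1)

    poly-repeat : ∀ {c} → PolyFun c → PolyFun (λ B → cost e B + (bound e B * (2 + (c B + 1)) + 1))
    poly-repeat C = poly-+ (cost-poly e) (poly-+ (poly-* (bound-poly e) (poly-+ (poly-const 2) (poly-+ C (poly-const 1)))) (poly-const 1))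

    cellCost-poly : PolyFun cellCost
    cellCost-poly = poly-+ (poly-∘ (cost-poly t) wide) (poly-+ (poly-const 2) (poly-loop (poly-∘ (bound-poly t) wide)))
      where wide = poly-+ poly-id (bound-poly e)

    rowCost-poly : PolyFun rowCost
    rowCost-poly = poly-+ (poly-repeat cellCost-poly) (poly-loop (bound-poly e))

    matrixCost-poly : PolyFun matrixCost
    matrixCost-poly = poly-+ (poly-+ (cost-poly e) (poly-loop (bound-poly e)))
      (poly-+ (poly-const 1) (poly-+ (poly-repeat rowCost-poly) (poly-loop (bound-poly e))))

    module _ (x : List Bool) {B : ℕ} (x≤B : length x ≤ B) where

      words : Vec (List Bool) 2
      words = x ∷ [] ∷ []

      open TermSpecs K words

      lens : ∀ d → length (lookup words d) ≤ B
      lens zero       = x≤B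
      lens (suc zero) = z≤n

      n : ℕ
      n = ⟦ words ⟧ e []

      f : ℕ → ℕ → Bool
      f u v = isPositive (⟦ words ⟧ t (v ∷ u ∷ []))

      n≤ : n ≤ bound e B
      n≤ = bound-correct e lens []

      clear-correct : ∀ {M} (le : suc M ≤ 5) {o a N} {τ : Vec ℕ M} → a ≤ N →
        clear (suc M) le (s≤s z≤n) ∶ ⟪ zero² , o , a ∷ τ ⟫ ⟶[ N * 3 + 1 ] ⟪ zero² , o , 0 ∷ τ ⟫
      clear-correct le {o} {a} {τ = τ} a≤N = drainDown (fits _ le) (λ _ → ⟪ zero² , o , τ ⟫) (λ k → skip′) a a≤N

      repeat-correct : ∀ {M Q b} (le : suc M ≤ 5) (o : ℕ → List Bool) (τ : ℕ → Vec ℕ M) →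
        (∀ k j → j < n → Q ∶ ⟪ zero² , o j , k ∷ τ j ⟫ ⟶[ b ] ⟪ zero² , o (suc j) , k ∷ τ (suc j) ⟫) →
        repeat (suc M) le (s≤s z≤n) Q ∶ ⟪ zero² , o 0 , 0 ∷ τ 0 ⟫ ⟶[ cost e B + (bound e B * (2 + b) + 1) ]
          ⟪ zero² , o n , 0 ∷ τ n ⟫
      repeat-correct le o τ q =
        then′ (add-fresh e (e-fits _ le) [] lens [])
          (drainUp (fits _ le) (λ j → ⟪ zero² , o j , τ j ⟫) n q n≤)

      cell-correct : ∀ {k v k′ u o} → v ≤ n → u ≤ n →
        cell ∶ ⟪ zero² , o , k ∷ v ∷ k′ ∷ u ∷ [] ⟫ ⟶[ cellCost B ] ⟪ zero² , f u v ∷ o , k ∷ v ∷ k′ ∷ u ∷ [] ⟫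
      cell-correct {k} {v} {k′} {u} {o} v≤n u≤n =
        local′ (then′ (cast (cong (λ a → ⟪ zero² , o , a ∷ _ ⟫) (+-identityʳ c))
                        (add-correct t t-fits _ zero ((λ ()) ∷ (λ ()) ∷ []) wide-lens wide-env))
               (then′ (printing c refl) (clear-correct ≤-refl (bound-correct t wide-lens wide-env))))
        where
        c = ⟦ words ⟧ t (v ∷ u ∷ [])
        wide-lens : ∀ d → length (lookup words d) ≤ B + bound e B
        wide-lens d = ≤-trans (lens d) (m≤m+n B _)
        wide-env : All (_≤ B + bound e B) (v ∷ u ∷ [])
        wide-env = ≤-trans v≤n (≤-trans n≤ (m≤n+m _ B)) ∷ ≤-trans u≤n (≤-trans n≤ (m≤n+m _ B)) ∷ []
        printing : ∀ a → a ≡ c → ifPositive (fits 5 ≤-refl) zero (emit true) (emit false) ∶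
          ⟪ zero² , o , a ∷ k ∷ v ∷ k′ ∷ u ∷ [] ⟫ ⟶[ 2 ] ⟪ zero² , isPositive a ∷ o , a ∷ k ∷ v ∷ k′ ∷ u ∷ [] ⟫
        printing zero    _ = ifPositive-zero (fits 5 ≤-refl) zero refl emit′
        printing (suc a) _ = ifPositive-suc (fits 5 ≤-refl) zero refl emit′

      row-correct : ∀ {k u o} → u ≤ n →
        row ∶ ⟪ zero² , o , k ∷ u ∷ [] ⟫ ⟶[ rowCost B ] ⟪ zero² , rowʳ (f u) n o , k ∷ u ∷ [] ⟫
      row-correct {k} {u} {o} u≤n =
        local′ (then′
          (local′ (repeat-correct 4≤5 (λ j → rowʳ (f u) j o) (λ j → j ∷ k ∷ u ∷ [])
            (λ k′ j j<n → then′ (cell-correct (<⇒≤ j<n) u≤n) (inc′ (fits 4 4≤5) (suc zero)))))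
          (clear-correct 3≤5 n≤))

      matrix-correct : matrix ∶ ⟪ zero² , [] , [] ⟫ ⟶[ matrixCost B ] ⟪ zero² , matrixWordʳ n f , [] ⟫
      matrix-correct =
        then′ (local′ (repeat-correct 1≤5 (λ j → rowʳ (λ _ → true) j []) (λ _ → []) (λ k j _ → emit′)))
        (then′ emit′
          (local′ (then′
            (local′ (repeat-correct 2≤5 (λ j → rowsʳ f n j (false ∷ rowʳ (λ _ → true) n [])) (λ j → j ∷ [])
              (λ k j j<n → then′ (row-correct (<⇒≤ j<n)) (inc′ (fits 2 2≤5) (suc zero)))))
            (clear-correct 1≤5 n≤))))

      length-concat : ∀ j (rows : ℕ → List Bool) → (∀ u → length (rows u) ≡ n) → length (concat (applyUpTo rows j)) ≡ j * n
      length-concat zero    rows eq = refl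
      length-concat (suc j) rows eq =
        trans (length-++ (rows 0)) (cong₂ _+_ (eq 0) (length-concat j (rows ∘ suc) (eq ∘ suc)))

      -- Bounds the time of `unload`, whose loop takes two steps for each written bit.
      length-matrixWordʳ : length (matrixWordʳ n f) ≤ bound e B + suc (bound e B * bound e B)
      length-matrixWordʳ = begin
        length (matrixWordʳ n f)
          ≡⟨ length-reverse (matrixWordʳ n f) ⟨
        length (matrixWordʳ n f ʳ++ [])
          ≡⟨ cong length (matrixWordʳ-reverse n f) ⟩
        length (matrixWord n f)
          ≡⟨ length-++ (replicate n true) ⟩
        length (replicate n true) + suc (length (concat (applyUpTo (λ u → applyUpTo (f u) n) n)))
          ≡⟨ cong₂ (λ a b → a + suc b) (length-replicate n) (length-concat n _ (λ u → length-applyUpTo (f u) n)) ⟩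
        n + suc (n * n)
          ≤⟨ +-mono-≤ n≤ (s≤s (*-mono-≤ n≤ n≤)) ⟩
        bound e B + suc (bound e B * bound e B) ∎
        where open ≤-Reasoning

    private
      after-left : ∀ {g} (t : Tape g) s → after (move left ⟨ before t , s , after t ⟩) ≡ s ∷ after t
      after-left ⟨ [] , _ , rs ⟩     s = refl
      after-left ⟨ l ∷ ls , _ , rs ⟩ s = refl

      leadingBits-word : ∀ w ss → leadingBits {1} (List.map bit w ++ blank ∷ ss) ≡ w
      leadingBits-word []      ss = refl
      leadingBits-word (b ∷ w) ss = cong (b ∷_) (leadingBits-word w ss)

      outputWord-right : ∀ (t : Tape 1) w ss → after t ≡ List.map bit w ++ blank ∷ ss → outputWord (move right t) ≡ w
      outputWord-right ⟨ ls , s , _ ⟩ []      ss refl = refl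
      outputWord-right ⟨ ls , s , _ ⟩ (b ∷ w) ss refl = cong (b ∷_) (leadingBits-word w ss)

      prim-to : ∀ {f : Heads 1 (3 + K) → Actions 1 (3 + K)} {ts us} →
                perform (f (heads ts)) ts ≡ us → Run (prim f) 1 ts us
      prim-to refl = prim

      -- The head of the first tape moves left over arbitrary cells. The invariant concerns only
      -- what lies to its right: the bits unloaded so far, closed by the blank at which the output
      -- word ends.
      unloading : ∀ o w {tx ty s rs ss tc} → after tx ≡ List.map bit w ++ blank ∷ ss →
        ∃[ tx′ ] ∃[ to ] Run (while bitLeft unloadBit) (length o * 2 + 1) (tx ∷ ty ∷ move left ⟨ List.map bit o , s , rs ⟩ ∷ tc) (tx′ ∷ ty ∷ to ∷ tc)
                       × after tx′ ≡ List.map bit (o ʳ++ w) ++ blank ∷ ss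
      unloading []      w eq = _ , _ , while-stop refl , eq
      unloading (b ∷ o) w {tx} {ty} {s} {rs} {ss} {tc} eq =
        let tx′ , to , r , eq′ = unloading o (b ∷ w) {move left ⟨ before tx , bit b , after tx ⟩} {ty} {bit b} {s ∷ rs} {ss} {tc}
                                   (trans (after-left tx (bit b)) (cong (bit b ∷_) eq))
        in tx′ , to , while-more refl (prim-to (cong (λ tc′ → _ ∷ ty ∷ _ ∷ tc′) (perform-keep tc))) r , eq′

    unload-correct : ∀ o {tx ty tc} → ∃[ tx′ ] ∃[ ts ]
      Run unload (1 + ((length o * 2 + 1) + 1)) (tx ∷ ty ∷ ⟨ List.map bit o , blank , [] ⟩ ∷ tc) (tx′ ∷ ts)
      × outputWord tx′ ≡ o ʳ++ []
    unload-correct o {tx} {ty} {tc} =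
      let tx′ , to , r , eq = unloading o [] {move left ⟨ before tx , blank , after tx ⟩} {ty} {blank} {[]} {after tx} {tc}
                                (after-left tx blank)
      in move right tx′ , ty ∷ to ∷ tc ,
         prim-to (cong (λ tc′ → _ ∷ ty ∷ _ ∷ tc′) (perform-keep tc)) ⨾ r ⨾
         prim-to (cong (λ tc′ → move right tx′ ∷ ty ∷ to ∷ tc′) (perform-keep tc)) ,
         outputWord-right tx′ (o ʳ++ []) (after tx) eq

    totalCost : ℕ → ℕ
    totalCost B = 1 + (matrixCost B + (1 + (((bound e B + suc (bound e B * bound e B)) * 2 + 1) + 1)))

    matrix-time : PolyFun totalCost
    matrix-time = poly-+ (poly-const 1) (poly-+ matrixCost-poly (poly-+ (poly-const 1) (poly-+
             (poly-loop (poly-+ (bound-poly e) (poly-+ (poly-const 1) (poly-* (bound-poly e) (bound-poly e))))) (poly-const 1))))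

    Writes : List Bool → Set
    Writes x = ∃[ us ] Run (setup K ⨾ matrix ⨾ unload) (totalCost (length x))
                         (Vec.map inputTape (x ∷ [] ∷ Vec.replicate (suc K) [])) us
                     × outputWord (Vec.head us) ≡ matrixWord (n x ≤-refl) (f x ≤-refl)

    run-matrix : ∀ x → Writes x
    run-matrix x =
      let us , r , R = setup-correct K x [] [] (λ _ → refl)
          vs , r′ , R′ = matrix-correct x ≤-refl R
      in finish r r′ R′
      where
      finish : ∀ {us vs} → Run (setup K) 1 (Vec.map inputTape (x ∷ [] ∷ Vec.replicate (suc K) [])) us →
        Run matrix (matrixCost (length x)) us vs →
        RegisterSpecs.Rep K (x ∷ [] ∷ []) ⟪ 0 ∷ 0 ∷ [] , matrixWordʳ (n x ≤-refl) (f x ≤-refl) , [] ⟫ vs → Writes x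
      finish r r′ (RegisterSpecs.rep {tx = tx} {ty} {tc} _ _ _) =
        let tx′ , ts , r″ , out = unload-correct (matrixWordʳ (n x ≤-refl) (f x ≤-refl)) {tx} {ty} {tc}
        in tx′ ∷ ts ,
           r ⨾ r′ ⨾ weaken (s≤s (+-monoˡ-≤ 1 (+-monoˡ-≤ 1 (*-monoˡ-≤ 2 (length-matrixWordʳ x ≤-refl))))) r″ ,
           trans out (matrixWordʳ-reverse (n x ≤-refl) (f x ≤-refl))

  matrix-PolyTimeFunction : (e : Term 0) (t : Term 2) → PolyTimeFunction (λ x →
    matrixWord (⟦ x ∷ [] ∷ [] ⟧ e []) (λ u v → isPositive (⟦ x ∷ [] ∷ [] ⟧ t (v ∷ u ∷ []))))
  matrix-PolyTimeFunction e t = run-PolyTimeFunction (setup K ⨾ matrix ⨾ unload) matrix-time run-matrix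
    where open MatrixPrograms e t

-- Cardinalities and maxima over finite index sets.

module Counting where

  open import Data.Bool.Base using (Bool; true; false; T; not; _∧_)
  open import Data.Fin.Base using (Fin; zero; suc)
  open import Data.Fin.Properties using (_≟_)
  open import Data.Fin.Subset using (∣_∣)
  open import Data.List.Base using ([]; _∷_; map)
  open import Data.Nat.ListAction using (sum)
  open import Data.List.Membership.Propositional using (_∈_)
  open import Data.List.Relation.Unary.All as All using (All; []; _∷_)
  open import Data.List.Relation.Unary.AllPairs using ([]; _∷_)
  open import Data.List.Relation.Unary.Any using (here; there)
  open import Data.List.Relation.Unary.Unique.Propositional using (Unique)
  open import Data.Nat.Base using (ℕ; zero; suc; _+_; _≤_; _<_; _⊔_; z≤n)
  open import Data.Nat.Properties using (+-comm; +-assoc; ⊔-lub; m≤m⊔n; m≤n⊔m; ≤-trans)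
  open import Data.Nat.Tactic.RingSolver using (solve-∀)
  open import Data.Product.Base using (∃-syntax; _,_)
  open import Data.Unit.Base using (tt)
  import Data.Vec.Base as Vec
  import Data.Vec.Functional as Functional
  open import Function.Base using (_∘_)
  open import Relation.Binary.PropositionalEquality
  open import Relation.Nullary.Decidable using (yes; no; does)
  open import Relation.Nullary.Negation using (contradiction)
  open Terms using (toNat; sumBelow)

  # : ∀ {n} → (Fin n → Bool) → ℕ
  # f = ∣ Vec.tabulate f ∣

  #-suc : ∀ {n} (f : Fin (suc n) → Bool) → # f ≡ toNat (f zero) + # (f ∘ suc)
  #-suc f with f zero
  ... | true  = refl
  ... | false = refl

  #-+ : ∀ {n} {f g h : Fin n → Bool} → (∀ i → toNat (f i) + toNat (g i) ≡ toNat (h i)) → # f + # g ≡ # h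
  #-+ {zero}  eq = refl
  #-+ {suc n} {f} {g} {h} eq
    rewrite #-suc f | #-suc g | #-suc h | sym (#-+ {f = f ∘ suc} {g ∘ suc} {h ∘ suc} (eq ∘ suc)) | sym (eq zero) =
    swap (toNat (f zero)) (# (f ∘ suc)) (toNat (g zero)) (# (g ∘ suc))
    where
    swap : ∀ a b c d → (a + b) + (c + d) ≡ (a + c) + (b + d)
    swap = solve-∀

  #-cong : ∀ {n} {f g : Fin n → Bool} → (∀ i → f i ≡ g i) → # f ≡ # g
  #-cong {zero}  eq = refl
  #-cong {suc n} {f} {g} eq = trans (#-suc f) (trans (cong₂ (λ a b → toNat a + b) (eq zero) (#-cong (eq ∘ suc))) (sym (#-suc g)))

  #-empty : ∀ {n} {f : Fin n → Bool} → (∀ i → f i ≡ false) → # f ≡ 0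
  #-empty {zero}  eq = refl
  #-empty {suc n} {f} eq = trans (#-suc f) (cong₂ _+_ (cong toNat (eq zero)) (#-empty (eq ∘ suc)))

  #-nonempty : ∀ {n} (f : Fin n → Bool) → 0 < # f → ∃[ i ] T (f i)
  #-nonempty {suc n} f pos with f zero in eq
  ... | true  = zero , subst T (sym eq) tt
  ... | false with #-nonempty (f ∘ suc) pos
  ...   | i , p = suc i , p

  #-remove : ∀ {n} (f : Fin n → Bool) i → # f ≡ toNat (f i) + # (λ j → f j ∧ not (does (i ≟ j)))
  #-remove f zero = trans (#-suc f) (cong (toNat (f zero) +_)
    (sym (trans (#-suc (λ j → f j ∧ not (does (zero ≟ j)))) (cong₂ _+_ (cong toNat (∧-false (f zero))) (#-cong (∧-true ∘ f ∘ suc))))))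
    where
    ∧-false : ∀ b → b ∧ false ≡ false
    ∧-false true  = refl
    ∧-false false = refl
    ∧-true : ∀ b → b ∧ true ≡ b
    ∧-true true  = refl
    ∧-true false = refl
  #-remove f (suc i) = begin
    # f                                                          ≡⟨ #-suc f ⟩
    a + # (f ∘ suc)                                              ≡⟨ cong (a +_) (#-remove (f ∘ suc) i) ⟩
    a + (b + c)                                                  ≡⟨ swap a b c ⟩
    b + (a + c)                                                  ≡⟨ cong (λ z → b + (toNat z + c)) (∧-true (f zero)) ⟨
    b + (toNat (f zero ∧ true) + c)                              ≡⟨ cong (b +_) (#-suc (λ j → f j ∧ not (does (suc i ≟ j)))) ⟨
    b + # (λ j → f j ∧ not (does (suc i ≟ j)))                   ∎
    where
    open ≡-Reasoning
    a = toNat (f zero)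
    b = toNat (f (suc i))
    c = # (λ j → f (suc j) ∧ not (does (i ≟ j)))
    swap : ∀ a b c → a + (b + c) ≡ b + (a + c)
    swap = solve-∀
    ∧-true : ∀ b → b ∧ true ≡ b
    ∧-true true  = refl
    ∧-true false = refl

  -- Removing the listed elements one by one leaves an empty support. This reduces degrees and
  -- in-degrees to a sum over the four neighbours of a vertex.
  #-list : ∀ {n} (f : Fin n → Bool) ws → Unique ws → (∀ i → T (f i) → i ∈ ws) → # f ≡ sum (map (toNat ∘ f) ws)
  #-list f []       []        sup = #-empty (λ i → none i (f i) refl)
    where
    none : ∀ i b → f i ≡ b → b ≡ false
    none i true  eq with () ← sup i (subst T (sym eq) tt)
    none i false eq = refl
  #-list f (w ∷ ws) (w∉ ∷ uniq) sup =
    trans (#-remove f w) (cong (toNat (f w) +_)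
      (trans (#-list f′ ws uniq sup′) (cong sum (same ws w∉))))
    where
    f′ = λ j → f j ∧ not (does (w ≟ j))
    sup′ : ∀ i → T (f′ i) → i ∈ ws
    sup′ i p with f i in eq | w ≟ i
    ... | true | no w≢i with sup i (subst T (sym eq) tt)
    ...   | here refl = contradiction refl w≢i
    ...   | there i∈  = i∈
    same : ∀ ws → All (w ≢_) ws → map (toNat ∘ f′) ws ≡ map (toNat ∘ f) ws
    same []       []        = refl
    same (v ∷ vs) (ne ∷ a) with w ≟ v
    ... | yes eq = contradiction eq ne
    ... | no _   with f v
    ...   | true  = cong (1 ∷_) (same vs a)
    ...   | false = cong (0 ∷_) (same vs a)

  module _ where
    open import Data.Fin.Base using (toℕ)

    sumBelow-suc : ∀ n f → sumBelow (suc n) f ≡ f 0 + sumBelow n (f ∘ suc)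
    sumBelow-suc zero    f = +-comm 0 (f 0)
    sumBelow-suc (suc n) f = trans (cong (_+ f (suc n)) (sumBelow-suc n f)) (+-assoc (f 0) _ _)

    #-sumBelow : ∀ {n} (f : ℕ → Bool) → # {n} (f ∘ toℕ) ≡ sumBelow n (toNat ∘ f)
    #-sumBelow {zero}  f = refl
    #-sumBelow {suc n} f = trans (#-suc {n} (f ∘ toℕ))
      (trans (cong (toNat (f 0) +_) (#-sumBelow {n} (f ∘ suc))) (sym (sumBelow-suc n (toNat ∘ f))))

  max-upper : ∀ {n} (f : Fin n → ℕ) i → f i ≤ Functional.foldr _⊔_ 0 f
  max-upper f zero    = m≤m⊔n _ _
  max-upper f (suc i) = ≤-trans (max-upper (f ∘ suc) i) (m≤n⊔m (f zero) _)

  max-least : ∀ {n} (f : Fin n → ℕ) {b} → (∀ i → f i ≤ b) → Functional.foldr _⊔_ 0 f ≤ b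
  max-least {zero}  f le = z≤n
  max-least {suc n} f le = ⊔-lub (le zero) (max-least (f ∘ suc) (le ∘ suc))

-- In-out-proper orientations of 4-regular graphs in terms of in-degrees.

module Orientations where

  open import Data.Bool.Base using (true; false; T; not)
  open import Data.Empty using (⊥-elim)
  open import Data.Integer.Base as ℤ using (+_)
  open import Data.Nat.Base using (ℕ; _+_; _∸_; _≤_; _<_; z≤n; s≤s)
  open import Data.Nat.Properties using (+-comm; ≤-trans; m+n∸m≡n; _≟_)
  open import Data.Product.Base using (Σ-syntax; _×_; _,_)
  open import Data.Unit.Base using (tt)
  open import Function.Bundles using (_⇔_; mk⇔)
  open import Relation.Binary.PropositionalEquality
  open import Relation.Nullary.Decidable using (yes; no)
  open import Relation.Nullary.Negation using (¬_; contradiction)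
  open import Defs
  open Terms using (toNat)
  open Counting

  open Orientation using (arc; arc⇒adj; exactly-one; d⁻; d⁺; d±)

  -- In the 4-regular case this replaces the integers and the minimum of the definition; it is also
  -- what the verifier checks.
  Balanced : (G : Graph) → Orientation G → Set
  Balanced G D = (∀ v → 1 ≤ d⁻ D v × d⁻ D v ≤ 3) × (∀ u v → T (adj G u v) → d⁻ D u ≢ d⁻ D v)

  arc-adj : ∀ {G} (D : Orientation G) u v → toNat (arc D u v) + toNat (arc D v u) ≡ toNat (adj G u v)
  arc-adj {G} D u v with adj G u v in a
  ... | true = one (arc D u v) (arc D v u) (exactly-one D u v (subst T (sym a) tt))
    where
    one : ∀ p q → p ≡ not q → toNat p + toNat q ≡ 1
    one _ true  refl = refl
    one _ false refl = refl
  ... | false = zero′ (arc D u v) (arc D v u) (λ p → subst T a (arc⇒adj D u v p))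
                  (λ p → subst T (trans (Graph.adj-sym G v u) a) (arc⇒adj D v u p))
    where
    zero′ : ∀ p q → ¬ T p → ¬ T q → toNat p + toNat q ≡ 0
    zero′ true  q     np nq = ⊥-elim (np tt)
    zero′ false true  np nq = ⊥-elim (nq tt)
    zero′ false false np nq = refl

  d⁻+d⁺ : ∀ {G} (D : Orientation G) v → d⁻ D v + d⁺ D v ≡ degree G v
  d⁻+d⁺ {G} D v = #-+ (λ u → trans (+-comm (toNat (arc D u v)) _) (arc-adj D v u))

  private
    -- For a + b = 4 this is |2a - 4|, so it takes only the values 0, 2 and 4, and a bound of 3 is
    -- as good as 2.
    gap : ℕ → ℕ → ℕ
    gap a b = ℤ.∣ + a ℤ.- + b ∣

    gap≤3 : ∀ a b → a + b ≡ 4 → gap a b ≤ 3 → 1 ≤ a × a ≤ 3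
    gap≤3 0 _ refl (s≤s (s≤s (s≤s ())))
    gap≤3 1 _ refl _ = s≤s z≤n , s≤s z≤n
    gap≤3 2 _ refl _ = s≤s z≤n , s≤s (s≤s z≤n)
    gap≤3 3 _ refl _ = s≤s z≤n , s≤s (s≤s (s≤s z≤n))
    gap≤3 4 _ refl (s≤s (s≤s (s≤s ())))

    gap≤2 : ∀ a b → a + b ≡ 4 → 1 ≤ a × a ≤ 3 → gap a b ≤ 2
    gap≤2 1 _ refl _ = s≤s (s≤s z≤n)
    gap≤2 2 _ refl _ = z≤n
    gap≤2 3 _ refl _ = s≤s (s≤s z≤n)
    gap≤2 4 _ refl (_ , s≤s (s≤s (s≤s ())))

    gap≥2 : ∀ a b → a + b ≡ 4 → a ≢ 2 → 2 ≤ gap a b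
    gap≥2 0 _ refl _ = s≤s (s≤s z≤n)
    gap≥2 1 _ refl _ = s≤s (s≤s z≤n)
    gap≥2 2 _ refl ne = contradiction refl ne
    gap≥2 3 _ refl _ = s≤s (s≤s z≤n)
    gap≥2 4 _ refl _ = s≤s (s≤s z≤n)

  module _ {G : Graph} (regular : Regular 4 G) where

    private
      total : (D : Orientation G) → ∀ v → d⁻ D v + d⁺ D v ≡ 4
      total D v = trans (d⁻+d⁺ D v) (regular v)

      d⁺≡ : (D : Orientation G) → ∀ v → d⁺ D v ≡ 4 ∸ d⁻ D v
      d⁺≡ D v = trans (sym (m+n∸m≡n (d⁻ D v) (d⁺ D v))) (cong (_∸ d⁻ D v) (total D v))

      d±-from-d⁻ : (D : Orientation G) → ∀ u v → d⁻ D u ≡ d⁻ D v → d± D u ≡ d± D v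
      d±-from-d⁻ D u v eq = cong₂ (λ a b → + a ℤ.- + b) eq
        (trans (d⁺≡ D u) (trans (cong (4 ∸_) eq) (sym (d⁺≡ D v))))

      two≤ : (D : Orientation G) → ∀ v → d⁻ D v ≢ 2 → 2 ≤ max∣d±∣ D
      two≤ D v ne = ≤-trans (gap≥2 (d⁻ D v) (d⁺ D v) (total D v) ne) (max-upper (λ v → ℤ.∣ d± D v ∣) v)

      -- Adjacent vertices have different in-degrees, so one of them is not 2.
      two≤max : (D : Orientation G) → InOutProper D → Vertex G → 2 ≤ max∣d±∣ D
      two≤max D proper v with #-nonempty (adj G v) (subst (0 <_) (sym (regular v)) (s≤s z≤n))
      ... | w , v~w with d⁻ D v ≟ 2 | d⁻ D w ≟ 2
      ...   | no ne | _     = two≤ D v ne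
      ...   | yes _ | no ne = two≤ D w ne
      ...   | yes p | yes q = contradiction (d±-from-d⁻ D v w (trans p (sym q))) (proper v w v~w)

    -- The definition asks for a minimum and not just for an orientation within the bound. A
    -- balanced orientation attains it: its maximum is at most 2, and with at least one vertex no
    -- in-out-proper orientation stays below 2.
    χ≤3⇔Balanced : χ↔[ G ]≤ 3 ⇔ (Σ[ D ∈ Orientation G ] Balanced G D)
    χ≤3⇔Balanced = mk⇔ to from
      where
      to : χ↔[ G ]≤ 3 → Σ[ D ∈ Orientation G ] Balanced G D
      to (k , ((D , proper , refl) , _) , k≤3) = D ,
        (λ v → gap≤3 (d⁻ D v) (d⁺ D v) (total D v) (≤-trans (max-upper (λ v → ℤ.∣ d± D v ∣) v) k≤3)) ,
        (λ u v u~v eq → proper u v u~v (d±-from-d⁻ D u v eq))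
      from : Σ[ D ∈ Orientation G ] Balanced G D → χ↔[ G ]≤ 3
      from (D , bounds , differ) = max∣d±∣ D , ((D , proper , refl) , least) ,
        max-least _ (λ v → ≤-trans (small v) (s≤s (s≤s z≤n)))
        where
        small : ∀ v → ℤ.∣ d± D v ∣ ≤ 2
        small v = gap≤2 (d⁻ D v) (d⁺ D v) (total D v) (bounds v)
        least : ∀ D′ → InOutProper D′ → max∣d±∣ D ≤ max∣d±∣ D′
        least D′ proper′ = max-least _ (λ v → ≤-trans (small v) (two≤max D′ proper′ v))
        decode : ∀ a b c d → a + b ≡ 4 → c + d ≡ 4 → 1 ≤ a × a ≤ 3 → 1 ≤ c × c ≤ 3 →
                 + a ℤ.- + b ≡ + c ℤ.- + d → a ≡ c
        decode 1 _ 1 _ refl refl _ _ eq = refl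
        decode 1 _ 2 _ refl refl _ _ ()
        decode 1 _ 3 _ refl refl _ _ ()
        decode 2 _ 1 _ refl refl _ _ ()
        decode 2 _ 2 _ refl refl _ _ eq = refl
        decode 2 _ 3 _ refl refl _ _ ()
        decode 3 _ 1 _ refl refl _ _ ()
        decode 3 _ 2 _ refl refl _ _ ()
        decode 3 _ 3 _ refl refl _ _ eq = refl
        decode 4 _ _ _ refl _ (_ , s≤s (s≤s (s≤s ()))) _ _
        decode _ _ 4 _ _ refl _ (_ , s≤s (s≤s (s≤s ()))) _
        proper : InOutProper D
        proper u v u~v eq = differ u v u~v
          (decode (d⁻ D u) (d⁺ D u) (d⁻ D v) (d⁺ D v) (total D u) (total D v) (bounds u) (bounds v) eq)

-- First-order formulas with bounded quantifiers as terms.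

module Formulas where

  open import Data.Bool.Base using (true; false; T)
  open import Data.List.Base using (List; []; _∷_; foldr)
  open import Data.List.Relation.Unary.Any using (Any; here; there)
  open import Data.Nat.Base using (ℕ; zero; suc; _+_; _*_; _∸_; _≤_; _<_; z≤n; s≤s)
  open import Data.Nat.Properties
  open import Data.Product.Base using (∃-syntax; _×_; _,_)
  open import Data.Sum.Base using (_⊎_; inj₁; inj₂)
  open import Data.Unit.Base using (tt)
  open import Function.Bundles using (_⇔_; mk⇔; Equivalence)
  open import Relation.Binary.PropositionalEquality
  open import Relation.Nullary.Negation using (¬_; contradiction)
  open Terms
  open PolyTime using (isPositive)

  open Equivalence using (to; from)

  ⇔-trans : ∀ {A B C : Set} → A ⇔ B → B ⇔ C → A ⇔ C
  ⇔-trans p q = mk⇔ (λ a → to q (to p a)) (λ c → from p (from q c))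

  ⇔-sym : ∀ {A B : Set} → A ⇔ B → B ⇔ A
  ⇔-sym p = mk⇔ (from p) (to p)

  -- A term is read as a formula that holds when its value is positive.
  module _ {m : ℕ} where

    infixl 5 _∨̂_
    infixl 6 _∧̂_

    _∧̂_ _∨̂_ _≤̂_ _<̂_ _≡̂_ : Term m → Term m → Term m
    s ∧̂ t = s ⊗ t
    s ∨̂ t = s ⊕ t

    ¬̂_ : Term m → Term m
    ¬̂ t = lit 1 ⊖ t

    s ≤̂ t = ¬̂ (s ⊖ t)
    s <̂ t = t ⊖ s
    s ≡̂ t = ¬̂ ((s ⊖ t) ⊕ (t ⊖ s))

    ∃̂ ∀̂ : Term m → Term (suc m) → Term m
    ∃̂ e t = Σ< e t
    ∀̂ e t = ¬̂ Σ< e (lit 1 ⊖ t)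

    ⋁ : List (Term m) → Term m
    ⋁ = foldr _∨̂_ (lit 0)

  ∧-⇔ : ∀ {a b} {P Q : Set} → 0 < a ⇔ P → 0 < b ⇔ Q → 0 < a * b ⇔ (P × Q)
  ∧-⇔ {a} {b} p q = mk⇔ (λ h → to p (left a b h) , to q (right a b h)) (λ (x , y) → *-mono-≤ (from p x) (from q y))
    where
    left : ∀ a b → 0 < a * b → 0 < a
    left (suc a) b h = s≤s z≤n
    right : ∀ a b → 0 < a * b → 0 < b
    right a zero    h = subst (0 <_) (*-zeroʳ a) h
    right a (suc b) h = s≤s z≤n

  ∨-⇔ : ∀ {a b} {P Q : Set} → 0 < a ⇔ P → 0 < b ⇔ Q → 0 < a + b ⇔ (P ⊎ Q)
  ∨-⇔ {a} {b} p q = mk⇔ (split a b p q)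
    (λ { (inj₁ x) → ≤-trans (from p x) (m≤m+n a b) ; (inj₂ y) → ≤-trans (from q y) (m≤n+m b a) })
    where
    split : ∀ a b {P Q : Set} → 0 < a ⇔ P → 0 < b ⇔ Q → 0 < a + b → P ⊎ Q
    split zero    b p q h = inj₂ (to q h)
    split (suc a) b p q h = inj₁ (to p (s≤s z≤n))

  ¬-⇔ : ∀ {a} {P : Set} → 0 < a ⇔ P → 0 < 1 ∸ a ⇔ (¬ P)
  ¬-⇔ {zero}  p = mk⇔ (λ _ x → contradiction (from p x) λ ()) (λ _ → s≤s z≤n)
  ¬-⇔ {suc a} p = mk⇔ (λ h _ → contradiction (subst (0 <_) (0∸n≡0 a) h) λ ()) (λ ¬x → contradiction (to p (s≤s z≤n)) ¬x)

  <-⇔ : ∀ a b → 0 < b ∸ a ⇔ a < b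
  <-⇔ a b = mk⇔ (λ h → ≰⇒> (λ b≤a → contradiction (subst (0 <_) (m≤n⇒m∸n≡0 b≤a) h) λ ())) m<n⇒0<n∸m

  ≤-⇔ : ∀ a b → 0 < 1 ∸ (a ∸ b) ⇔ a ≤ b
  ≤-⇔ a b = mk⇔ (λ h → ≮⇒≥ (to (¬-⇔ (<-⇔ b a)) h)) (λ a≤b → from (¬-⇔ (<-⇔ b a)) (≤⇒≯ a≤b))

  ≡-⇔ : ∀ a b → 0 < 1 ∸ ((a ∸ b) + (b ∸ a)) ⇔ a ≡ b
  ≡-⇔ a b = mk⇔
    (λ h → let ¬< = to (¬-⇔ (∨-⇔ (<-⇔ b a) (<-⇔ a b))) h in
      ≤-antisym (≮⇒≥ (λ l → ¬< (inj₁ l))) (≮⇒≥ (λ l → ¬< (inj₂ l))))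
    (λ { refl → from (¬-⇔ (∨-⇔ (<-⇔ b b) (<-⇔ b b))) (λ { (inj₁ l) → <-irrefl refl l ; (inj₂ l) → <-irrefl refl l }) })

  ∃-⇔ : ∀ {n} {f : ℕ → ℕ} {P : ℕ → Set} → (∀ i → i < n → 0 < f i ⇔ P i) → 0 < sumBelow n f ⇔ (∃[ i ] i < n × P i)
  ∃-⇔ {zero} p = mk⇔ (λ ()) (λ ())
  ∃-⇔ {suc n} {f} {P} p = mk⇔ find (λ (i , i<n , x) → total i (≤-pred i<n) x)
    where
    ih = ∃-⇔ {n} {f} {P} (λ i i<n → p i (m≤n⇒m≤1+n i<n))
    both = ∨-⇔ ih (p n ≤-refl)
    find : 0 < sumBelow n f + f n → ∃[ i ] i < suc n × P i
    find h with to both h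
    ... | inj₁ (i , i<n , x) = i , m≤n⇒m≤1+n i<n , x
    ... | inj₂ x             = n , ≤-refl , x
    total : ∀ i → i ≤ n → P i → 0 < sumBelow n f + f n
    total i i≤n x with m≤n⇒m<n∨m≡n i≤n
    ... | inj₁ i<n  = from both (inj₁ (i , i<n , x))
    ... | inj₂ refl = from both (inj₂ x)

  ∀-⇔ : ∀ {n} {f : ℕ → ℕ} {P : ℕ → Set} → (∀ i → i < n → 0 < f i ⇔ P i) →
        0 < 1 ∸ sumBelow n (λ i → 1 ∸ f i) ⇔ (∀ i → i < n → P i)
  ∀-⇔ {n} {f} {P} p = mk⇔ (λ h i i<n → to (p i i<n) (pos (f i) (λ ¬h → to fails h (i , i<n , ¬h))))
                          (λ all → from fails (λ (i , i<n , ¬h) → ¬h (from (p i i<n) (all i i<n))))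
    where
    fails : 0 < 1 ∸ sumBelow n (λ i → 1 ∸ f i) ⇔ (¬ (∃[ i ] i < n × ¬ (0 < f i)))
    fails = ¬-⇔ (∃-⇔ {n} {λ i → 1 ∸ f i} (λ i i<n → ¬-⇔ {f i} (mk⇔ (λ h → h) (λ h → h))))
    -- Counting failures yields only a double negation, which positivity, being decidable, allows to
    -- remove.
    pos : ∀ a → ¬ ¬ (0 < a) → 0 < a
    pos zero    h = contradiction (λ ()) h
    pos (suc a) h = s≤s z≤n

  bit-⇔ : ∀ b → 0 < toNat b ⇔ T b
  bit-⇔ true  = mk⇔ (λ _ → tt) (λ _ → s≤s z≤n)
  bit-⇔ false = mk⇔ (λ ()) (λ ())

  isPositive-⇔ : ∀ n → isPositive n ≡ true ⇔ 0 < n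
  isPositive-⇔ zero    = mk⇔ (λ ()) (λ ())
  isPositive-⇔ (suc n) = mk⇔ (λ _ → s≤s z≤n) (λ _ → refl)

  ⋁-⇔ : ∀ {m} words {ρ} (ts : List (Term m)) → let open Semantics words in
        0 < ⟦ ⋁ ts ⟧ ρ ⇔ Any (λ t → 0 < ⟦ t ⟧ ρ) ts
  ⋁-⇔ words []       = mk⇔ (λ ()) (λ ())
  ⋁-⇔ words (t ∷ ts) = mk⇔ (λ h → join (to both h)) (λ { (here h) → from both (inj₁ h) ; (there h) → from both (inj₂ h) })
    where
    both = ∨-⇔ (mk⇔ (λ h → h) (λ h → h)) (⋁-⇔ words ts)
    join : _ ⊎ _ → Any _ (t ∷ ts)
    join (inj₁ h) = here h
    join (inj₂ h) = there h

-- Reading the encoding of a graph bit by bit.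

module Encodings where

  open import Data.Bool.Base using (Bool; true; false)
  open import Data.Fin.Base using (Fin; zero; suc; toℕ; fromℕ<; remQuot)
  open import Data.Fin.Properties using (toℕ-fromℕ<; toℕ-combine; combine-remQuot)
  open import Data.List.Base as List using (List; []; _∷_; _++_; length; replicate; concat; tabulate; applyUpTo)
  open import Data.List.Properties using (length-++; length-tabulate; length-replicate; tabulate-cong)
  open import Data.Nat.Base using (ℕ; zero; suc; _+_; _*_; _<_; z≤n; s≤s)
  open import Data.Nat.Properties
  open import Data.Product.Base using (proj₁; proj₂)
  open import Function.Base using (_∘_)
  open import Relation.Binary.Definitions using (tri<; tri≈; tri>)
  open import Relation.Binary.PropositionalEquality
  open import Relation.Nullary.Negation using (contradiction)
  open import Defs
  open Terms using (_‼_)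
  open PolyTime using (matrixWord)

  matrix : ∀ {m n} → (Fin m → Fin n → Bool) → List Bool
  matrix f = concat (tabulate (λ u → tabulate (f u)))

  private
    ‼-++ʳ : ∀ xs {ys} i → (xs ++ ys) ‼ (length xs + i) ≡ ys ‼ i
    ‼-++ʳ []       i = refl
    ‼-++ʳ (x ∷ xs) i = ‼-++ʳ xs i

    ‼-tabulate : ∀ {n ys} (f : Fin n → Bool) i → (tabulate f ++ ys) ‼ toℕ i ≡ f i
    ‼-tabulate f zero    = refl
    ‼-tabulate f (suc i) = ‼-tabulate (f ∘ suc) i

    ‼-replicate : ∀ n {ys} i → i < n → (replicate n true ++ ys) ‼ i ≡ true
    ‼-replicate (suc n) zero    _       = refl
    ‼-replicate (suc n) (suc i) (s≤s h) = ‼-replicate n i h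

  matrix-‼ : ∀ {m n} (f : Fin m → Fin n → Bool) u v → matrix f ‼ (n * toℕ u + toℕ v) ≡ f u v
  matrix-‼ {suc m} {n} f zero    v rewrite *-zeroʳ n = ‼-tabulate (f zero) v
  matrix-‼ {suc m} {n} f (suc u) v = begin
    (row ++ rest) ‼ (n * suc (toℕ u) + toℕ v)           ≡⟨ cong ((row ++ rest) ‼_) (trans (cong (_+ toℕ v) (*-suc n (toℕ u))) (+-assoc n _ _)) ⟩
    (row ++ rest) ‼ (n + (n * toℕ u + toℕ v))           ≡⟨ cong (λ k → (row ++ rest) ‼ (k + (n * toℕ u + toℕ v))) (length-tabulate (f zero)) ⟨
    (row ++ rest) ‼ (length row + (n * toℕ u + toℕ v))  ≡⟨ ‼-++ʳ row (n * toℕ u + toℕ v) ⟩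
    rest ‼ (n * toℕ u + toℕ v)                          ≡⟨ matrix-‼ (f ∘ suc) u v ⟩
    f (suc u) v                                         ∎
    where
    open ≡-Reasoning
    row  = tabulate (f zero)
    rest = matrix (f ∘ suc)

  matrix-length : ∀ {m n} (f : Fin m → Fin n → Bool) → length (matrix f) ≡ m * n
  matrix-length {zero}  f = refl
  matrix-length {suc m} f = trans (length-++ (tabulate (f zero))) (cong₂ _+_ (length-tabulate (f zero)) (matrix-length (f ∘ suc)))

  -- Phrased by positions because a term can only read single bits. The verifier checks the first
  -- three conditions and takes the last as the definition of its graph.
  record Encodes (w : List Bool) (n : ℕ) (adj : Fin n → Fin n → Bool) : Set where
    field
      ones    : ∀ i → i < n → w ‼ i ≡ true
      zero-at : w ‼ n ≡ false
      size    : length w ≡ n + suc (n * n)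
      entries : ∀ u v → w ‼ (n + suc (n * toℕ u + toℕ v)) ≡ adj u v

  encodeGraph-Encodes : ∀ G → Encodes (encodeGraph G) (order G) (adj G)
  encodeGraph-Encodes G = record
    { ones    = ‼-replicate n
    ; zero-at = trans (cong (encodeGraph G ‼_) (trans (sym (length-replicate n)) (sym (+-identityʳ _)))) (‼-++ʳ (replicate n true) 0)
    ; size    = trans (length-++ (replicate n true)) (cong₂ (λ a b → a + suc b) (length-replicate n) (matrix-length (adj G)))
    ; entries = λ u v → trans (cong (λ k → encodeGraph G ‼ (k + suc (n * toℕ u + toℕ v))) (sym (length-replicate n)))
                          (trans (‼-++ʳ (replicate n true) (suc (n * toℕ u + toℕ v))) (matrix-‼ (adj G) u v))
    }
    where n = order G

  private
    ext : ∀ v w → length v ≡ length w → (∀ i → i < length v → v ‼ i ≡ w ‼ i) → v ≡ w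
    ext []      []      _  _  = refl
    ext (a ∷ v) (b ∷ w) eq at = cong₂ _∷_ (at 0 (s≤s z≤n)) (ext v w (suc-injective eq) (λ i h → at (suc i) (s≤s h)))

  Encodes-unique : ∀ {v w n adj} → Encodes v n adj → Encodes w n adj → v ≡ w
  Encodes-unique {v} {w} {n} {adj} E F = ext v w (trans (E.size) (sym F.size)) same
    where
    module E = Encodes E
    module F = Encodes F
    same : ∀ i → i < length v → v ‼ i ≡ w ‼ i
    same i i<v with <-cmp i n
    ... | tri< i<n _ _  = trans (E.ones i i<n) (sym (F.ones i i<n))
    ... | tri≈ _ refl _ = trans E.zero-at (sym F.zero-at)
    ... | tri> _ _ n<i  = subst (λ k → v ‼ k ≡ w ‼ k) pos (trans (E.entries u u′) (sym (F.entries u u′)))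
      where
      open import Data.Nat.Base using (_∸_)
      j = i ∸ suc n
      i≡ : n + suc j ≡ i
      i≡ = trans (+-suc n j) (m+[n∸m]≡n n<i)
      j<nn : j < n * n
      j<nn = +-cancelˡ-< (suc n) j (n * n) (subst₂ _<_ (trans (sym i≡) (+-suc n j)) (trans E.size (+-suc n (n * n))) i<v)
      u  = proj₁ (remQuot {n} n (fromℕ< j<nn))
      u′ = proj₂ (remQuot {n} n (fromℕ< j<nn))
      pos : n + suc (n * toℕ u + toℕ u′) ≡ i
      pos = trans (cong (λ k → n + suc k) (trans (sym (toℕ-combine u u′))
              (trans (cong toℕ (combine-remQuot {n} n (fromℕ< j<nn))) (toℕ-fromℕ< j<nn)))) i≡

  -- The order is the position of the first `false`.
  Encodes-order : ∀ {w m n adj adj′} → Encodes w m adj → Encodes w n adj′ → m ≡ n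
  Encodes-order {w} {m} {n} E F with <-cmp m n
  ... | tri< m<n _ _ = contradiction (trans (sym (Encodes.ones F m m<n)) (Encodes.zero-at E)) λ ()
  ... | tri≈ _ eq _  = eq
  ... | tri> _ _ n<m = contradiction (trans (sym (Encodes.ones E n n<m)) (Encodes.zero-at F)) λ ()

  encodeGraph-matrixWord : ∀ G f → (∀ u v → adj G u v ≡ f (toℕ u) (toℕ v)) → encodeGraph G ≡ matrixWord (order G) f
  encodeGraph-matrixWord G f eq = cong (λ r → replicate (order G) true ++ false ∷ concat r)
    (trans (tabulate-cong (λ u → trans (tabulate-cong (eq u)) (tabulate-applyUpTo (f (toℕ u)))))
           (tabulate-applyUpTo (λ u → applyUpTo (f u) (order G))))
    where
    tabulate-applyUpTo : ∀ {A : Set} {n} (f : ℕ → A) → tabulate {n = n} (f ∘ toℕ) ≡ applyUpTo f n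
    tabulate-applyUpTo {n = zero}  f = refl
    tabulate-applyUpTo {n = suc n} f = cong (f 0 ∷_) (tabulate-applyUpTo (f ∘ suc))

-- Membership in NP.

module Membership where

  open import Data.Bool.Base using (Bool; true; false; T; not)
  open import Data.Bool.Properties using (T-≡)
  open import Data.Fin.Base using (zero; suc; toℕ; fromℕ<)
  open import Data.Fin.Properties using (toℕ<n; toℕ-fromℕ<)
  open import Data.List.Base using (List; []; _∷_; length)
  open import Data.Nat.Base using (ℕ; zero; suc; _+_; _*_; _≤_; _<_; s≤s)
  open import Data.Nat.Properties
  open import Data.Product.Base using (∃-syntax; _×_; _,_; proj₁; proj₂)
  open import Data.Unit.Base using (tt)
  open import Data.Vec.Base using ([]; _∷_)
  open import Function.Bundles using (_⇔_; mk⇔; Equivalence)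
  open import Relation.Binary.PropositionalEquality
  open import Relation.Nullary.Negation using (¬_; contradiction)
  open import Defs
  open Terms
  open Polynomials
  open PolyTime
  open Formulas
  open Counting
  open Encodings
  open Orientations

  open Equivalence using (to; from)
  open Orientation using (arc; arc⇒adj; exactly-one; d⁻)

  problem : Language
  problem = language (RegularInOutProperOrientation 4 3)

  private
    adjᵗ arcᵗ : ∀ {m} → Term m → Term m → Term m → Term m
    adjᵗ n u v = bitAt zero (n ⊕ (lit 1 ⊕ (n ⊗ u ⊕ v)))
    arcᵗ n u v = bitAt (suc zero) (n ⊗ u ⊕ v)

    #0 : ∀ {m} → Term (suc m)
    #0 = var zero
    #1 : ∀ {m} → Term (suc (suc m))
    #1 = var (suc zero)
    #2 : ∀ {m} → Term (suc (suc (suc m)))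
    #2 = var (suc (suc zero))
    #3 : ∀ {m} → Term (suc (suc (suc (suc m))))
    #3 = var (suc (suc (suc zero)))

    -- The certificate is the arc matrix of a balanced orientation. The word is checked too, since
    -- it may fail to encode a 4-regular graph; the order is searched for among the numbers up to
    -- its length. The conjuncts are the fields of `Valid` in the same order.
    verifier : Term 0
    verifier = ∃̂ (lit 1 ⊕ len zero)
      ( ∀̂ #0 (bitAt zero #0)
      ∧̂ ¬̂ bitAt zero #0
      ∧̂ (len zero ≡̂ (#0 ⊕ (lit 1 ⊕ #0 ⊗ #0)))
      ∧̂ ∀̂ #0 (∀̂ #1 (adjᵗ #2 #1 #0 ≡̂ adjᵗ #2 #0 #1))
      ∧̂ ∀̂ #0 (¬̂ adjᵗ #1 #0 #0)
      ∧̂ ∀̂ #0 (Σ< #1 (adjᵗ #2 #1 #0) ≡̂ lit 4)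
      ∧̂ ∀̂ #0 (∀̂ #1 ((arcᵗ #2 #1 #0 ⊕ arcᵗ #2 #0 #1) ≡̂ adjᵗ #2 #1 #0))
      ∧̂ ∀̂ #0 ((lit 1 ≤̂ Σ< #1 (arcᵗ #2 #0 #1)) ∧̂ (Σ< #1 (arcᵗ #2 #0 #1) ≤̂ lit 3))
      ∧̂ ∀̂ #0 (∀̂ #1 (¬̂ (adjᵗ #2 #1 #0 ∧̂ (Σ< #2 (arcᵗ #3 #0 #2) ≡̂ Σ< #2 (arcᵗ #3 #0 #1))))))

    module _ (w y : List Bool) where

      adj′ arc′ : ℕ → ℕ → ℕ → Bool
      adj′ n u v = w ‼ (n + suc (n * u + v))
      arc′ n u v = y ‼ (n * u + v)

      indegree : ℕ → ℕ → ℕ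
      indegree n v = sumBelow n (λ u → toNat (arc′ n u v))

      record Valid (n : ℕ) : Set where
        field
          ones     : ∀ i → i < n → T (w ‼ i)
          zero-at  : ¬ T (w ‼ n)
          size     : length w ≡ n + suc (n * n)
          symm     : ∀ u → u < n → ∀ v → v < n → toNat (adj′ n u v) ≡ toNat (adj′ n v u)
          irrefl   : ∀ u → u < n → ¬ T (adj′ n u u)
          four     : ∀ u → u < n → sumBelow n (λ v → toNat (adj′ n u v)) ≡ 4
          -- One equation between numbers says both that arcs lie on edges and that an edge carries
          -- exactly one arc.
          oriented : ∀ u → u < n → ∀ v → v < n → toNat (arc′ n u v) + toNat (arc′ n v u) ≡ toNat (adj′ n u v)
          bounds   : ∀ v → v < n → 1 ≤ indegree n v × indegree n v ≤ 3
          differ   : ∀ u → u < n → ∀ v → v < n → ¬ (T (adj′ n u v) × indegree n u ≡ indegree n v)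

      verifier-⇔ : 0 < Semantics.⟦_⟧ (w ∷ y ∷ []) verifier [] ⇔ (∃[ n ] n < suc (length w) × Valid n)
      verifier-⇔ = ∃-⇔ λ n _ → ⇔-trans
        (∧-⇔ (∧-⇔ (∧-⇔ (∧-⇔ (∧-⇔ (∧-⇔ (∧-⇔ (∧-⇔
          (∀-⇔ (λ i _ → bit-⇔ (w ‼ i)))
          (¬-⇔ (bit-⇔ (w ‼ n))))
          (≡-⇔ (length w) (n + suc (n * n))))
          (∀-⇔ (λ u _ → ∀-⇔ (λ v _ → ≡-⇔ (toNat (adj′ n u v)) (toNat (adj′ n v u))))))
          (∀-⇔ (λ u _ → ¬-⇔ (bit-⇔ (adj′ n u u)))))
          (∀-⇔ (λ u _ → ≡-⇔ (sumBelow n (λ v → toNat (adj′ n u v))) 4)))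
          (∀-⇔ (λ u _ → ∀-⇔ (λ v _ → ≡-⇔ (toNat (arc′ n u v) + toNat (arc′ n v u)) (toNat (adj′ n u v))))))
          (∀-⇔ (λ v _ → ∧-⇔ (≤-⇔ 1 (indegree n v)) (≤-⇔ (indegree n v) 3))))
          (∀-⇔ (λ u _ → ∀-⇔ (λ v _ → ¬-⇔ (∧-⇔ (bit-⇔ (adj′ n u v)) (≡-⇔ (indegree n u) (indegree n v)))))))
        (mk⇔ (λ ((((((((a , b) , c) , d) , e) , f) , g) , h) , i) → record
               { ones = a ; zero-at = b ; size = c ; symm = d ; irrefl = e ; four = f ; oriented = g ; bounds = h ; differ = i })
             (λ V → let open Valid V in (((((((ones , zero-at) , size) , symm) , irrefl) , four) , oriented) , bounds) , differ))

    toNat-injective : ∀ a b → toNat a ≡ toNat b → a ≡ b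
    toNat-injective true  true  _ = refl
    toNat-injective false false _ = refl

    T⇒≡ : ∀ {b} → T b → b ≡ true
    T⇒≡ = to T-≡

    ¬T⇒≡ : ∀ {b} → ¬ T b → b ≡ false
    ¬T⇒≡ {true}  h = contradiction tt h
    ¬T⇒≡ {false} h = refl

    sound : ∀ w y n → Valid w y n → problem w
    sound w y n V = (G , regular) , Encodes-unique (encodeGraph-Encodes G) encodes , from (χ≤3⇔Balanced regular) (D , balanced)
      where
      open Valid V
      G : Graph
      G = record
        { order     = n
        ; adj       = λ u v → adj′ w y n (toℕ u) (toℕ v)
        ; adj-sym   = λ u v → toNat-injective _ _ (symm (toℕ u) (toℕ<n u) (toℕ v) (toℕ<n v))
        ; adj-irref = λ u → irrefl (toℕ u) (toℕ<n u)
        }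
      regular : Regular 4 G
      regular u = trans (#-sumBelow {n} (adj′ w y n (toℕ u))) (four (toℕ u) (toℕ<n u))
      encodes : Encodes w n (adj G)
      encodes = record
        { ones = λ i i<n → T⇒≡ (ones i i<n) ; zero-at = ¬T⇒≡ zero-at ; size = size ; entries = λ u v → refl }
      adj-arc : ∀ p q a → toNat p + toNat q ≡ toNat a → (T p → T a) × (T a → p ≡ not q)
      adj-arc true  false true  _ = (λ _ → tt) , (λ _ → refl)
      adj-arc false true  true  _ = (λ _ → tt) , (λ _ → refl)
      adj-arc false false false _ = (λ ()) , (λ ())
      adj-arc true  true  true  ()
      adj-arc true  true  false ()
      adj-arc true  false false ()
      adj-arc false true  false ()
      adj-arc false false true  ()
      D : Orientation G
      D = record
        { arc         = λ u v → arc′ w y n (toℕ u) (toℕ v)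
        ; arc⇒adj     = λ u v → proj₁ (adj-arc _ _ _ (oriented (toℕ u) (toℕ<n u) (toℕ v) (toℕ<n v)))
        ; exactly-one = λ u v → proj₂ (adj-arc _ _ _ (oriented (toℕ u) (toℕ<n u) (toℕ v) (toℕ<n v)))
        }
      d⁻≡ : ∀ v → d⁻ D v ≡ indegree w y n (toℕ v)
      d⁻≡ v = #-sumBelow {n} (λ u → arc′ w y n u (toℕ v))
      balanced : Balanced G D
      balanced = (λ v → subst (λ d → 1 ≤ d × d ≤ 3) (sym (d⁻≡ v)) (bounds (toℕ v) (toℕ<n v))) ,
        (λ u v u~v eq → differ (toℕ u) (toℕ<n u) (toℕ v) (toℕ<n v) (u~v , trans (sym (d⁻≡ u)) (trans eq (d⁻≡ v))))

    -- The arc matrix is as long as the adjacency matrix contained in w, so the identity polynomial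
    -- bounds the certificate.
    complete : ∀ w → problem w → ∃[ y ] length y ≤ length w × (∃[ n ] n < suc (length w) × Valid w y n)
    complete _ ((G , regular) , refl , yes) with to (χ≤3⇔Balanced regular) yes
    ... | D , bounds , differ = y , y-short , n , n-short , record
      { ones     = λ i i<n → from T-≡ (E.ones i i<n)
      ; zero-at  = λ t → contradiction (trans (sym (T⇒≡ t)) E.zero-at) λ ()
      ; size     = E.size
      ; symm     = λ u u<n v v<n → cong toNat (trans (adj-at u<n v<n) (trans (Graph.adj-sym G _ _) (sym (adj-at v<n u<n))))
      ; irrefl   = λ u u<n t → Graph.adj-irref G (fromℕ< u<n) (subst T (adj-at u<n u<n) t)
      ; four     = λ u u<n → trans (sym (#-sumBelow {n} (adj′ w y n u)))
                     (trans (#-cong (row-at u<n))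
                       (regular (fromℕ< u<n)))
      ; oriented = λ u u<n v v<n → trans (cong₂ (λ a b → toNat a + toNat b) (arc-at u<n v<n) (arc-at v<n u<n))
                     (trans (arc-adj D _ _) (cong toNat (sym (adj-at u<n v<n))))
      ; bounds   = λ v v<n → subst (λ d → 1 ≤ d × d ≤ 3) (sym (indegree≡ v<n)) (bounds (fromℕ< v<n))
      ; differ   = λ u u<n v v<n (t , eq) → differ (fromℕ< u<n) (fromℕ< v<n) (subst T (adj-at u<n v<n) t)
                     (trans (sym (indegree≡ u<n)) (trans eq (indegree≡ v<n)))
      }
      where
      n = order G
      w = encodeGraph G
      y = matrix (arc D)
      module E = Encodes (encodeGraph-Encodes G)
      nn≤ : n * n ≤ length w
      nn≤ = ≤-trans (≤-trans (n≤1+n _) (m≤n+m _ n)) (≤-reflexive (sym E.size))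
      y-short : length y ≤ length w
      y-short = ≤-trans (≤-reflexive (matrix-length (arc D))) nn≤
      n-short : n < suc (length w)
      n-short = s≤s (≤-trans (m≤m+n n _) (≤-reflexive (sym E.size)))
      adj-at : ∀ {u v} (u<n : u < n) (v<n : v < n) → adj′ w y n u v ≡ adj G (fromℕ< u<n) (fromℕ< v<n)
      adj-at u<n v<n = trans (sym (cong₂ (adj′ w y n) (toℕ-fromℕ< u<n) (toℕ-fromℕ< v<n))) (E.entries _ _)
      row-at : ∀ {u} (u<n : u < n) v → adj′ w y n u (toℕ v) ≡ adj G (fromℕ< u<n) v
      row-at u<n v = trans (cong (λ k → adj′ w y n k (toℕ v)) (sym (toℕ-fromℕ< u<n))) (E.entries _ _)
      arc-at : ∀ {u v} (u<n : u < n) (v<n : v < n) → arc′ w y n u v ≡ arc D (fromℕ< u<n) (fromℕ< v<n)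
      arc-at u<n v<n = trans (sym (cong₂ (arc′ w y n) (toℕ-fromℕ< u<n) (toℕ-fromℕ< v<n))) (matrix-‼ (arc D) _ _)
      indegree≡ : ∀ {v} (v<n : v < n) → indegree w y n v ≡ d⁻ D (fromℕ< v<n)
      indegree≡ {v} v<n = trans (sym (#-sumBelow {n} (λ u → arc′ w y n u v)))
        (#-cong (λ u → trans (cong (arc′ w y n (toℕ u)) (sym (toℕ-fromℕ< v<n))) (matrix-‼ (arc D) u _)))

  problem-NP : NP problem
  problem-NP = (λ w y → isPositive (Semantics.⟦_⟧ (w ∷ y ∷ []) verifier [])) , term-PolyTimeRelation verifier ,
    poly poly-id , λ w → mk⇔
      (λ p → let y , y≤ , V = complete w p in
        y , subst (length y ≤_) (sym (agree poly-id (length w))) y≤ , from (isPositive-⇔ _) (from (verifier-⇔ w y) V))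
      (λ (y , _ , r) → let n , _ , V = to (verifier-⇔ w y) (to (isPositive-⇔ _) r) in sound w y n V)

-- Triangle-partitioned 4-regular graphs: proper 3-colourings as orientations.

module TriangleGraph where

  open import Data.Bool.Base using (Bool; true; false; T; not; _∧_; _∨_)
  open import Data.Bool.Properties using (∨-comm)
  open import Data.Fin.Base using (Fin; suc; toℕ; fromℕ<)
  open import Data.Fin.Properties using (_≟_; toℕ-fromℕ<; toℕ-injective; toℕ<n; all?)
  open import Data.List.Base using (List; []; _∷_; map)
  open import Data.List.Membership.Propositional using (_∈_)
  open import Data.List.Relation.Unary.All using ([]; _∷_)
  open import Data.List.Relation.Unary.AllPairs using ([]; _∷_)
  open import Data.List.Relation.Unary.Any using (here; there)
  open import Data.List.Relation.Unary.Unique.Propositional using (Unique)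
  open import Data.Nat.Base using (ℕ; suc; _+_; _∸_; _<_; _≤_; _<ᵇ_; z≤n; s≤s)
  open import Data.Nat.ListAction using (sum)
  open import Data.Nat.Properties using (suc-injective)
  import Data.Nat.Properties as ℕₚ
  open import Data.Product.Base using (Σ-syntax; _×_; _,_; proj₁; proj₂)
  open import Data.Unit.Base using (tt)
  open import Relation.Binary.PropositionalEquality
  open import Relation.Nullary.Decidable using (yes; no; does; from-yes; ¬?; _→-dec_)
  open import Relation.Nullary.Negation using (¬_; contradiction)
  open import Defs
  open Terms using (toNat)
  open Counting
  open Orientations

  open Orientation using (arc; d⁻)

  -- Three in-degrees are possible, and they colour the graph.
  Balanced-colouring : (G : Graph) (D : Orientation G) → Balanced G D →
    Σ[ c ∈ (Vertex G → Fin 3) ] (∀ u v → T (adj G u v) → c u ≢ c v)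
  Balanced-colouring G D (bounds , differ) = (λ v → fromℕ< (small v)) , proper
    where
    down : ∀ {d} → 1 ≤ d × d ≤ 3 → d ∸ 1 < 3
    down {suc d} (_ , le) = le
    small : ∀ v → d⁻ D v ∸ 1 < 3
    small v = down (bounds v)
    up : ∀ {d e} → 1 ≤ d → 1 ≤ e → d ∸ 1 ≡ e ∸ 1 → d ≡ e
    up (s≤s _) (s≤s _) eq = cong suc eq
    proper : ∀ u v → T (adj G u v) → fromℕ< (small u) ≢ fromℕ< (small v)
    proper u v u~v eq = differ u v u~v (up (proj₁ (bounds u)) (proj₁ (bounds v))
      (trans (sym (toℕ-fromℕ< (small u))) (trans (cong toℕ eq) (toℕ-fromℕ< (small v)))))

  -- The orbits of r are triangles; s is a permutation.
  record TriangleSystem (V : Set) : Set where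
    field
      r r⁻ s s⁻ : V → V
      r-r   : ∀ v → r (r v) ≡ r⁻ v
      r-r⁻  : ∀ v → r (r⁻ v) ≡ v
      r⁻-r  : ∀ v → r⁻ (r v) ≡ v
      s-s⁻  : ∀ v → s (s⁻ v) ≡ v
      s⁻-s  : ∀ v → s⁻ (s v) ≡ v
      r≢id  : ∀ v → r v ≢ v
      s≢id  : ∀ v → s v ≢ v
      r⁻≢r  : ∀ v → r⁻ v ≢ r v
      s≢r   : ∀ v → s v ≢ r v
      s≢r⁻  : ∀ v → s v ≢ r⁻ v
      s≢s⁻  : ∀ v → s v ≢ s⁻ v

  module _ {n : ℕ} (S : TriangleSystem (Fin n)) where

    open TriangleSystem S

    -- `tri` is symmetric, whereas `ext` follows the direction of s; this direction later becomes
    -- that of the arcs.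
    tri ext near : Fin n → Fin n → Bool
    tri u v  = does (v ≟ r u) ∨ does (v ≟ r⁻ u)
    ext u v  = does (v ≟ s u)
    near u v = tri u v ∨ (ext u v ∨ ext v u)

    private
      tri-r : ∀ u → tri u (r u) ≡ true
      tri-r u with r u ≟ r u
      ... | yes _ = refl
      ... | no ne = contradiction refl ne

      tri-r⁻ : ∀ u → tri u (r⁻ u) ≡ true
      tri-r⁻ u with r⁻ u ≟ r u | r⁻ u ≟ r⁻ u
      ... | yes _ | _     = refl
      ... | no _  | yes _ = refl
      ... | no _  | no ne = contradiction refl ne

      ext-s : ∀ u → ext u (s u) ≡ true
      ext-s u with s u ≟ s u
      ... | yes _ = refl
      ... | no ne = contradiction refl ne

      tri-sym-true : ∀ u v → tri u v ≡ true → tri v u ≡ true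
      tri-sym-true u v p with v ≟ r u | v ≟ r⁻ u
      ... | yes refl | _        = subst (λ x → tri (r u) x ≡ true) (r⁻-r u) (tri-r⁻ (r u))
      ... | no _     | yes refl = subst (λ x → tri (r⁻ u) x ≡ true) (r-r⁻ u) (tri-r (r⁻ u))

      tri-sym : ∀ u v → tri u v ≡ tri v u
      tri-sym u v with tri u v in p | tri v u in q
      ... | true  | true  = refl
      ... | false | false = refl
      ... | true  | false = trans (sym (tri-sym-true u v p)) q
      ... | false | true  = trans (sym p) (tri-sym-true v u q)

      tri-ext : ∀ u v → tri u v ≡ true → ext u v ≡ false
      tri-ext u v p with v ≟ r u | v ≟ r⁻ u | v ≟ s u
      ... | yes refl | _        | yes eq = contradiction (sym eq) (s≢r u)
      ... | no _     | yes refl | yes eq = contradiction (sym eq) (s≢r⁻ u)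
      ... | _        | _        | no _   = refl

      -- If s led from u to v and back, then s and its inverse would agree at v, which `s≢s⁻`
      -- forbids.
      ext-ext : ∀ u v → ext u v ≡ true → ext v u ≡ false
      ext-ext u v p with v ≟ s u | u ≟ s v
      ... | yes refl | yes eq = contradiction (trans (cong s eq′) (s-s⁻ u)) (λ e → s≢s⁻ (s u) (trans (sym eq) (sym (s⁻-s u))))
        where eq′ = sym (trans (cong s⁻ eq) (s⁻-s (s u)))
      ... | _        | no _   = refl

      irrefl : ∀ u → ¬ T (near u u)
      irrefl u p with u ≟ r u | u ≟ r⁻ u | u ≟ s u
      ... | yes eq | _      | _      = r≢id u (sym eq)
      ... | no _   | yes eq | _      = r≢id u (trans (cong r eq) (r-r⁻ u))
      ... | no _   | no _   | yes eq = s≢id u (sym eq)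
      ... | no _   | no _   | no _   = p

    graph : Graph
    graph = record
      { order     = n
      ; adj       = near
      ; adj-sym   = λ u v → cong₂ _∨_ (tri-sym u v) (∨-comm (ext u v) (ext v u))
      ; adj-irref = irrefl
      }

    nbrs : Fin n → List (Fin n)
    nbrs v = r v ∷ r⁻ v ∷ s v ∷ s⁻ v ∷ []

    private
      nbrs-unique : ∀ v → Unique (nbrs v)
      nbrs-unique v =
        ((λ eq → r⁻≢r v (sym eq)) ∷ (λ eq → s≢r v (sym eq)) ∷
          (λ eq → s≢r⁻ (r v) (trans (cong s eq) (trans (s-s⁻ v) (sym (r⁻-r v))))) ∷ []) ∷
        ((λ eq → s≢r⁻ v (sym eq)) ∷
          (λ eq → s≢r (r⁻ v) (trans (cong s eq) (trans (s-s⁻ v) (sym (r-r⁻ v))))) ∷ []) ∷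
        (s≢s⁻ v ∷ []) ∷ [] ∷ []

      near-nbrs : ∀ u v → T (near u v) → v ∈ nbrs u
      near-nbrs u v p with v ≟ r u | v ≟ r⁻ u | v ≟ s u | u ≟ s v
      ... | yes eq | _      | _      | _      = here eq
      ... | no _   | yes eq | _      | _      = there (here eq)
      ... | no _   | no _   | yes eq | _      = there (there (here eq))
      ... | no _   | no _   | no _   | yes eq = there (there (there (here (sym (trans (cong s⁻ eq) (s⁻-s v))))))

      near-r : ∀ u → near u (r u) ≡ true
      near-r u rewrite tri-r u = refl
      near-r⁻ : ∀ u → near u (r⁻ u) ≡ true
      near-r⁻ u rewrite tri-r⁻ u = refl
      near-s : ∀ u → near u (s u) ≡ true
      near-s u rewrite ext-s u with tri u (s u)
      ... | true  = refl
      ... | false = refl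
      near-s⁻ : ∀ u → near u (s⁻ u) ≡ true
      near-s⁻ u = trans (Graph.adj-sym graph u (s⁻ u)) (subst (λ x → near (s⁻ u) x ≡ true) (s-s⁻ u) (near-s (s⁻ u)))

    graph-regular : Regular 4 graph
    graph-regular u = trans (#-list (near u) (nbrs u) (nbrs-unique u) (near-nbrs u)) total
      where
      total : sum (map (λ v → toNat (near u v)) (nbrs u)) ≡ 4
      total rewrite near-r u | near-r⁻ u | near-s u | near-s⁻ u = refl

    -- Each edge leads from one of its ends to the image under r or under s, so two inequalities per
    -- vertex cover all edges.
    Proper : (Fin n → Fin 3) → Set
    Proper c = ∀ v → c v ≢ c (r v) × c v ≢ c (s v)

    adjacent-Proper : ∀ c → (∀ u v → T (near u v) → c u ≢ c v) → Proper c
    adjacent-Proper c proper v =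
      proper v (r v) (subst T (sym (near-r v)) tt) , proper v (s v) (subst T (sym (near-s v)) tt)

    module _ (c : Fin n → Fin 3) (proper : Proper c) where

      private
        c-near : ∀ u v → T (near u v) → c u ≢ c v
        c-near u v p with near-nbrs u v p
        ... | here refl                         = proj₁ (proper u)
        ... | there (here refl)                 = λ eq → proj₁ (proper (r⁻ u)) (trans (sym eq) (cong c (sym (r-r⁻ u))))
        ... | there (there (here refl))         = proj₂ (proper u)
        ... | there (there (there (here refl))) = λ eq → proj₂ (proper (s⁻ u)) (trans (sym eq) (cong c (sym (s-s⁻ u))))

        up : Fin n → Fin n → Bool
        up u v = toℕ (c u) <ᵇ toℕ (c v)

        up-not : ∀ a b → a ≢ b → (toℕ {3} a <ᵇ toℕ {3} b) ≡ not (toℕ b <ᵇ toℕ a)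
        up-not = from-yes (all? λ a → all? λ b → ¬? (a ≟ b) →-dec ((toℕ {3} a <ᵇ toℕ {3} b) Data.Bool.Properties.≟ not (toℕ b <ᵇ toℕ a)))

      -- A triangle oriented by increasing colour contributes -2, 0, 2 to the
      -- in-out-degrees, and the cycles of s, oriented cyclically, contribute 0.
      orientation : Orientation graph
      orientation = record { arc = arc′ ; arc⇒adj = arc⇒near ; exactly-one = one }
        where
        arc′ : Fin n → Fin n → Bool
        arc′ u v = (tri u v ∧ up u v) ∨ ext u v
        arc⇒near : ∀ u v → T (arc′ u v) → T (near u v)
        arc⇒near u v p with tri u v | ext u v
        ... | true  | _    = tt
        ... | false | true = tt
        one : ∀ u v → T (near u v) → arc′ u v ≡ not (arc′ v u)
        one u v p with tri u v in t | tri-sym u v | ext u v in e | ext v u in e′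
        ... | true | eq | _ | _ rewrite sym eq | trans (sym e) (tri-ext u v t) | trans (sym e′) (tri-ext v u (sym eq)) =
          trans (Data.Bool.Properties.∨-identityʳ _) (trans (up-not (c u) (c v) (c-near u v (subst (λ b → T (b ∨ (ext u v ∨ ext v u))) (sym t) tt)))
            (cong not (sym (Data.Bool.Properties.∨-identityʳ _))))
        ... | false | eq | true  | true  = contradiction (trans (sym e′) (ext-ext u v e)) λ ()
        ... | false | eq | true  | false rewrite sym eq = refl
        ... | false | eq | false | true  rewrite sym eq = refl

      -- All three colours occur in the triangle of v, so one arc enters from each smaller colour;
      -- the remaining arc comes from `s⁻ v`.
      orientation-d⁻ : ∀ v → d⁻ orientation v ≡ suc (toℕ (c v))
      orientation-d⁻ v = trans (#-list (λ u → arc orientation u v) (nbrs v) (nbrs-unique v)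
          (λ u p → near-nbrs v u (subst T (Graph.adj-sym graph u v) (Orientation.arc⇒adj orientation u v p)))) total
        where
        value : ∀ a b d → a ≢ b → b ≢ d → d ≢ a →
                toNat (toℕ {3} b <ᵇ toℕ {3} a) + (toNat (toℕ {3} d <ᵇ toℕ a) + 1) ≡ suc (toℕ a)
        value = from-yes (all? λ a → all? λ b → all? λ d → ¬? (a ≟ b) →-dec (¬? (b ≟ d) →-dec (¬? (d ≟ a) →-dec
                  (toNat (toℕ {3} b <ᵇ toℕ {3} a) + (toNat (toℕ {3} d <ᵇ toℕ a) + 1) ℕₚ.≟ suc (toℕ a)))))
        from-tri : ∀ {u} → tri v u ≡ true → arc orientation u v ≡ up u v
        from-tri {u} t rewrite trans (tri-sym u v) t | tri-ext u v (trans (tri-sym u v) t) = Data.Bool.Properties.∨-identityʳ _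
        from-s : arc orientation (s v) v ≡ false
        from-s rewrite ext-ext v (s v) (ext-s v) | tri-sym (s v) v with tri v (s v) in t
        ... | true  = contradiction (trans (sym (ext-s v)) (tri-ext v (s v) t)) λ ()
        ... | false = refl
        from-s⁻ : arc orientation (s⁻ v) v ≡ true
        from-s⁻ rewrite subst (λ x → ext (s⁻ v) x ≡ true) (s-s⁻ v) (ext-s (s⁻ v)) = Data.Bool.Properties.∨-zeroʳ _
        total : sum (map (λ u → toNat (arc orientation u v)) (nbrs v)) ≡ suc (toℕ (c v))
        total = trans
          (cong₂ _+_ (cong toNat (from-tri {r v} (tri-r v))) (cong₂ _+_ (cong toNat (from-tri {r⁻ v} (tri-r⁻ v)))
            (cong₂ (λ a b → toNat a + (toNat b + 0)) from-s from-s⁻)))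
          (value (c v) (c (r v)) (c (r⁻ v)) (proj₁ (proper v))
            (λ eq → proj₁ (proper (r v)) (trans eq (cong c (sym (r-r v)))))
            (λ eq → proj₁ (proper (r⁻ v)) (trans eq (cong c (sym (r-r⁻ v))))))

      orientation-Balanced : Balanced graph orientation
      orientation-Balanced =
        (λ v → subst (λ d → 1 ≤ d × d ≤ 3) (sym (orientation-d⁻ v)) (s≤s z≤n , toℕ<n (c v))) ,
        (λ u v p eq → c-near u v p (toℕ-injective (suc-injective (trans (sym (orientation-d⁻ u)) (trans eq (orientation-d⁻ v))))))

-- Rings of triangles that copy colours.

module RingGadget where

  open import Data.Bool.Base using (Bool; true; false)
  open import Data.Fin.Base using (Fin; zero; suc)
  open import Data.Fin.Properties using (_≟_; all?)
  open import Data.Product.Base using (Σ-syntax; _×_; _,_; proj₁; proj₂)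
  open import Relation.Binary.PropositionalEquality
  open import Relation.Nullary.Decidable using (from-yes; ¬?; _→-dec_; _×-dec_)
  open TriangleGraph

  open TriangleSystem

  transport : ∀ {V W : Set} (to : V → W) (from : W → V) → (∀ v → from (to v) ≡ v) → (∀ w → to (from w) ≡ w) →
              TriangleSystem V → TriangleSystem W
  transport {V} {W} to from from-to to-from S = record
    { r = lift (r S) ; r⁻ = lift (r⁻ S) ; s = lift (s S) ; s⁻ = lift (s⁻ S)
    ; r-r   = λ w → trans (lift-lift (r S) (r S) w) (cong to (r-r S (from w)))
    ; r-r⁻  = λ w → trans (lift-lift (r S) (r⁻ S) w) (trans (cong to (r-r⁻ S (from w))) (to-from w))
    ; r⁻-r  = λ w → trans (lift-lift (r⁻ S) (r S) w) (trans (cong to (r⁻-r S (from w))) (to-from w))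
    ; s-s⁻  = λ w → trans (lift-lift (s S) (s⁻ S) w) (trans (cong to (s-s⁻ S (from w))) (to-from w))
    ; s⁻-s  = λ w → trans (lift-lift (s⁻ S) (s S) w) (trans (cong to (s⁻-s S (from w))) (to-from w))
    ; r≢id  = λ w eq → r≢id S (from w) (trans (sym (from-to _)) (cong from eq))
    ; s≢id  = λ w eq → s≢id S (from w) (trans (sym (from-to _)) (cong from eq))
    ; r⁻≢r  = λ w eq → r⁻≢r S (from w) (injective eq)
    ; s≢r   = λ w eq → s≢r S (from w) (injective eq)
    ; s≢r⁻  = λ w eq → s≢r⁻ S (from w) (injective eq)
    ; s≢s⁻  = λ w eq → s≢s⁻ S (from w) (injective eq)
    }
    where
    lift : (V → V) → W → W
    lift f w = to (f (from w))
    lift-lift : ∀ f g w → lift f (lift g w) ≡ to (f (g (from w)))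
    lift-lift f g w = cong (λ v → to (f v)) (from-to (g (from w)))
    injective : ∀ {u v} → to u ≡ to v → u ≡ v
    injective {u} {v} eq = trans (sym (from-to u)) (trans (cong from eq) (from-to v))

  ProperOn : ∀ {V : Set} → TriangleSystem V → (V → Fin 3) → Set
  ProperOn S c = ∀ v → c v ≢ c (r S v) × c v ≢ c (s S v)

  data Kind : Set where
    A B C S : Kind

  -- Consumers y are grouped into triangles by rot, and consumer y copies the
  -- colour of provider θ y; colours of providers are constant along π₀.
  record Wiring (Y : Set) : Set where
    field
      rot rot⁻ θ θ⁻ π₀ π₀⁻ : Y → Y
      rot-rot  : ∀ y → rot (rot y) ≡ rot⁻ y
      rot-rot⁻ : ∀ y → rot (rot⁻ y) ≡ y
      rot⁻-rot : ∀ y → rot⁻ (rot y) ≡ y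
      rot≢id   : ∀ y → rot y ≢ y
      rot⁻≢rot : ∀ y → rot⁻ y ≢ rot y
      θ-θ⁻     : ∀ y → θ (θ⁻ y) ≡ y
      θ⁻-θ     : ∀ y → θ⁻ (θ y) ≡ y
      π₀-π₀⁻   : ∀ y → π₀ (π₀⁻ y) ≡ y
      π₀⁻-π₀   : ∀ y → π₀⁻ (π₀ y) ≡ y

  module _ {Y : Set} (W : Wiring Y) where

    open Wiring W

    -- Two copies of everything guarantee that π has no fixed point.
    Node : Set
    Node = Kind × (Bool × Y)

    π π⁻ : Bool × Y → Bool × Y
    π (false , y) = true , y
    π (true , y)  = false , π₀ y
    π⁻ (true , y)  = false , y
    π⁻ (false , y) = true , π₀⁻ y

    private
      π-π⁻ : ∀ x → π (π⁻ x) ≡ x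
      π-π⁻ (true , y)  = refl
      π-π⁻ (false , y) = cong (false ,_) (π₀-π₀⁻ y)

      π⁻-π : ∀ x → π⁻ (π x) ≡ x
      π⁻-π (false , y) = refl
      π⁻-π (true , y)  = cong (true ,_) (π₀⁻-π₀ y)

      π≢id : ∀ x → π x ≢ x
      π≢id (false , y) ()
      π≢id (true , y)  ()

      π⁻≢id : ∀ x → π⁻ x ≢ x
      π⁻≢id (false , y) ()
      π⁻≢id (true , y)  ()

    -- The triangles are A, B, C at a provider and the rot-orbits of S.  Since
    -- (A , π x) is joined by swap to (B , x) and (C , x), it has the colour of
    -- (A , x); likewise (S , (e , y)) has the colour of (A , (e , θ y)).
    rotate rotate⁻ swap swap⁻ : Node → Node
    rotate (A , x)         = B , x
    rotate (B , x)         = C , x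
    rotate (C , x)         = A , x
    rotate (S , (e , y))   = S , (e , rot y)
    rotate⁻ (A , x)        = C , x
    rotate⁻ (B , x)        = A , x
    rotate⁻ (C , x)        = B , x
    rotate⁻ (S , (e , y))  = S , (e , rot⁻ y)
    swap (A , x)           = C , π⁻ x
    swap (B , x)           = A , π x
    swap (C , (e , y))     = S , (e , θ⁻ y)
    swap (S , (e , y))     = B , (e , θ y)
    swap⁻ (A , x)          = B , π⁻ x
    swap⁻ (B , (e , y))    = S , (e , θ⁻ y)
    swap⁻ (C , x)          = A , π x
    swap⁻ (S , (e , y))    = C , (e , θ y)

    wiringSystem : TriangleSystem Node
    wiringSystem = record
      { r = rotate ; r⁻ = rotate⁻ ; s = swap ; s⁻ = swap⁻
      ; r-r   = λ { (A , x) → refl ; (B , x) → refl ; (C , x) → refl ; (S , (e , y)) → cong (λ y → S , (e , y)) (rot-rot y) }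
      ; r-r⁻  = λ { (A , x) → refl ; (B , x) → refl ; (C , x) → refl ; (S , (e , y)) → cong (λ y → S , (e , y)) (rot-rot⁻ y) }
      ; r⁻-r  = λ { (A , x) → refl ; (B , x) → refl ; (C , x) → refl ; (S , (e , y)) → cong (λ y → S , (e , y)) (rot⁻-rot y) }
      ; s-s⁻  = λ { (A , x) → cong (A ,_) (π-π⁻ x) ; (B , (e , y)) → cong (λ y → B , (e , y)) (θ-θ⁻ y)
                  ; (C , x) → cong (C ,_) (π⁻-π x) ; (S , (e , y)) → cong (λ y → S , (e , y)) (θ⁻-θ y) }
      ; s⁻-s  = λ { (A , x) → cong (A ,_) (π-π⁻ x) ; (B , x) → cong (B ,_) (π⁻-π x)
                  ; (C , (e , y)) → cong (λ y → C , (e , y)) (θ-θ⁻ y) ; (S , (e , y)) → cong (λ y → S , (e , y)) (θ⁻-θ y) }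
      ; r≢id  = λ { (A , x) () ; (B , x) () ; (C , x) () ; (S , (e , y)) eq → rot≢id y (cong (λ v → proj₂ (proj₂ v)) eq) }
      ; s≢id  = λ { (A , x) () ; (B , x) () ; (C , x) () ; (S , x) () }
      ; r⁻≢r  = λ { (A , x) () ; (B , x) () ; (C , x) () ; (S , (e , y)) eq → rot⁻≢rot y (cong (λ v → proj₂ (proj₂ v)) eq) }
      ; s≢r   = λ { (A , x) () ; (B , x) () ; (C , x) () ; (S , x) () }
      ; s≢r⁻  = λ { (A , x) eq → π⁻≢id x (cong proj₂ eq) ; (B , x) eq → π≢id x (cong proj₂ eq) ; (C , x) () ; (S , x) () }
      ; s≢s⁻  = λ { (A , x) () ; (B , x) () ; (C , x) () ; (S , x) () }
      }

    -- Only the providers are coloured here; consumer y shows `f (θ y)`. As rot has order three, the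
    -- second condition makes the colours in every consumer triangle pairwise different.
    Solution : (Y → Fin 3) → Set
    Solution f = (∀ y → f (π₀ y) ≡ f y) × (∀ y → f (θ y) ≢ f (θ (rot y)))

    private
      -- The principle by which edges copy a colour: a vertex joined to two corners of a triangle
      -- has the colour of the third.
      third : ∀ (a b d x : Fin 3) → a ≢ b → b ≢ d → d ≢ a → x ≢ b → x ≢ d → x ≡ a
      third = from-yes (all? λ (a : Fin 3) → all? λ (b : Fin 3) → all? λ (d : Fin 3) → all? λ (x : Fin 3) →
        ¬? (a ≟ b) →-dec (¬? (b ≟ d) →-dec (¬? (d ≟ a) →-dec (¬? (x ≟ b) →-dec (¬? (x ≟ d) →-dec (x ≟ a))))))

      succ : Fin 3 → Fin 3
      succ zero             = suc zero
      succ (suc zero)       = suc (suc zero)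
      succ (suc (suc zero)) = zero

      succ≢ : ∀ a → a ≢ succ a × a ≢ succ (succ a)
      succ≢ = from-yes (all? λ a → ¬? (a ≟ succ a) ×-dec ¬? (a ≟ succ (succ a)))

    proper⇒solution : ∀ c → ProperOn wiringSystem c → Solution (λ y → c (A , (false , y)))
    -- Two steps of π, through the other copy and back, make one step of π₀.
    proper⇒solution c proper = (λ y → trans (along (true , y)) (along (false , y))) ,
      (λ y eq → proj₁ (proper (S , (false , y))) (trans (copies false y) (trans eq (sym (copies false (rot y))))))
      where
      like-A : ∀ x a → a ≢ c (B , x) → a ≢ c (C , x) → a ≡ c (A , x)
      like-A x a = third (c (A , x)) (c (B , x)) (c (C , x)) a (proj₁ (proper (A , x))) (proj₁ (proper (B , x))) (proj₁ (proper (C , x)))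
      along : ∀ x → c (A , π x) ≡ c (A , x)
      along x = like-A x _ (λ eq → proj₂ (proper (B , x)) (sym eq))
        (λ eq → proj₂ (proper (A , π x)) (trans eq (cong (λ x → c (C , x)) (sym (π⁻-π x)))))
      copies : ∀ e y → c (S , (e , y)) ≡ c (A , (e , θ y))
      copies e y = like-A (e , θ y) _ (proj₂ (proper (S , (e , y))))
        (λ eq → proj₂ (proper (C , (e , θ y))) (trans (sym eq) (cong (λ y → c (S , (e , y))) (sym (θ⁻-θ y)))))

    solution⇒proper : ∀ f → Solution f → Σ[ c ∈ (Node → Fin 3) ] ProperOn wiringSystem c
    solution⇒proper f (same , distinct) = c , proper
      where
      c : Node → Fin 3
      c (A , (e , y)) = f y
      c (B , (e , y)) = succ (f y)
      c (C , (e , y)) = succ (succ (f y))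
      c (S , (e , y)) = f (θ y)
      along : ∀ x → f (proj₂ (π x)) ≡ f (proj₂ x)
      along (false , y) = refl
      along (true , y)  = same y
      back : ∀ x → f (proj₂ (π⁻ x)) ≡ f (proj₂ x)
      back x = trans (sym (along (π⁻ x))) (cong (λ x → f (proj₂ x)) (π-π⁻ x))
      proper : ProperOn wiringSystem c
      proper (A , x)       = proj₁ (succ≢ _) , (λ eq → proj₂ (succ≢ (f (proj₂ x))) (trans eq (cong (λ a → succ (succ a)) (back x))))
      proper (B , x)       = proj₁ (succ≢ _) , (λ eq → proj₁ (succ≢ (f (proj₂ x))) (trans (sym (along x)) (sym eq)))
      proper (C , (e , y)) = (λ eq → proj₂ (succ≢ (f y)) (sym eq)) ,
        (λ eq → proj₂ (succ≢ (f y)) (trans (cong f (sym (θ-θ⁻ y))) (sym eq)))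
      proper (S , (e , y)) = distinct y , proj₁ (succ≢ _)

-- Local constraints as triples of variables with pairwise different colours.

module Rainbow where

  open import Data.Bool.Base using (Bool; true; false; not; if_then_else_)
  open import Data.Fin.Base using (Fin; zero; suc; inject₁; fromℕ)
  open import Data.Fin.Properties using (_≟_; any?)
  open import Data.Nat.Base using (ℕ; zero; suc)
  open import Data.Product.Base using (_×_; _,_; proj₁; proj₂)
  open import Data.Sum.Base using (_⊎_; inj₁; inj₂)
  open import Function.Base using (_∘_)
  open import Relation.Binary.Definitions using (DecidableEquality)
  open import Relation.Binary.PropositionalEquality
  open import Relation.Nullary.Decidable using (yes; no; does)
  open import Relation.Nullary.Negation using (contradiction)
  open Finiteness

  -- The cycles of the permutation are exactly the fibres of `var`. Transitivity on a fibre is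
  -- expressed by invariant functions, the form in which colours along a ring are used.
  record FibrePermutation {O : ℕ} {X : Set} (var : Fin O → X) : Set₁ where
    field
      perm perm⁻  : Fin O → Fin O
      perm-perm⁻  : ∀ o → perm (perm⁻ o) ≡ o
      perm⁻-perm  : ∀ o → perm⁻ (perm o) ≡ o
      var-perm : ∀ o → var (perm o) ≡ var o
      constant : ∀ {Z : Set} (f : Fin O → Z) → (∀ o → f (perm o) ≡ f o) → ∀ o p → var o ≡ var p → f o ≡ f p

  -- By induction: the new element either is alone in its fibre, or it is inserted into an existing
  -- cycle immediately after some `o₀` of the same fibre.
  fibrePermutation : ∀ {O X} → DecidableEquality X → (var : Fin O → X) → FibrePermutation var
  fibrePermutation {zero}  _≟ˣ_ var = record
    { perm = λ () ; perm⁻ = λ () ; perm-perm⁻ = λ () ; perm⁻-perm = λ () ; var-perm = λ () ; constant = λ _ _ () }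
  fibrePermutation {suc O} _≟ˣ_ var with fibrePermutation _≟ˣ_ (var ∘ suc) | any? (λ o → var (suc o) ≟ˣ var zero)
  ... | F | no none = record
    { perm = perm′ ; perm⁻ = perm⁻′
    ; perm-perm⁻  = λ { zero → refl ; (suc o) → cong suc (F.perm-perm⁻ o) }
    ; perm⁻-perm  = λ { zero → refl ; (suc o) → cong suc (F.perm⁻-perm o) }
    ; var-perm = λ { zero → refl ; (suc o) → F.var-perm o }
    ; constant = const′ }
    where
    module F = FibrePermutation F
    perm′ perm⁻′ : Fin (suc O) → Fin (suc O)
    perm′ zero    = zero
    perm′ (suc o) = suc (F.perm o)
    perm⁻′ zero    = zero
    perm⁻′ (suc o) = suc (F.perm⁻ o)
    const′ : ∀ {Z : Set} (f : Fin (suc O) → Z) → (∀ o → f (perm′ o) ≡ f o) → ∀ o p → var o ≡ var p → f o ≡ f p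
    const′ f inv zero    zero    eq = refl
    const′ f inv zero    (suc p) eq = contradiction (p , sym eq) none
    const′ f inv (suc o) zero    eq = contradiction (o , eq) none
    const′ f inv (suc o) (suc p) eq = F.constant (f ∘ suc) (inv ∘ suc) o p eq
  ... | F | yes (o₀ , eq₀) = record
    { perm = perm′ ; perm⁻ = perm⁻′ ; perm-perm⁻ = inv₁ ; perm⁻-perm = inv₂ ; var-perm = var-perm′ ; constant = const′ }
    where
    module F = FibrePermutation F
    perm′ perm⁻′ : Fin (suc O) → Fin (suc O)
    perm′ zero    = suc (F.perm o₀)
    perm′ (suc o) = if does (o ≟ o₀) then zero else suc (F.perm o)
    perm⁻′ zero    = suc o₀
    perm⁻′ (suc o) = if does (F.perm⁻ o ≟ o₀) then zero else suc (F.perm⁻ o)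
    at-o₀ : perm′ (suc o₀) ≡ zero
    at-o₀ with o₀ ≟ o₀
    ... | yes _ = refl
    ... | no ne = contradiction refl ne
    inv₁ : ∀ o → perm′ (perm⁻′ o) ≡ o
    inv₁ zero = at-o₀
    inv₁ (suc o) with F.perm⁻ o ≟ o₀
    ... | yes eq = cong suc (trans (cong F.perm (sym eq)) (F.perm-perm⁻ o))
    ... | no ne with F.perm⁻ o ≟ o₀
    ...   | yes eq = contradiction eq ne
    ...   | no _   = cong suc (F.perm-perm⁻ o)
    inv₂ : ∀ o → perm⁻′ (perm′ o) ≡ o
    inv₂ zero with F.perm⁻ (F.perm o₀) ≟ o₀
    ... | yes _ = refl
    ... | no ne = contradiction (F.perm⁻-perm o₀) ne
    inv₂ (suc o) with o ≟ o₀
    ... | yes refl = refl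
    ... | no ne with F.perm⁻ (F.perm o) ≟ o₀
    ...   | yes eq = contradiction (trans (sym (F.perm⁻-perm o)) eq) ne
    ...   | no _   = cong suc (F.perm⁻-perm o)
    var-perm′ : ∀ o → var (perm′ o) ≡ var o
    var-perm′ zero = trans (F.var-perm o₀) eq₀
    var-perm′ (suc o) with o ≟ o₀
    ... | yes refl = sym eq₀
    ... | no _     = F.var-perm o
    const′ : ∀ {Z : Set} (f : Fin (suc O) → Z) → (∀ o → f (perm′ o) ≡ f o) → ∀ o p → var o ≡ var p → f o ≡ f p
    const′ f inv = result
      where
      f₀ : f zero ≡ f (suc o₀)
      f₀ = trans (cong f (sym at-o₀)) (inv (suc o₀))
      -- Bypassing the inserted element turns invariance under the new permutation into invariance
      -- under the old one.
      old : ∀ o → f (suc (F.perm o)) ≡ f (suc o)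
      old o with o ≟ o₀ | inv (suc o)
      ... | yes refl | _  = trans (inv zero) f₀
      ... | no _     | eq = eq
      result : ∀ o p → var o ≡ var p → f o ≡ f p
      result zero    zero    eq = refl
      result zero    (suc p) eq = trans f₀ (F.constant (f ∘ suc) old o₀ p (trans eq₀ eq))
      result (suc o) zero    eq = trans (F.constant (f ∘ suc) old o o₀ (trans eq (sym eq₀))) (sym f₀)
      result (suc o) (suc p) eq = F.constant (f ∘ suc) old o p eq

  module FiniteFibres {A X : Set} (F : Finite A) (_≟ˣ_ : DecidableEquality X) (var : A → X) where

    open Finite F

    private
      fibres : FibrePermutation (λ i → var (from i))
      fibres = fibrePermutation _≟ˣ_ (λ i → var (from i))

      module Fib = FibrePermutation fibres

    next next⁻ : A → A
    next o = from (Fib.perm (to o))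
    next⁻ o = from (Fib.perm⁻ (to o))

    next-next⁻ : ∀ o → next (next⁻ o) ≡ o
    next-next⁻ o = trans (cong (λ i → from (Fib.perm i)) (to-from _)) (trans (cong from (Fib.perm-perm⁻ (to o))) (from-to o))

    next⁻-next : ∀ o → next⁻ (next o) ≡ o
    next⁻-next o = trans (cong (λ i → from (Fib.perm⁻ i)) (to-from _)) (trans (cong from (Fib.perm⁻-perm (to o))) (from-to o))

    var-next : ∀ o → var (next o) ≡ var o
    var-next o = trans (Fib.var-perm (to o)) (cong var (from-to o))

    next-constant : ∀ {Z : Set} (f : A → Z) → (∀ o → f (next o) ≡ f o) → ∀ o p → var o ≡ var p → f o ≡ f p
    next-constant f inv o p eq = trans (cong f (sym (from-to o)))
      (trans (Fib.constant (f ∘ from) (λ i → trans (cong (λ j → f (from (Fib.perm j))) (sym (to-from i))) (inv (from i)))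
                (to o) (to p) (trans (cong var (from-to o)) (trans eq (cong var (sym (from-to p))))))
             (cong f (from-to p)))

  -- A computation step is checked from the earlier of its two rows, so the only vertical neighbour
  -- is the one below.
  data Offset : Set where
    here left right down : Offset

  finite-Offset : Finite Offset
  finite-Offset = record
    { size = 4
    ; to = λ { here → zero ; left → suc zero ; right → suc (suc zero) ; down → suc (suc (suc zero)) }
    ; from = λ { zero → here ; (suc zero) → left ; (suc (suc zero)) → right ; (suc (suc (suc zero))) → down }
    ; from-to = λ { here → refl ; left → refl ; right → refl ; down → refl }
    ; to-from = λ { zero → refl ; (suc zero) → refl ; (suc (suc zero)) → refl ; (suc (suc (suc zero))) → refl } }

  turn turn⁻ : Fin 3 → Fin 3
  turn zero              = suc zero
  turn (suc zero)        = suc (suc zero)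
  turn (suc (suc zero))  = zero
  turn⁻ zero             = suc (suc zero)
  turn⁻ (suc zero)       = zero
  turn⁻ (suc (suc zero)) = suc zero

  -- The palette of the usual reduction to 3-colouring: true, false and base.
  pattern T̂ = zero
  pattern F̂ = suc zero
  pattern B̂ = suc (suc zero)

  -- The constraints at a cell of a torus: there are `flags` bits given with
  -- the cell, `bits` unknown bits in each cell, and for each k < clauses the
  -- bits listed by `source` must not all agree with `bad k`.
  record LocalConstraints : Set where
    field
      flags bits clauses width : ℕ
      source : Fin width → Fin flags ⊎ (Offset × Fin bits)
      bad    : Fin clauses → Fin width → Bool

  module Local (L : LocalConstraints) where

    open LocalConstraints L

    -- Every triple of variables must receive three different colours.
    data Triple : Set where
      palette  : Offset → Fin 3 → Triple
      negation : Fin bits → Triple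
      flag     : Fin flags → Bool → Triple
      link     : Fin clauses → Fin width → Fin 3 → Triple
      begin    : Fin clauses → Triple
      end      : Fin clauses → Triple

    -- Bits and flags have two variables each, for themselves and for their negations. `chain k j`
    -- stands for the disjunction of the first j literals of clause k, and the `aux` are inner
    -- vertices of its disjunction gadgets. `slack` completes the triple that keeps the end of a
    -- chain away from F.
    data Var : Set where
      pal   : Fin 3 → Var
      lit   : Fin bits → Bool → Var
      flg   : Fin flags → Bool → Var
      chain : Fin clauses → Fin (suc width) → Var
      aux   : Fin clauses → Fin width → Fin 4 → Var
      slack : Fin clauses → Var

    finite-Triple : Finite Triple
    finite-Triple = finite-iso
      (λ { (palette d i) → inj₁ (d , i) ; (negation w) → inj₂ (inj₁ w) ; (flag i b) → inj₂ (inj₂ (inj₁ (i , b)))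
         ; (link k j l) → inj₂ (inj₂ (inj₂ (inj₁ (k , (j , l))))) ; (begin k) → inj₂ (inj₂ (inj₂ (inj₂ (inj₁ k))))
         ; (end k) → inj₂ (inj₂ (inj₂ (inj₂ (inj₂ k)))) })
      (λ { (inj₁ (d , i)) → palette d i ; (inj₂ (inj₁ w)) → negation w ; (inj₂ (inj₂ (inj₁ (i , b)))) → flag i b
         ; (inj₂ (inj₂ (inj₂ (inj₁ (k , (j , l)))))) → link k j l ; (inj₂ (inj₂ (inj₂ (inj₂ (inj₁ k))))) → begin k
         ; (inj₂ (inj₂ (inj₂ (inj₂ (inj₂ k))))) → end k })
      (λ { (palette d i) → refl ; (negation w) → refl ; (flag i b) → refl ; (link k j l) → refl ; (begin k) → refl ; (end k) → refl })
      (λ { (inj₁ (d , i)) → refl ; (inj₂ (inj₁ w)) → refl ; (inj₂ (inj₂ (inj₁ (i , b)))) → refl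
         ; (inj₂ (inj₂ (inj₂ (inj₁ (k , (j , l)))))) → refl ; (inj₂ (inj₂ (inj₂ (inj₂ (inj₁ k))))) → refl
         ; (inj₂ (inj₂ (inj₂ (inj₂ (inj₂ k))))) → refl })
      (finite-⊎ (finite-× finite-Offset (finite-Fin 3)) (finite-⊎ (finite-Fin bits) (finite-⊎ (finite-× (finite-Fin flags) finite-Bool)
        (finite-⊎ (finite-× (finite-Fin clauses) (finite-× (finite-Fin width) (finite-Fin 3)))
          (finite-⊎ (finite-Fin clauses) (finite-Fin clauses))))))

    finite-Var : Finite Var
    finite-Var = finite-iso
      (λ { (pal i) → inj₁ i ; (lit w b) → inj₂ (inj₁ (w , b)) ; (flg i b) → inj₂ (inj₂ (inj₁ (i , b)))
         ; (chain k j) → inj₂ (inj₂ (inj₂ (inj₁ (k , j)))) ; (aux k j l) → inj₂ (inj₂ (inj₂ (inj₂ (inj₁ (k , (j , l))))))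
         ; (slack k) → inj₂ (inj₂ (inj₂ (inj₂ (inj₂ k)))) })
      (λ { (inj₁ i) → pal i ; (inj₂ (inj₁ (w , b))) → lit w b ; (inj₂ (inj₂ (inj₁ (i , b)))) → flg i b
         ; (inj₂ (inj₂ (inj₂ (inj₁ (k , j))))) → chain k j ; (inj₂ (inj₂ (inj₂ (inj₂ (inj₁ (k , (j , l))))))) → aux k j l
         ; (inj₂ (inj₂ (inj₂ (inj₂ (inj₂ k))))) → slack k })
      (λ { (pal i) → refl ; (lit w b) → refl ; (flg i b) → refl ; (chain k j) → refl ; (aux k j l) → refl ; (slack k) → refl })
      (λ { (inj₁ i) → refl ; (inj₂ (inj₁ (w , b))) → refl ; (inj₂ (inj₂ (inj₁ (i , b)))) → refl
         ; (inj₂ (inj₂ (inj₂ (inj₁ (k , j))))) → refl ; (inj₂ (inj₂ (inj₂ (inj₂ (inj₁ (k , (j , l))))))) → refl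
         ; (inj₂ (inj₂ (inj₂ (inj₂ (inj₂ k))))) → refl })
      (finite-⊎ (finite-Fin 3) (finite-⊎ (finite-× (finite-Fin bits) finite-Bool) (finite-⊎ (finite-× (finite-Fin flags) finite-Bool)
        (finite-⊎ (finite-× (finite-Fin clauses) (finite-Fin (suc width)))
          (finite-⊎ (finite-× (finite-Fin clauses) (finite-× (finite-Fin width) (finite-Fin 4))) (finite-Fin clauses))))))

    Occ : Set
    Occ = Triple × Fin 3

    finite-Occ : Finite Occ
    finite-Occ = finite-× finite-Triple (finite-Fin 3)

    -- Clause k excludes the pattern `bad k`, so its literals say that the bit at j differs from the
    -- pattern.
    literal : Fin clauses → Fin width → Offset × Var
    literal k j with source j
    ... | inj₁ i       = here , flg i (not (bad k j))
    ... | inj₂ (d , w) = d , lit w (not (bad k j))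

    -- A link computes chain (j + 1) = chain j ∨ literal j, in one direction:
    -- if both inputs are coloured F, then so is the output.
    ref : Occ → Offset × Var
    -- Colour i is taken from the neighbour and the other two from this cell. Hence the neighbour's
    -- colour i agrees with the one here, and all cells reached by the offsets share a palette.
    ref (palette d i  , j)  = (if does (j ≟ i) then d else here) , pal j
    ref (negation w   , T̂) = here , lit w true
    ref (negation w   , F̂) = here , lit w false
    ref (negation w   , B̂) = here , pal B̂
    -- Without a twist the two triples of a flag force `flg i true` to T and `flg i false` to F.
    ref (flag i b     , T̂) = here , flg i b
    ref (flag i b     , F̂) = here , pal B̂
    ref (flag i b     , B̂) = here , pal (if b then F̂ else T̂)
    ref (link k j T̂   , T̂) = here , chain k (inject₁ j)
    ref (link k j T̂   , F̂) = here , aux k j zero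
    ref (link k j T̂   , B̂) = here , aux k j (suc (suc zero))
    ref (link k j F̂   , T̂) = literal k j
    ref (link k j F̂   , F̂) = here , aux k j (suc zero)
    ref (link k j F̂   , B̂) = here , aux k j (suc (suc (suc zero)))
    ref (link k j B̂   , T̂) = here , aux k j zero
    ref (link k j B̂   , F̂) = here , aux k j (suc zero)
    ref (link k j B̂   , B̂) = here , chain k (suc j)
    ref (begin k      , T̂) = here , chain k zero
    ref (begin k      , F̂) = here , pal T̂
    ref (begin k      , B̂) = here , pal B̂
    ref (end k        , T̂) = here , chain k (fromℕ width)
    ref (end k        , F̂) = here , pal F̂
    ref (end k        , B̂) = here , slack k

    offset : Occ → Offset
    offset o = proj₁ (ref o)

    var : Occ → Var
    var o = proj₂ (ref o)

    -- If a flag is false, then T and F are exchanged in its two triples.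
    twist : (Fin flags → Bool) → Occ → Occ
    twist β (flag i b , B̂) = flag i (if β i then b else not b) , B̂
    twist β o = o

    occurrence : Var → Occ
    occurrence (pal i)                              = palette here i , i
    occurrence (lit w true)                         = negation w , T̂
    occurrence (lit w false)                        = negation w , F̂
    occurrence (flg i b)                            = flag i b , T̂
    occurrence (chain k zero)                       = begin k , T̂
    occurrence (chain k (suc j))                    = link k j B̂ , B̂
    occurrence (aux k j zero)                       = link k j B̂ , T̂
    occurrence (aux k j (suc zero))                 = link k j B̂ , F̂
    occurrence (aux k j (suc (suc zero)))           = link k j T̂ , B̂
    occurrence (aux k j (suc (suc (suc zero))))     = link k j F̂ , B̂
    occurrence (slack k)                            = end k , B̂

    var-occurrence : ∀ x → var (occurrence x) ≡ x
    var-occurrence (pal i)                          = refl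
    var-occurrence (lit w true)                     = refl
    var-occurrence (lit w false)                    = refl
    var-occurrence (flg i b)                        = refl
    var-occurrence (chain k zero)                   = refl
    var-occurrence (chain k (suc j))                = refl
    var-occurrence (aux k j zero)                   = refl
    var-occurrence (aux k j (suc zero))             = refl
    var-occurrence (aux k j (suc (suc zero)))       = refl
    var-occurrence (aux k j (suc (suc (suc zero)))) = refl
    var-occurrence (slack k)                        = refl

    twist-twist : ∀ β o → twist β (twist β o) ≡ o
    twist-twist β (palette d i , j)  = refl
    twist-twist β (negation w , j)   = refl
    twist-twist β (flag i b , T̂)    = refl
    twist-twist β (flag i b , F̂)    = refl
    twist-twist β (flag i b , B̂) with β i | b
    ... | true  | _     = refl
    ... | false | true  = refl
    ... | false | false = refl
    twist-twist β (link k j l , i)   = refl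
    twist-twist β (begin k , j)      = refl
    twist-twist β (end k , j)        = refl

    twist-offset : ∀ β o → offset (twist β o) ≡ offset o
    twist-offset β (palette d i , j)  = refl
    twist-offset β (negation w , j)   = refl
    twist-offset β (flag i b , T̂)    = refl
    twist-offset β (flag i b , F̂)    = refl
    twist-offset β (flag i b , B̂)    = refl
    twist-offset β (link k j l , i)   = refl
    twist-offset β (begin k , j)      = refl
    twist-offset β (end k , j)        = refl

    -- A twisted occurrence is plugged within its own cell. So it does not matter at which end of a
    -- shift the flags are looked up, and plugging has an inverse.
    twist-moved : ∀ o → offset o ≡ here ⊎ (∀ β′ → twist β′ o ≡ o)
    twist-moved (palette d i , j)  = inj₂ (λ _ → refl)
    twist-moved (negation w , j)   = inj₂ (λ _ → refl)
    twist-moved (flag i b , T̂)    = inj₁ refl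
    twist-moved (flag i b , F̂)    = inj₁ refl
    twist-moved (flag i b , B̂)    = inj₁ refl
    twist-moved (link k j l , i)   = inj₂ (λ _ → refl)
    twist-moved (begin k , j)      = inj₂ (λ _ → refl)
    twist-moved (end k , j)        = inj₂ (λ _ → refl)

    open FiniteFibres {Occ} {Var} finite-Occ (Finite.equal? finite-Var) var public

-- Satisfying assignments and solutions of the wiring.

module Satisfaction where

  open import Data.Bool.Base using (Bool; true; false; not; _∨_; if_then_else_)
  open import Data.Bool.Properties using (∨-assoc; ∨-comm; ∨-zeroʳ)
  import Data.Bool.Properties as Boolₚ
  open import Data.Fin.Base using (Fin; zero; suc; inject₁; fromℕ)
  open import Data.Fin.Induction using (<-weakInduction)
  open import Data.Fin.Properties using (_≟_; all?; ¬∀⟶∃¬)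
  open import Data.Nat.Base using (zero; suc)
  open import Data.Product.Base using (Σ-syntax; _×_; _,_; proj₁; proj₂)
  open import Data.Sum.Base using (inj₁; inj₂)
  open import Function.Base using (_∘_)
  open import Relation.Binary.PropositionalEquality
  open import Relation.Nullary.Decidable using (Dec; yes; no; does; from-yes; ¬?; _→-dec_; _×-dec_)
  open import Relation.Nullary.Negation using (¬_; contradiction)
  open RingGadget
  open Rainbow

  -- Every provider is plugged into exactly one consumer, so the shifts have to be invertible; a
  -- bounded grid with free borders would not do.
  record Torus : Set₁ where
    field
      Cell   : Set
      shift   : Offset → Cell → Cell
      shift⁻  : Offset → Cell → Cell
      shift-here  : ∀ c → shift here c ≡ c
      shift-shift⁻ : ∀ d c → shift d (shift⁻ d c) ≡ c
      shift⁻-shift : ∀ d c → shift⁻ d (shift d c) ≡ c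

  Distinct : Fin 3 → Fin 3 → Fin 3 → Set
  Distinct a b d = a ≢ b × b ≢ d × d ≢ a

  tf : Bool → Fin 3
  tf true  = T̂
  tf false = F̂

  equals : Bool → Bool → Bool
  equals a b = does (a Boolₚ.≟ b)

  distinct? : ∀ (a b d : Fin 3) → Dec (Distinct a b d)
  distinct? a b d = ¬? (a ≟ b) ×-dec ¬? (b ≟ d) ×-dec ¬? (d ≟ a)

  -- The disjunction of the literals before a position, which is the intended truth value of the
  -- chain there.
  reached : ∀ {m} → (Fin m → Bool) → Fin (suc m) → Bool
  reached l zero            = false
  reached {suc m} l (suc j) = l zero ∨ reached (l ∘ suc) j

  reached-suc : ∀ {m} (l : Fin m → Bool) j → reached l (suc j) ≡ reached l (inject₁ j) ∨ l j
  reached-suc l zero    = ∨-comm (l zero) false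
  reached-suc l (suc j) = trans (cong (l zero ∨_) (reached-suc (l ∘ suc) j)) (sym (∨-assoc (l zero) _ _))

  reached-all : ∀ {m} (l : Fin m → Bool) j → l j ≡ true → reached l (fromℕ m) ≡ true
  reached-all {suc m} l zero    eq rewrite eq = refl
  reached-all {suc m} l (suc j) eq rewrite reached-all (l ∘ suc) j eq = ∨-zeroʳ (l zero)

  -- A completion of the disjunction gadget for inputs x, y and output x ∨ y. Vertices 0 and 1 meet
  -- the output; 2 and 3 take the colour that is left over in the two input triples.
  gadget : Bool → Bool → Fin 4 → Fin 3
  gadget false false zero                   = T̂
  gadget false true  zero                   = B̂
  gadget true  y     zero                   = F̂
  gadget false true  (suc zero)             = F̂
  gadget x     y     (suc zero)             = B̂
  gadget false true  (suc (suc zero))       = T̂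
  gadget x     y     (suc (suc zero))       = B̂
  gadget false true  (suc (suc (suc zero))) = B̂
  gadget x     true  (suc (suc (suc zero))) = F̂
  gadget x     false (suc (suc (suc zero))) = T̂

  gadget-1 : ∀ x y → Distinct (tf x) (gadget x y zero) (gadget x y (suc (suc zero)))
  gadget-1 false false = from-yes (distinct? F̂ T̂ B̂)
  gadget-1 false true  = from-yes (distinct? F̂ B̂ T̂)
  gadget-1 true  y     = from-yes (distinct? T̂ F̂ B̂)

  gadget-2 : ∀ x y → Distinct (tf y) (gadget x y (suc zero)) (gadget x y (suc (suc (suc zero))))
  gadget-2 false false = from-yes (distinct? F̂ B̂ T̂)
  gadget-2 false true  = from-yes (distinct? T̂ F̂ B̂)
  gadget-2 true  false = from-yes (distinct? F̂ B̂ T̂)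
  gadget-2 true  true  = from-yes (distinct? T̂ B̂ F̂)

  gadget-3 : ∀ x y → Distinct (gadget x y zero) (gadget x y (suc zero)) (tf (x ∨ y))
  gadget-3 false false = from-yes (distinct? T̂ B̂ F̂)
  gadget-3 false true  = from-yes (distinct? B̂ F̂ T̂)
  gadget-3 true  y     = from-yes (distinct? F̂ B̂ T̂)

  flag-colours : ∀ x b → Distinct (tf (equals x b)) B̂ (if (if x then b else not b) then F̂ else T̂)
  flag-colours true  true  = from-yes (distinct? T̂ B̂ F̂)
  flag-colours true  false = from-yes (distinct? F̂ B̂ T̂)
  flag-colours false true  = from-yes (distinct? F̂ B̂ T̂)
  flag-colours false false = from-yes (distinct? T̂ B̂ F̂)

  bit-colours : ∀ x → Distinct (tf (equals x true)) (tf (equals x false)) B̂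
  bit-colours true  = from-yes (distinct? T̂ F̂ B̂)
  bit-colours false = from-yes (distinct? F̂ T̂ B̂)

  third : ∀ (a b d x : Fin 3) → a ≢ b → b ≢ d → d ≢ a → x ≢ b → x ≢ d → x ≡ a
  third = from-yes (all? λ (a : Fin 3) → all? λ (b : Fin 3) → all? λ (d : Fin 3) → all? λ (x : Fin 3) →
    ¬? (a ≟ b) →-dec (¬? (b ≟ d) →-dec (¬? (d ≟ a) →-dec (¬? (x ≟ b) →-dec (¬? (x ≟ d) →-dec (x ≟ a))))))

  third′ : ∀ {a b d x} → Distinct a b d → x ≢ b → x ≢ d → x ≡ a
  third′ {a} {b} {d} {x} (p , q , r) = third a b d x p q r

  rotated : ∀ {a b d} → Distinct a b d → Distinct b d a
  rotated (p , q , r) = q , r , p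

  module _ (L : LocalConstraints) (G : Torus) where

    open LocalConstraints L
    open Local L
    open Torus G

    module _ (β : Cell → Fin flags → Bool) where

      value : (Cell → Fin bits → Bool) → Cell → Fin width → Bool
      value a c j with source j
      ... | inj₁ i       = β c i
      ... | inj₂ (d , w) = a (shift d c) w

      Satisfies : (Cell → Fin bits → Bool) → Set
      Satisfies a = ∀ c k → ¬ (∀ j → value a c j ≡ bad k j)

      private
        Y = Cell × Occ

        -- Up to the twist, an occurrence consumes the colour of the provider with the same name in
        -- the cell to which its offset points; there this provider belongs to the variable that is
        -- meant.
        plug plug⁻ : Y → Y
        plug (c , o)  = shift (offset o) c , twist (β c) o
        plug⁻ (c , o) = shift⁻ (offset o) c , twist (β c) o

        shift⁻-here : ∀ c → shift⁻ here c ≡ c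
        shift⁻-here c = trans (cong (shift⁻ here) (sym (shift-here c))) (shift⁻-shift here c)

        twist-at : ∀ c c′ o → (offset o ≡ here → c ≡ c′) → twist (β c) (twist (β c′) o) ≡ o
        twist-at c c′ o same with twist-moved o
        ... | inj₁ eq    rewrite same eq = twist-twist (β c′) o
        ... | inj₂ fixed = trans (cong (twist (β c)) (fixed (β c′))) (fixed (β c))

        plug-plug⁻ : ∀ y → plug (plug⁻ y) ≡ y
        plug-plug⁻ (c , o) = cong₂ _,_
          (trans (cong (λ d → shift d (shift⁻ (offset o) c)) (twist-offset (β c) o)) (shift-shift⁻ (offset o) c))
          (twist-at _ c o (λ eq → trans (cong (λ d → shift⁻ d c) eq) (shift⁻-here c)))

        plug⁻-plug : ∀ y → plug⁻ (plug y) ≡ y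
        plug⁻-plug (c , o) = cong₂ _,_
          (trans (cong (λ d → shift⁻ d (shift (offset o) c)) (twist-offset (β c) o)) (shift⁻-shift (offset o) c))
          (twist-at _ c o (λ eq → trans (cong (λ d → shift d c) eq) (shift-here c)))

        turn-laws : ∀ j → turn (turn j) ≡ turn⁻ j × turn (turn⁻ j) ≡ j × turn⁻ (turn j) ≡ j × turn j ≢ j × turn⁻ j ≢ turn j
        turn-laws = from-yes (all? λ j → (turn (turn j) ≟ turn⁻ j) ×-dec (turn (turn⁻ j) ≟ j) ×-dec (turn⁻ (turn j) ≟ j)
                      ×-dec ¬? (turn j ≟ j) ×-dec ¬? (turn⁻ j ≟ turn j))

      wiring : Wiring (Cell × Occ)
      wiring = record
        { rot  = λ (c , (t , j)) → c , (t , turn j)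
        ; rot⁻ = λ (c , (t , j)) → c , (t , turn⁻ j)
        ; θ = plug ; θ⁻ = plug⁻
        ; π₀ = λ (c , o) → c , next o
        ; π₀⁻ = λ (c , o) → c , next⁻ o
        ; rot-rot  = λ (c , (t , j)) → cong (λ j → c , (t , j)) (proj₁ (turn-laws j))
        ; rot-rot⁻ = λ (c , (t , j)) → cong (λ j → c , (t , j)) (proj₁ (proj₂ (turn-laws j)))
        ; rot⁻-rot = λ (c , (t , j)) → cong (λ j → c , (t , j)) (proj₁ (proj₂ (proj₂ (turn-laws j))))
        ; rot≢id   = λ (c , (t , j)) eq → proj₁ (proj₂ (proj₂ (proj₂ (turn-laws j)))) (cong (λ y → proj₂ (proj₂ y)) eq)
        ; rot⁻≢rot = λ (c , (t , j)) eq → proj₂ (proj₂ (proj₂ (proj₂ (turn-laws j)))) (cong (λ y → proj₂ (proj₂ y)) eq)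
        ; θ-θ⁻ = plug-plug⁻ ; θ⁻-θ = plug⁻-plug
        ; π₀-π₀⁻ = λ (c , o) → cong (c ,_) (next-next⁻ o)
        ; π₀⁻-π₀ = λ (c , o) → cong (c ,_) (next⁻-next o)
        }

      shown : (Cell → Var → Fin 3) → Cell → Occ → Fin 3
      shown col c o = col (shift (offset o) c) (var (twist (β c) o))

      Rainbow : (Cell → Var → Fin 3) → Set
      Rainbow col = ∀ c t → Distinct (shown col c (t , T̂)) (shown col c (t , F̂)) (shown col c (t , B̂))

      spread : (Cell → Var → Fin 3) → Cell × Occ → Fin 3
      spread col y = col (proj₁ y) (var (proj₂ y))

      rainbow⇒solution : ∀ col → Rainbow col → Solution wiring (spread col)
      rainbow⇒solution col rainbow = (λ (c , o) → cong (col c) (var-next o)) ,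
        λ { (c , (t , T̂)) → proj₁ (rainbow c t) ; (c , (t , F̂)) → proj₁ (proj₂ (rainbow c t))
          ; (c , (t , B̂)) → proj₂ (proj₂ (rainbow c t)) }

      solution⇒rainbow : ∀ f → Solution wiring f → Rainbow (λ c x → f (c , occurrence x))
      solution⇒rainbow f (same , distinct) c t = pair T̂ F̂ (distinct (c , (t , T̂))) , pair F̂ B̂ (distinct (c , (t , F̂))) ,
                                                 pair B̂ T̂ (distinct (c , (t , B̂)))
        where
        col = λ c x → f (c , occurrence x)
        seen : ∀ c o → col c (var o) ≡ f (c , o)
        -- The ring makes the choice of a representative occurrence irrelevant.
        seen c o = next-constant (λ o → f (c , o)) (λ o → same (c , o)) (occurrence (var o)) o (var-occurrence (var o))
        pair : ∀ i j → f (plug (c , (t , i))) ≢ f (plug (c , (t , j))) → shown col c (t , i) ≢ shown col c (t , j)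
        pair i j ne eq = ne (trans (sym (seen _ _)) (trans eq (seen _ _)))

      module _ (a : Cell → Fin bits → Bool) (satisfies : Satisfies a) where

        private
          truth : Cell → Fin clauses → Fin width → Bool
          truth c k j = equals (value a c j) (not (bad k j))

          col : Cell → Var → Fin 3
          col c (pal i)     = i
          col c (lit w b)   = tf (equals (a c w) b)
          col c (flg i b)   = tf (equals (β c i) b)
          col c (chain k j) = tf (reached (truth c k) j)
          col c (aux k j l) = gadget (reached (truth c k) (inject₁ j)) (truth c k j) l
          col c (slack k)   = B̂

          col-literal : ∀ c k j → col (shift (proj₁ (literal k j)) c) (proj₂ (literal k j)) ≡ tf (truth c k j)
          col-literal c k j with source j
          ... | inj₁ i       rewrite shift-here c = refl
          ... | inj₂ (d , w) = refl

          ends-true : ∀ c k → reached (truth c k) (fromℕ width) ≡ true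
          ends-true c k with ¬∀⟶∃¬ width (λ j → value a c j ≡ bad k j) (λ j → value a c j Boolₚ.≟ bad k j) (satisfies c k)
          ... | j , ne = reached-all (truth c k) j (agree (value a c j) (bad k j) ne)
            where
            agree : ∀ x y → x ≢ y → equals x (not y) ≡ true
            agree true  true  ne = contradiction refl ne
            agree false false ne = contradiction refl ne
            agree true  false ne = refl
            agree false true  ne = refl

          at-here : ∀ c x y z → Distinct (col c x) (col c y) (col c z) →
                    Distinct (col (shift here c) x) (col (shift here c) y) (col (shift here c) z)
          at-here c x y z = subst (λ c → Distinct (col c x) (col c y) (col c z)) (sym (shift-here c))

        satisfies⇒rainbow : Rainbow col
        satisfies⇒rainbow c (palette d i) = from-yes (distinct? T̂ F̂ B̂)
        satisfies⇒rainbow c (negation w) = bit-colours (a (shift here c) w)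
        satisfies⇒rainbow c (flag i b) = at-here c (flg i b) (pal B̂) (pal (if (if β c i then b else not b) then F̂ else T̂)) (flag-colours (β c i) b)
        satisfies⇒rainbow c (link k j T̂) = at-here c (chain k (inject₁ j)) (aux k j zero) (aux k j (suc (suc zero))) (gadget-1 (reached (truth c k) (inject₁ j)) (truth c k j))
        satisfies⇒rainbow c (link k j F̂) =
          subst₂ (λ x c′ → Distinct x (col c′ (aux k j (suc zero))) (col c′ (aux k j (suc (suc (suc zero))))))
            (sym (col-literal c k j)) (sym (shift-here c)) (gadget-2 (reached (truth c k) (inject₁ j)) (truth c k j))
        satisfies⇒rainbow c (link k j B̂) = at-here c (aux k j zero) (aux k j (suc zero)) (chain k (suc j))
          (subst (λ x → Distinct (col c (aux k j zero)) (col c (aux k j (suc zero))) (tf x)) (sym (reached-suc (truth c k) j))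
            (gadget-3 (reached (truth c k) (inject₁ j)) (truth c k j)))
        satisfies⇒rainbow c (begin k) = from-yes (distinct? F̂ T̂ B̂)
        satisfies⇒rainbow c (end k) = at-here c (chain k (fromℕ width)) (pal F̂) (slack k)
          (subst (λ x → Distinct (tf x) F̂ B̂) (sym (ends-true c k)) (from-yes (distinct? T̂ F̂ B̂)))

        satisfies⇒solution : Σ[ f ∈ (Cell × Occ → Fin 3) ] Solution wiring f
        satisfies⇒solution = spread col , rainbow⇒solution col satisfies⇒rainbow

      module _ (col : Cell → Var → Fin 3) (rainbow : Rainbow col) where

        private
          pc : Cell → Fin 3 → Fin 3
          pc c i = col c (pal i)

          pc-distinct : ∀ c → Distinct (pc c T̂) (pc c F̂) (pc c B̂)
          pc-distinct c = subst (λ c → Distinct (pc c T̂) (pc c F̂) (pc c B̂)) (shift-here c) (rainbow c (palette here T̂))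

          pc-shift : ∀ d c i → pc (shift d c) i ≡ pc c i
          pc-shift d c T̂ = third′ (pc-distinct c) (subst (λ e → pc (shift d c) T̂ ≢ pc e F̂) (shift-here c) p)
                             (λ eq → r (trans (cong (λ e → pc e B̂) (shift-here c)) (sym eq)))
            where
            p = proj₁ (rainbow c (palette d T̂))
            r = proj₂ (proj₂ (rainbow c (palette d T̂)))
          pc-shift d c F̂ = third′ (rotated (pc-distinct c)) (subst (λ e → pc (shift d c) F̂ ≢ pc e B̂) (shift-here c) p)
                             (λ eq → r (trans (cong (λ e → pc e T̂) (shift-here c)) (sym eq)))
            where
            p = proj₁ (proj₂ (rainbow c (palette d F̂)))
            r = proj₁ (rainbow c (palette d F̂))
          pc-shift d c B̂ = third′ (rotated (rotated (pc-distinct c))) (subst (λ e → pc (shift d c) B̂ ≢ pc e T̂) (shift-here c) p)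
                             (λ eq → r (trans (cong (λ e → pc e F̂) (shift-here c)) (sym eq)))
            where
            p = proj₂ (proj₂ (rainbow c (palette d B̂)))
            r = proj₁ (proj₂ (rainbow c (palette d B̂)))

          at-here : ∀ {c a b d} → Distinct (col (shift here c) a) (col (shift here c) b) (col (shift here c) d) →
                    Distinct (col c a) (col c b) (col c d)
          at-here {c} {a} {b} {d} = subst (λ c → Distinct (col c a) (col c b) (col c d)) (shift-here c)

          pick : Cell → Bool → Fin 3
          pick c b = pc c (tf b)

        -- Colours have a meaning only relative to the palette, so truth is read off by comparison
        -- with the colour of `pal T̂` in the same cell.
        assignment : Cell → Fin bits → Bool
        assignment c w = does (col c (lit w true) ≟ pc c T̂)

        private
          lit-colour : ∀ c w b → col c (lit w b) ≡ pick c (equals (assignment c w) b)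
          lit-colour c w b with at-here (rainbow c (negation w)) | col c (lit w true) ≟ pc c T̂
          lit-colour c w true  | p , q , r | yes eq = eq
          lit-colour c w true  | p , q , r | no ne  = third′ (rotated (pc-distinct c)) (λ eq → r (sym eq)) ne
          lit-colour c w false | p , q , r | yes eq = third′ (rotated (pc-distinct c)) q (λ e → p (trans eq (sym e)))
          lit-colour c w false | p , q , r | no ne  = third′ (pc-distinct c)
            (λ e → p (trans (third′ (rotated (pc-distinct c)) (λ eq → r (sym eq)) ne) (sym e))) q

          flg-colour : ∀ c i b → col c (flg i b) ≡ pick c (equals (β c i) b)
          flg-colour c i b = flagged (β c i) b (at-here (rainbow c (flag i b)))
            where
            flagged : ∀ x b {y} → Distinct y (pc c B̂) (pc c (if (if x then b else not b) then F̂ else T̂)) → y ≡ pick c (equals x b)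
            flagged true  true  (p , q , r) = third′ (pc-distinct c) (λ e → r (sym e)) p
            flagged true  false (p , q , r) = third′ (rotated (pc-distinct c)) p (λ e → r (sym e))
            flagged false true  (p , q , r) = third′ (rotated (pc-distinct c)) p (λ e → r (sym e))
            flagged false false (p , q , r) = third′ (pc-distinct c) (λ e → r (sym e)) p

          literal-false : ∀ c k j → value assignment c j ≡ bad k j →
                          col (shift (proj₁ (literal k j)) c) (proj₂ (literal k j)) ≡ pc c F̂
          literal-false c k j eq with source j
          ... | inj₁ i       = trans (cong (λ c → col c (flg i (not (bad k j)))) (shift-here c))
                                 (trans (flg-colour c i (not (bad k j))) (cong (pick c) (differ eq)))
            where
            differ : ∀ {x y} → x ≡ y → equals x (not y) ≡ false
            differ {true}  refl = refl
            differ {false} refl = refl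
          ... | inj₂ (d , w) = trans (lit-colour (shift d c) w (not (bad k j)))
                                 (trans (cong (pick (shift d c)) (differ eq)) (pc-shift d c F̂))
            where
            differ : ∀ {x y} → x ≡ y → equals x (not y) ≡ false
            differ {true}  refl = refl
            differ {false} refl = refl

        -- If all literals of a clause were false, the colour F would pass along the whole chain and
        -- reach its end, where the `end` triple excludes it.
        rainbow⇒satisfies : Satisfies assignment
        rainbow⇒satisfies c k all-bad = proj₁ (at-here (rainbow c (end k))) (chain-false (fromℕ width))
          where
          chain-false : ∀ j → col c (chain k j) ≡ pc c F̂
          chain-false = <-weakInduction _
            (third′ (rotated (pc-distinct c)) (λ e → proj₂ (proj₂ (at-here (rainbow c (begin k)))) (sym e)) (proj₁ (at-here (rainbow c (begin k)))))
            (λ j ih → let p₁ , _ , _ = at-here (rainbow c (link k j T̂))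
                          p₂ , _ , _ = rainbow c (link k j F̂)
                          p₃ , q₃ , r₃ = at-here (rainbow c (link k j B̂))
                          ne = subst (λ e → pc c F̂ ≢ col e (aux k j (suc zero))) (shift-here c)
                                 (λ e → p₂ (trans (literal-false c k j (all-bad j)) e)) in
              -- Vertices 0 and 1 of the gadget differ from each other and, both inputs being F,
              -- from F; the output avoids both of them.
              third′ ((λ e → p₁ (trans ih e)) , p₃ , (λ e → ne (sym e))) r₃ (λ e → q₃ (sym e)))

-- Computation tableaux in coordinates relative to the heads.

module Tableau where

  open import Data.Bool.Base using (Bool; true; false; if_then_else_)
  import Data.Bool.Properties as Boolₚ
  open import Data.Fin.Base using (Fin; zero; suc)
  open import Data.List.Base as List using (List; []; _∷_; length)
  open import Data.Maybe.Base using (just; nothing; fromMaybe)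
  open import Data.Nat.Base using (ℕ; zero; suc; _+_; _≤_; _<_; z≤n; s≤s)
  open import Data.Nat.Properties
  open import Data.Product.Base using (Σ-syntax; _×_; _,_; proj₁; proj₂)
  open import Data.Sum.Base using (inj₁; inj₂)
  open import Data.Unit.Base using (tt)
  open import Data.Vec.Base as Vec using (Vec; []; _∷_; lookup; tabulate)
  open import Data.Vec.Properties using (lookup-map; lookup-zipWith; tabulate-cong; tabulate∘lookup)
  open import Function.Base using (_∘_)
  open import Relation.Binary.PropositionalEquality
  open import Relation.Nullary.Decidable using (Dec; yes; no; does; _×-dec_; _→-dec_)
  open import Relation.Nullary.Negation using (¬_; contradiction)
  open import Defs
  open Finiteness
  open Programs using (heads; perform; perform-keep; keep)
  open Registers using (nth; word)
  open Terms using (_‼_)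

  does-true : ∀ {P : Set} (d : Dec P) → does d ≡ true → P
  does-true (yes p) _ = p

  does-false : ∀ {P : Set} (d : Dec P) → does d ≡ false → ¬ P
  does-false (no ¬p) _ = ¬p

  true-does : ∀ {P : Set} (d : Dec P) → P → does d ≡ true
  true-does (yes _) p = refl
  true-does (no ¬p) p = contradiction p ¬p

  false-does : ∀ {P : Set} (d : Dec P) → ¬ P → does d ≡ false
  false-does (yes p) ¬p = contradiction p ¬p
  false-does (no _)  ¬p = refl

  finite-Symbol : ∀ g → Finite (Symbol g)
  finite-Symbol g = finite-iso
    (λ { blank → inj₁ tt ; (bit b) → inj₂ (inj₁ b) ; (aux i) → inj₂ (inj₂ i) })
    (λ { (inj₁ _) → blank ; (inj₂ (inj₁ b)) → bit b ; (inj₂ (inj₂ i)) → aux i })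
    (λ { blank → refl ; (bit b) → refl ; (aux i) → refl })
    (λ { (inj₁ _) → refl ; (inj₂ (inj₁ b)) → refl ; (inj₂ (inj₂ i)) → refl })
    (finite-⊎ finite-⊤ (finite-⊎ finite-Bool (finite-Fin g)))

  -- The two halves of a tape, numbered from the head; the scanned cell is
  -- number 0 of the right half.
  rightHalf leftHalf : ∀ {g} → ℕ → Tape g → Symbol g
  rightHalf p t = nth (scanned t ∷ after t) p
  leftHalf p t  = nth (before t) p

  -- A move of the head shifts the two halves by one column in opposite directions. Exceptions occur
  -- only near the head: the written symbol, and the symbol that passes from one half to the other
  -- in column 0.
  newRight newLeft : ∀ {g} → (at-0 at-1 : Bool) → Symbol g × Move → (Rl Rh Rr Ll Lh Lr : Symbol g) → Symbol g
  newRight at-0 at-1 (s , stay)  Rl Rh Rr Ll Lh Lr = if at-0 then s else Rh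
  newRight at-0 at-1 (s , right) Rl Rh Rr Ll Lh Lr = Rr
  newRight at-0 at-1 (s , left)  Rl Rh Rr Ll Lh Lr = if at-0 then Lh else if at-1 then s else Rl
  newLeft at-0 at-1 (s , stay)   Rl Rh Rr Ll Lh Lr = Lh
  newLeft at-0 at-1 (s , right)  Rl Rh Rr Ll Lh Lr = if at-0 then s else Ll
  newLeft at-0 at-1 (s , left)   Rl Rh Rr Ll Lh Lr = Lr

  newRight-correct : ∀ {g} (t : Tape g) a p {Rl Ll} → (∀ p′ → p ≡ suc p′ → Rl ≡ rightHalf p′ t × Ll ≡ leftHalf p′ t) →
    newRight (does (p ≟ 0)) (does (p ≟ 1)) a Rl (rightHalf p t) (rightHalf (suc p) t) Ll (leftHalf p t) (leftHalf (suc p) t)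
    ≡ rightHalf p (act a t)
  newRight-correct t (s , stay) zero    eq = refl
  newRight-correct t (s , stay) (suc p) eq = refl
  newRight-correct ⟨ ls , h , [] ⟩     (s , right) zero    eq = refl
  newRight-correct ⟨ ls , h , [] ⟩     (s , right) (suc p) eq = refl
  newRight-correct ⟨ ls , h , r ∷ rs ⟩ (s , right) zero    eq = refl
  newRight-correct ⟨ ls , h , r ∷ rs ⟩ (s , right) (suc p) eq = refl
  newRight-correct ⟨ [] , h , rs ⟩     (s , left) zero          eq = refl
  newRight-correct ⟨ [] , h , rs ⟩     (s , left) (suc zero)    eq = refl
  newRight-correct ⟨ [] , h , rs ⟩     (s , left) (suc (suc p)) eq = proj₁ (eq (suc p) refl)
  newRight-correct ⟨ l ∷ ls , h , rs ⟩ (s , left) zero          eq = refl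
  newRight-correct ⟨ l ∷ ls , h , rs ⟩ (s , left) (suc zero)    eq = refl
  newRight-correct ⟨ l ∷ ls , h , rs ⟩ (s , left) (suc (suc p)) eq = proj₁ (eq (suc p) refl)

  newLeft-correct : ∀ {g} (t : Tape g) a p {Rl Ll} → (∀ p′ → p ≡ suc p′ → Rl ≡ rightHalf p′ t × Ll ≡ leftHalf p′ t) →
    newLeft (does (p ≟ 0)) (does (p ≟ 1)) a Rl (rightHalf p t) (rightHalf (suc p) t) Ll (leftHalf p t) (leftHalf (suc p) t)
    ≡ leftHalf p (act a t)
  newLeft-correct t (s , stay) p eq = refl
  newLeft-correct ⟨ ls , h , [] ⟩     (s , right) zero    eq = refl
  newLeft-correct ⟨ ls , h , [] ⟩     (s , right) (suc p) eq = proj₂ (eq p refl)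
  newLeft-correct ⟨ ls , h , r ∷ rs ⟩ (s , right) zero    eq = refl
  newLeft-correct ⟨ ls , h , r ∷ rs ⟩ (s , right) (suc p) eq = proj₂ (eq p refl)
  newLeft-correct ⟨ [] , h , rs ⟩     (s , left) p eq = refl
  newLeft-correct ⟨ l ∷ ls , h , rs ⟩ (s , left) p eq = refl

  rightHalves leftHalves : ∀ {g n} → ℕ → Vec (Tape g) n → Vec (Symbol g) n
  rightHalves p = Vec.map (rightHalf p)
  leftHalves p  = Vec.map (leftHalf p)

  module _ {k : ℕ} (M : TM (2 + k)) where

    g : ℕ
    g = auxiliary M

    Sym : Set
    Sym = Symbol g

    Syms : Set
    Syms = Vec Sym (2 + k)

    delta : Fin (states M) → Syms → Fin (states M) × Vec (Sym × Move) (2 + k)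
    delta q ss = fromMaybe (q , Vec.map keep ss) (δ M q ss)

    -- The step function, with halting configurations repeated forever.
    advance : Config M → Config M
    advance (q , ts) = proj₁ (delta q (heads ts)) , perform (proj₂ (delta q (heads ts))) ts

    after-steps : ℕ → Config M → Config M
    after-steps zero    c = c
    after-steps (suc t) c = advance (after-steps t c)

    private
      after-steps-advance : ∀ t c → after-steps t (advance c) ≡ after-steps (suc t) c
      after-steps-advance zero    c = refl
      after-steps-advance (suc t) c = cong advance (after-steps-advance t c)

      advance-just : ∀ {c c′} → step M c ≡ just c′ → advance c ≡ c′
      advance-just {q , ts} eq with δ M q (heads ts)
      advance-just {q , ts} refl | just _ = refl

      advance-nothing : ∀ {c} → step M c ≡ nothing → advance c ≡ c
      advance-nothing {q , ts} eq with δ M q (heads ts)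
      advance-nothing {q , ts} eq | nothing = cong (q ,_) (perform-keep ts)

    after-steps-halts : ∀ {t c d} → HaltsWithin M t c d → after-steps t c ≡ d
    after-steps-halts {t} {c} (halt eq) = stable t
      where
      stable : ∀ t → after-steps t c ≡ c
      stable zero    = refl
      stable (suc t) = trans (cong advance (stable t)) (advance-nothing eq)
    after-steps-halts {suc t} {c} (next eq r) =
      trans (sym (after-steps-advance t c)) (trans (cong (after-steps t) (advance-just eq)) (after-steps-halts r))

    -- The state and the scanned symbols are repeated in every column of a row, so that the
    -- transition can be checked locally; the halves are those of all tapes at this column.
    record Tile : Set where
      constructor tile
      field
        state  : Fin (states M)
        seen   : Syms
        rights : Syms
        lefts  : Syms

    open Tile

    finite-Syms : Finite Syms
    finite-Syms = finite-Vec (finite-Symbol g) (2 + k)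

    finite-Tile : Finite Tile
    finite-Tile = finite-iso
      (λ { (tile q s r l) → q , (s , (r , l)) }) (λ { (q , (s , (r , l))) → tile q s r l })
      (λ { (tile q s r l) → refl }) (λ { (q , (s , (r , l))) → refl })
      (finite-× (finite-Fin (states M)) (finite-× finite-Syms (finite-× finite-Syms finite-Syms)))

    certSymbol : Sym → Bool
    certSymbol (aux _) = false
    certSymbol _       = true

    cert : Tile → Sym
    cert τ = lookup (rights τ) (suc zero)

    -- Five flags locate the borders of the tableau and the columns next to the head, two transmit
    -- the input word, and `allowed` marks the columns open to the certificate.
    Flags : Set
    Flags = Vec Bool 8

    pattern flags-of row-0 row-last col-0 col-1 col-last is-bit is-one allowed =
      row-0 ∷ row-last ∷ col-0 ∷ col-1 ∷ col-last ∷ is-bit ∷ is-one ∷ allowed ∷ []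

    spread : (∀ (at-0 at-1 : Bool) → Sym × Move → (Rl Rh Rr Ll Lh Lr : Sym) → Sym) → Bool → Bool →
             Vec (Sym × Move) (2 + k) → Tile → Tile → Tile → Syms
    spread new at-0 at-1 as l h r = tabulate (λ i → new at-0 at-1 (lookup as i)
      (lookup (rights l) i) (lookup (rights h) i) (lookup (rights r) i)
      (lookup (lefts l) i) (lookup (lefts h) i) (lookup (lefts r) i))

    -- `Control` takes the scanned symbols from the right halves in column 0 and passes them along
    -- the row. `Initial` leaves the second tape free, but without gaps. `Step` is waived in the
    -- last row and column, where the torus closes up and a neighbour is not the next cell of the
    -- tableau.
    Control Initial Step Final Ok : Flags → (l h r d : Tile) → Set
    Control (flags-of row-0 row-last col-0 col-1 col-last is-bit is-one allowed) l h r d =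
      (col-0 ≡ true → seen h ≡ rights h) × (col-0 ≡ false → state h ≡ state l × seen h ≡ seen l)
    Initial (flags-of row-0 row-last col-0 col-1 col-last is-bit is-one allowed) l h r d = row-0 ≡ true →
      state h ≡ start M × lefts h ≡ Vec.replicate _ blank ×
      rights h ≡ (if is-bit then bit is-one else blank) ∷ cert h ∷ Vec.replicate k blank ×
      certSymbol (cert h) ≡ true × (allowed ≡ false → cert h ≡ blank) ×
      (col-0 ≡ false → cert l ≡ blank → cert h ≡ blank)
    Step (flags-of row-0 row-last col-0 col-1 col-last is-bit is-one allowed) l h r d = row-last ≡ false → col-last ≡ false →
      state d ≡ proj₁ (delta (state h) (seen h)) ×
      rights d ≡ spread newRight col-0 col-1 (proj₂ (delta (state h) (seen h))) l h r ×
      lefts d ≡ spread newLeft col-0 col-1 (proj₂ (delta (state h) (seen h))) l h r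
    Final (flags-of row-0 row-last col-0 col-1 col-last is-bit is-one allowed) l h r d =
      row-last ≡ true → accepting M (state h) ≡ true
    Ok f l h r d = Control f l h r d × Initial f l h r d × Step f l h r d × Final f l h r d

    Ok? : ∀ f l h r d → Dec (Ok f l h r d)
    Ok? (flags-of row-0 row-last col-0 col-1 col-last is-bit is-one allowed) l h r d =
      ((col-0 Boolₚ.≟ true →-dec (seen h ≟ˢ rights h)) ×-dec
       (col-0 Boolₚ.≟ false →-dec ((state h ≟ᶠ state l) ×-dec (seen h ≟ˢ seen l)))) ×-dec
      (row-0 Boolₚ.≟ true →-dec
        ((state h ≟ᶠ start M) ×-dec (lefts h ≟ˢ _) ×-dec (rights h ≟ˢ _) ×-dec (certSymbol (cert h) Boolₚ.≟ true) ×-dec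
         (allowed Boolₚ.≟ false →-dec (cert h ≟ᵇ blank)) ×-dec
         (col-0 Boolₚ.≟ false →-dec ((cert l ≟ᵇ blank) →-dec (cert h ≟ᵇ blank))))) ×-dec
      (row-last Boolₚ.≟ false →-dec (col-last Boolₚ.≟ false →-dec
        ((state d ≟ᶠ _) ×-dec (rights d ≟ˢ _) ×-dec (lefts d ≟ˢ _)))) ×-dec
      (row-last Boolₚ.≟ true →-dec (accepting M (state h) Boolₚ.≟ true))
      where
      _≟ˢ_ = Finite.equal? finite-Syms
      _≟ᵇ_ = Finite.equal? (finite-Symbol g)
      _≟ᶠ_ = Finite.equal? (finite-Fin (states M))

    spread-correct : ∀ (new : ∀ (at-0 at-1 : Bool) → Sym × Move → (Rl Rh Rr Ll Lh Lr : Sym) → Sym) (half : ℕ → Tape g → Sym) →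
      (∀ t a p {Rl Ll} → (∀ p′ → p ≡ suc p′ → Rl ≡ rightHalf p′ t × Ll ≡ leftHalf p′ t) →
        new (does (p ≟ 0)) (does (p ≟ 1)) a Rl (rightHalf p t) (rightHalf (suc p) t) Ll (leftHalf p t) (leftHalf (suc p) t) ≡ half p (act a t)) →
      ∀ as ts p l h r →
      (∀ p′ → p ≡ suc p′ → rights l ≡ rightHalves p′ ts × lefts l ≡ leftHalves p′ ts) →
      rights h ≡ rightHalves p ts × lefts h ≡ leftHalves p ts →
      rights r ≡ rightHalves (suc p) ts × lefts r ≡ leftHalves (suc p) ts →
      spread new (does (p ≟ 0)) (does (p ≟ 1)) as l h r ≡ Vec.map (half p) (perform as ts)
    spread-correct new half correct as ts p l h r left′ (Rh , Lh) (Rr , Lr) =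
      trans (tabulate-cong at) (tabulate∘lookup (Vec.map (half p) (perform as ts)))
      where
      args : ∀ {a b x Rl Rh Rr Ll Lh Lr Rh′ Rr′ Lh′ Lr′} → Rh ≡ Rh′ → Rr ≡ Rr′ → Lh ≡ Lh′ → Lr ≡ Lr′ →
             new a b x Rl Rh Rr Ll Lh Lr ≡ new a b x Rl Rh′ Rr′ Ll Lh′ Lr′
      args refl refl refl refl = refl
      entry : ∀ {v : Syms} {f : Tape g → Sym} → v ≡ Vec.map f ts → ∀ i → lookup v i ≡ f (lookup ts i)
      entry {f = f} eq i = trans (cong (λ v → lookup v i) eq) (lookup-map i f ts)
      at : ∀ i → new (does (p ≟ 0)) (does (p ≟ 1)) (lookup as i)
          (lookup (rights l) i) (lookup (rights h) i) (lookup (rights r) i)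
          (lookup (lefts l) i) (lookup (lefts h) i) (lookup (lefts r) i) ≡ lookup (Vec.map (half p) (perform as ts)) i
      at i = trans (args (entry Rh i) (entry Rr i) (entry Lh i) (entry Lr i))
        (trans (correct (lookup ts i) (lookup as i) p
                  (λ p′ eq → entry (proj₁ (left′ p′ eq)) i , entry (proj₂ (left′ p′ eq)) i))
               (sym (trans (lookup-map i (half p) (perform as ts)) (cong (half p) (lookup-zipWith act i as ts)))))

    private
      word-‼ : ∀ w p → word {g} w p ≡ (if does (p <? length w) then bit (w ‼ p) else blank)
      word-‼ []      p       = refl
      word-‼ (b ∷ w) zero    = refl
      word-‼ (b ∷ w) (suc p) = word-‼ w p

      rightHalf-input : ∀ p w → rightHalf {g} p (inputTape w) ≡ word w p
      rightHalf-input zero    []      = refl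
      rightHalf-input (suc p) []      = refl
      rightHalf-input p       (b ∷ w) = refl

      leftHalf-input : ∀ p w → leftHalf {g} p (inputTape w) ≡ blank
      leftHalf-input p []      = refl
      leftHalf-input p (b ∷ w) = refl

    inputs : List Bool → List Bool → Vec (Tape g) (2 + k)
    inputs x y = Vec.map inputTape (x ∷ y ∷ Vec.replicate k [])

    private
      rightHalves-inputs : ∀ p x y → rightHalves p (inputs x y) ≡ word x p ∷ word y p ∷ Vec.replicate k blank
      rightHalves-inputs p x y = cong₂ _∷_ (rightHalf-input p x) (cong₂ _∷_ (rightHalf-input p y) (blanks k))
        where
        blanks : ∀ k → rightHalves p (Vec.map inputTape (Vec.replicate k [])) ≡ Vec.replicate k blank
        blanks zero    = refl
        blanks (suc k) = cong₂ _∷_ (rightHalf-input p []) (blanks k)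

      leftHalves-inputs : ∀ p x y → leftHalves p (inputs x y) ≡ Vec.replicate (2 + k) blank
      leftHalves-inputs p x y = cong₂ _∷_ (leftHalf-input p x) (cong₂ _∷_ (leftHalf-input p y) (blanks k))
        where
        blanks : ∀ k → leftHalves p (Vec.map inputTape (Vec.replicate k [])) ≡ Vec.replicate k blank
        blanks zero    = refl
        blanks (suc k) = cong₂ _∷_ (leftHalf-input p []) (blanks k)

      readBits : (ℕ → Sym) → ℕ → List Bool
      readBits f zero    = []
      readBits f (suc n) with f 0
      ... | bit b = b ∷ readBits (f ∘ suc) n
      ... | _     = []

      -- Only blanks follow a blank, so nothing is lost by cutting at the first one.
      readBits-word : ∀ f n → (∀ p → p < n → certSymbol (f p) ≡ true) → (∀ p → suc p < n → f p ≡ blank → f (suc p) ≡ blank) →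
                      ∀ p → p < n → f p ≡ word (readBits f n) p
      readBits-word f (suc n) cert blanks p p<n with f 0 in eq
      readBits-word f (suc n) cert blanks zero    p<n | bit b = eq
      readBits-word f (suc n) cert blanks (suc p) p<n | bit b =
        readBits-word (f ∘ suc) n (λ p h → cert (suc p) (s≤s h)) (λ p h → blanks (suc p) (s≤s h)) p (≤-pred p<n)
      readBits-word f (suc n) cert blanks p p<n | blank = all-blank p p<n
        where
        all-blank : ∀ p → p < suc n → f p ≡ blank
        all-blank zero    _ = eq
        all-blank (suc p) h = blanks p h (all-blank p (<⇒≤ h))
      readBits-word f (suc n) cert blanks p p<n | aux i with () ← trans (sym (cert 0 (s≤s z≤n))) (cong certSymbol eq)

      readBits-length : ∀ f n c → (∀ p → p < n → c ≤ p → f p ≡ blank) → length (readBits f n) ≤ c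
      readBits-length f zero    c       h = z≤n
      readBits-length f (suc n) c       h with f 0 in eq
      readBits-length f (suc n) zero    h | bit b with () ← trans (sym eq) (h 0 (s≤s z≤n) z≤n)
      readBits-length f (suc n) (suc c) h | bit b = s≤s (readBits-length (f ∘ suc) n c (λ p l m → h (suc p) (s≤s l) (s≤s m)))
      readBits-length f (suc n) c       h | blank = z≤n
      readBits-length f (suc n) c       h | aux _ = z≤n

    -- Rows are times 0 .. T, columns are positions 0 .. W relative to the head.
    module Grid (x : List Bool) (T C : ℕ) where

      -- Each step makes one more column at the right border unreliable. T columns absorb this loss
      -- for T steps, and C leave room for the certificate.
      W : ℕ
      W = T + C

      flagsAt : ℕ → ℕ → Flags
      flagsAt t p = flags-of (does (t ≟ 0)) (does (t ≟ T)) (does (p ≟ 0)) (does (p ≟ 1)) (does (p ≟ W))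
                             (does (p <? length x)) (x ‼ p) (does (p <? C))

      -- Nothing is said about neighbours outside the tableau, which keeps the argument independent
      -- of the way in which the borders are glued.
      Neighbours : (ℕ → ℕ → Tile) → ℕ → ℕ → (l r d : Tile) → Set
      Neighbours G t p l r d = (∀ p′ → p ≡ suc p′ → l ≡ G t p′) × (p < W → r ≡ G t (suc p)) × (t < T → d ≡ G (suc t) p)

      configAt : List Bool → ℕ → Config M
      configAt y t = after-steps t (initial M (x ∷ y ∷ Vec.replicate k []))

      -- A single look at time T is enough, because halting configurations are repeated until then.
      Accepts : List Bool → Set
      Accepts y = accepting M (proj₁ (configAt y T)) ≡ true

      module _ (y : List Bool) (y≤C : length y ≤ C) (accepts : Accepts y) where

        contents : ℕ → ℕ → Tile
        contents t p = tile (proj₁ (configAt y t)) (heads (proj₂ (configAt y t)))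
                            (rightHalves p (proj₂ (configAt y t))) (leftHalves p (proj₂ (configAt y t)))

        contents-Ok : ∀ t p → t ≤ T → p ≤ W → ∀ l r d → Neighbours contents t p l r d → Ok (flagsAt t p) l (contents t p) r d
        contents-Ok t p t≤T p≤W l r d (eql , eqr , eqd) = control p eql , first t eql , later , final
          where
          q  = proj₁ (configAt y t)
          ts = proj₂ (configAt y t)
          control : ∀ p → (∀ p′ → p ≡ suc p′ → l ≡ contents t p′) → Control (flagsAt t p) l (contents t p) r d
          control zero    eql = (λ _ → refl) , (λ ())
          control (suc p) eql = (λ ()) , (λ _ → cong state (sym (eql p refl)) , cong seen (sym (eql p refl)))
          first : ∀ t → (∀ p′ → p ≡ suc p′ → l ≡ contents t p′) → Initial (flagsAt t p) l (contents t p) r d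
          first zero eql _ = refl , leftHalves-inputs p x y ,
            trans (rightHalves-inputs p x y) (cong₂ (λ a b → a ∷ b ∷ Vec.replicate k blank) (word-‼ x p) (sym cert≡)) ,
            trans (cong certSymbol cert≡) (word-cert y p) ,
            (λ eq → trans cert≡ (word-beyond y p (≤-trans y≤C (≮⇒≥ (does-false (p <? C) eq))))) ,
            (λ eq → previous p eql eq)
            where
            cert≡ : cert (contents 0 p) ≡ word y p
            cert≡ = cong (λ v → lookup v (suc zero)) (rightHalves-inputs p x y)
            word-cert : ∀ w p → certSymbol (word w p) ≡ true
            word-cert []      p       = refl
            word-cert (b ∷ w) zero    = refl
            word-cert (b ∷ w) (suc p) = word-cert w p
            word-beyond : ∀ w p → length w ≤ p → word {g} w p ≡ blank
            word-beyond []      p       h       = refl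
            word-beyond (b ∷ w) (suc p) (s≤s h) = word-beyond w p h
            word-blank : ∀ w p → word {g} w p ≡ blank → word {g} w (suc p) ≡ blank
            word-blank []          p       h = refl
            word-blank (b ∷ [])    (suc p) h = refl
            word-blank (b ∷ c ∷ w) (suc p) h = word-blank (c ∷ w) p h
            previous : ∀ p → (∀ p′ → p ≡ suc p′ → l ≡ contents 0 p′) → does (p ≟ 0) ≡ false →
                       cert l ≡ blank → cert (contents 0 p) ≡ blank
            previous (suc p) eql _ h = trans (cong (λ v → lookup v (suc zero)) (rightHalves-inputs (suc p) x y))
              (word-blank y p (trans (sym (cong (λ v → lookup v (suc zero)) (rightHalves-inputs p x y))) (trans (cong cert (sym (eql p refl))) h)))
          first (suc t) eql ()
          later : Step (flagsAt t p) l (contents t p) r d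
          later nT nW = cong state d≡ , trans (cong rights d≡) (sym (spread-correct newRight rightHalf newRight-correct as ts p l (contents t p) r left′ (refl , refl) right′)) ,
                                        trans (cong lefts d≡) (sym (spread-correct newLeft leftHalf newLeft-correct as ts p l (contents t p) r left′ (refl , refl) right′))
            where
            as = proj₂ (delta q (heads ts))
            d≡ : d ≡ contents (suc t) p
            d≡ = eqd (≤∧≢⇒< t≤T (does-false (t ≟ T) nT))
            r≡ : r ≡ contents t (suc p)
            r≡ = eqr (≤∧≢⇒< p≤W (does-false (p ≟ W) nW))
            left′ : ∀ p′ → p ≡ suc p′ → rights l ≡ rightHalves p′ ts × lefts l ≡ leftHalves p′ ts
            left′ p′ eq = cong rights (eql p′ eq) , cong lefts (eql p′ eq)
            right′ = cong rights r≡ , cong lefts r≡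
          final : Final (flagsAt t p) l (contents t p) r d
          final eq rewrite does-true (t ≟ T) eq = accepts

      module _ (G : ℕ → ℕ → Tile)
               (tiling : ∀ t p → t ≤ T → p ≤ W → Σ[ l ∈ Tile ] Σ[ r ∈ Tile ] Σ[ d ∈ Tile ]
                          Neighbours G t p l r d × Ok (flagsAt t p) l (G t p) r d) where

        private
          certificate : List Bool
          certificate = readBits (λ p → cert (G 0 p)) (suc W)

          initially : ∀ p → p ≤ W → Σ[ l ∈ Tile ] (∀ p′ → p ≡ suc p′ → l ≡ G 0 p′) ×
            state (G 0 p) ≡ start M × lefts (G 0 p) ≡ Vec.replicate _ blank ×
            rights (G 0 p) ≡ (if does (p <? length x) then bit (x ‼ p) else blank) ∷ cert (G 0 p) ∷ Vec.replicate k blank ×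
            certSymbol (cert (G 0 p)) ≡ true × (does (p <? C) ≡ false → cert (G 0 p) ≡ blank) ×
            (does (p ≟ 0) ≡ false → cert l ≡ blank → cert (G 0 p) ≡ blank)
          initially p p≤W with tiling 0 p z≤n p≤W
          ... | l , r , d , (eql , _) , (_ , first , _) = l , eql , first refl

          cert-word : ∀ p → p < suc W → cert (G 0 p) ≡ word certificate p
          cert-word = readBits-word _ (suc W)
            (λ p h → let _ , _ , _ , _ , _ , c , _ = initially p (≤-pred h) in c)
            (λ p h eq → let l , eql , _ , _ , _ , _ , _ , b = initially (suc p) (≤-pred h) in b refl (trans (cong cert (eql p refl)) eq))

        certificate-length : length certificate ≤ C
        certificate-length = readBits-length _ (suc W) C
          (λ p h C≤p → let _ , _ , _ , _ , _ , _ , a , _ = initially p (≤-pred h) in a (false-does (p <? C) (≤⇒≯ C≤p)))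

        private
          conf : ℕ → Config M
          conf = configAt certificate

          -- A tile is determined by the tiles of the preceding row in the
          -- adjacent columns, so row t is correct in columns p ≤ W - t.
          Correct : ℕ → Set
          Correct t = state (G t 0) ≡ proj₁ (conf t) ×
            (∀ p → p + t ≤ W → rights (G t p) ≡ rightHalves p (proj₂ (conf t)) × lefts (G t p) ≡ leftHalves p (proj₂ (conf t)))

          -- By induction along the row; it guarantees that all columns apply the same transition.
          control : ∀ t p → t ≤ T → p ≤ W → state (G t p) ≡ state (G t 0) × seen (G t p) ≡ rights (G t 0)
          control t zero t≤T p≤W with tiling t 0 t≤T p≤W
          ... | _ , _ , _ , _ , ((c , _) , _) = refl , c refl
          control t (suc p) t≤T p≤W with tiling t (suc p) t≤T p≤W | control t p t≤T (<⇒≤ p≤W)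
          ... | l , _ , _ , (eql , _) , ((_ , c) , _) | q , s =
            trans (proj₁ (c refl)) (trans (cong state (eql p refl)) q) , trans (proj₂ (c refl)) (trans (cong seen (eql p refl)) s)

          correct-0 : Correct 0
          correct-0 = (let _ , _ , q , _ = initially 0 z≤n in q) , λ p h → row p (subst (_≤ W) (+-identityʳ p) h)
            where
            row : ∀ p → p ≤ W → rights (G 0 p) ≡ rightHalves p (inputs x certificate) × lefts (G 0 p) ≡ leftHalves p (inputs x certificate)
            row p p≤W with initially p p≤W
            ... | _ , _ , _ , ls , rs , _ =
              trans rs (trans (cong₂ (λ a b → a ∷ b ∷ Vec.replicate k blank) (sym (word-‼ x p)) (cert-word p (s≤s p≤W)))
                              (sym (rightHalves-inputs p x certificate))) ,
              trans ls (sym (leftHalves-inputs p x certificate))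

          correct-suc : ∀ t → t < T → Correct t → Correct (suc t)
          correct-suc t t<T (q≡ , halves) = advanced 0 (≤-trans t<T (m≤m+n T C)) .proj₁ , λ p h → advanced p h .proj₂
            where
            q  = proj₁ (conf t)
            ts = proj₂ (conf t)
            as = proj₂ (delta q (heads ts))
            t≤W : t ≤ W
            t≤W = ≤-trans (<⇒≤ t<T) (m≤m+n T C)
            advanced : ∀ p → p + suc t ≤ W → state (G (suc t) p) ≡ proj₁ (conf (suc t)) ×
              (rights (G (suc t) p) ≡ rightHalves p (proj₂ (conf (suc t))) × lefts (G (suc t) p) ≡ leftHalves p (proj₂ (conf (suc t))))
            advanced p h with tiling t p (<⇒≤ t<T) p≤W
              where p≤W = ≤-trans (m≤m+n p (suc t)) h
            ... | l , r , d , (eql , eqr , eqd) , (_ , _ , stepped , _) =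
              trans (cong state (sym d≡)) (trans (proj₁ (stepped nT nW)) (cong proj₁ delta≡)) ,
              trans (cong rights (sym d≡)) (trans (proj₁ (proj₂ (stepped nT nW)))
                (trans (cong (λ c → spread newRight (does (p ≟ 0)) (does (p ≟ 1)) (proj₂ c) l (G t p) r) delta≡)
                  (spread-correct newRight rightHalf newRight-correct as ts p l (G t p) r left′ (halves p p+t≤W) right′))) ,
              trans (cong lefts (sym d≡)) (trans (proj₂ (proj₂ (stepped nT nW)))
                (trans (cong (λ c → spread newLeft (does (p ≟ 0)) (does (p ≟ 1)) (proj₂ c) l (G t p) r) delta≡)
                  (spread-correct newLeft leftHalf newLeft-correct as ts p l (G t p) r left′ (halves p p+t≤W) right′)))
              where
              sp+t≤W : suc p + t ≤ W
              sp+t≤W = subst (_≤ W) (+-suc p t) h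
              p+t≤W : p + t ≤ W
              p+t≤W = <⇒≤ sp+t≤W
              p<W : p < W
              p<W = ≤-trans (m≤m+n (suc p) t) sp+t≤W
              nT = false-does (t ≟ T) (<⇒≢ t<T)
              nW = false-does (p ≟ W) (<⇒≢ p<W)
              d≡ = eqd t<T
              r≡ = eqr p<W
              right′ = trans (cong rights r≡) (proj₁ (halves (suc p) sp+t≤W)) , trans (cong lefts r≡) (proj₂ (halves (suc p) sp+t≤W))
              left′ : ∀ p′ → p ≡ suc p′ → rights l ≡ rightHalves p′ ts × lefts l ≡ leftHalves p′ ts
              left′ p′ eq = trans (cong rights (eql p′ eq)) (proj₁ (halves p′ h′)) , trans (cong lefts (eql p′ eq)) (proj₂ (halves p′ h′))
                where h′ = ≤-trans (n≤1+n _) (subst (λ p → p + t ≤ W) eq p+t≤W)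
              delta≡ : delta (state (G t p)) (seen (G t p)) ≡ delta q (heads ts)
              delta≡ with control t p (<⇒≤ t<T) (<⇒≤ p<W)
              ... | a , b = cong₂ delta (trans a q≡) (trans b (proj₁ (halves 0 t≤W)))

          correct : ∀ t → t ≤ T → Correct t
          correct zero    _   = correct-0
          correct (suc t) t<T = correct-suc t t<T (correct t (<⇒≤ t<T))

        certificate-Accepts : Accepts certificate
        certificate-Accepts with tiling T 0 ≤-refl z≤n
        ... | _ , _ , _ , _ , (_ , _ , _ , final) =
          trans (cong (accepting M) (sym (proj₁ (correct T ≤-refl)))) (final (true-does (T ≟ T) refl))

        tiling⇒certificate : Σ[ y ∈ List Bool ] length y ≤ C × Accepts y
        tiling⇒certificate = certificate , certificate-length , certificate-Accepts

-- Tilings of a torus as local constraints on bits.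

module Tiling where

  open import Data.Bool.Base using (Bool)
  import Data.Bool.Properties as Boolₚ
  open import Data.Fin.Base using (Fin; zero; suc; toℕ; fromℕ; fromℕ<; inject₁)
  open import Data.Fin.Properties using (all?; any?; toℕ<n; toℕ-fromℕ<; toℕ-injective; toℕ-inject₁; toℕ-fromℕ) renaming (_≟_ to _≟ᶠ_)
  open import Data.Fin.Relation.Unary.Top using (view; ‵fromℕ; ‵inject₁; view-fromℕ; view-inject₁)
  open import Data.List.Base as List using (List; length)
  open import Data.List.Membership.Propositional using (_∈_)
  open import Data.List.Membership.Propositional.Properties using (∈-filter⁺; ∈-filter⁻; ∈-lookup; ∈-map⁺; ∈-allFin)
  open import Data.List.Relation.Unary.Any using (index)
  open import Data.List.Relation.Unary.Any.Properties using (lookup-index)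
  open import Data.Nat.Base using (ℕ; zero; suc; _+_; _≤_; _<_; s≤s)
  open import Data.Nat.Properties using (≤-trans; ≤-refl; ≤-pred; _≤?_; <⇒≤; suc-injective; <-irrefl)
  open import Data.Product.Base using (Σ-syntax; _×_; _,_; proj₂)
  open import Data.Sum.Base using (_⊎_; inj₁; inj₂)
  open import Data.Vec.Base as Vec using (Vec; lookup; tabulate)
  open import Data.Vec.Properties using (lookup∘tabulate; tabulate∘lookup; tabulate-cong)
  open import Function.Base using (_∘_)
  open import Function.Bundles using (_⇔_; mk⇔)
  open import Relation.Binary.PropositionalEquality
  open import Relation.Nullary.Decidable using (Dec; yes; no; does; map′; ¬?; _×-dec_; decidable-stable)
  open import Relation.Nullary.Negation using (¬_; contradiction)
  open import Defs
  open Finiteness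
  open Rainbow
  open Satisfaction
  open Tableau

  exists? : ∀ {A : Set} {P : A → Set} → Finite A → (∀ a → Dec (P a)) → Dec (Σ[ a ∈ A ] P a)
  exists? {P = P} F P? = map′ (λ (i , p) → from i , p) (λ (a , p) → to a , subst P (sym (from-to a)) p) (any? (P? ∘ from))
    where open Finite F

  module _ {A : Set} {P : A → Set} (F : Finite A) (P? : ∀ a → Dec (P a)) where

    private
      not? : ∀ a → Dec (¬ P a)
      not? a = ¬? (P? a)

      elements : List A
      elements = List.map (Finite.from F) (List.allFin (Finite.size F))

    -- A decidable condition on finitely many bits is the conjunction of the clauses that exclude
    -- its failing patterns; this list supplies them.
    failing : List A
    failing = List.filter not? elements

    failing-complete : ∀ a → ¬ a ∈ failing → P a
    failing-complete a a∉ = decidable-stable (P? a) (λ np → a∉ (∈-filter⁺ not?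
      (subst (_∈ elements) (Finite.from-to F a) (∈-map⁺ (Finite.from F) (∈-allFin (Finite.to F a)))) np))

    failing-fails : ∀ i → ¬ P (List.lookup failing i)
    failing-fails i = proj₂ (∈-filter⁻ not? {xs = elements} (∈-lookup {xs = failing} i))

  module Coding {A : Set} (F : Finite A) {n : ℕ} (Good : Vec Bool n → (l h r d : A) → Set)
                (Good? : ∀ f l h r d → Dec (Good f l h r d)) where

    private
      tiles = Finite.size F

    Source : Set
    Source = Fin n ⊎ (Offset × Fin tiles)

    -- The unary code with one true bit per tile. Patterns that code no tile are excluded by
    -- `Allowed` along with the forbidden neighbourhoods.
    code : A → Fin tiles → Bool
    code τ w = does (Finite.to F τ ≟ᶠ w)

    code-injective : ∀ σ τ → (∀ w → code σ w ≡ code τ w) → σ ≡ τ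
    code-injective σ τ eq = Finite.to-injective F (sym (does-true (Finite.to F τ ≟ᶠ Finite.to F σ)
      (trans (sym (eq (Finite.to F σ))) (true-does (Finite.to F σ ≟ᶠ Finite.to F σ) refl))))

    record Allowed (f : Source → Bool) : Set where
      constructor allowed
      field
        l h r d  : A
        ok       : Good (tabulate (λ i → f (inj₁ i))) l h r d
        at-left  : ∀ w → f (inj₂ (left , w)) ≡ code l w
        at-here  : ∀ w → f (inj₂ (here , w)) ≡ code h w
        at-right : ∀ w → f (inj₂ (right , w)) ≡ code r w
        at-down  : ∀ w → f (inj₂ (down , w)) ≡ code d w

    Allowed? : ∀ f → Dec (Allowed f)
    Allowed? f = map′ (λ (l , h , r , d , (ok , a , b , c , e)) → allowed l h r d ok a b c e)
      (λ (allowed l h r d ok a b c e) → l , h , r , d , (ok , a , b , c , e))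
      (exists? F λ l → exists? F λ h → exists? F λ r → exists? F λ d → Good? (tabulate (λ i → f (inj₁ i))) l h r d ×-dec
        all? (λ w → f (inj₂ (left , w)) Boolₚ.≟ code l w) ×-dec all? (λ w → f (inj₂ (here , w)) Boolₚ.≟ code h w) ×-dec
        all? (λ w → f (inj₂ (right , w)) Boolₚ.≟ code r w) ×-dec all? (λ w → f (inj₂ (down , w)) Boolₚ.≟ code d w))

    Allowed-cong : ∀ {f g} → (∀ s → f s ≡ g s) → Allowed f → Allowed g
    Allowed-cong eq (allowed l h r d ok a b c e) = allowed l h r d
      (subst (λ fl → Good fl l h r d) (tabulate-cong (λ i → eq (inj₁ i))) ok)
      (λ w → trans (sym (eq _)) (a w)) (λ w → trans (sym (eq _)) (b w))
      (λ w → trans (sym (eq _)) (c w)) (λ w → trans (sym (eq _)) (e w))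

    module Clauses (S : Finite Source) where

      AllowedVec : Vec Bool (Finite.size S) → Set
      AllowedVec v = Allowed (λ s → lookup v (Finite.to S s))

      AllowedVec? : ∀ v → Dec (AllowedVec v)
      AllowedVec? v = Allowed? (λ s → lookup v (Finite.to S s))

      module _ (V : Finite (Vec Bool (Finite.size S))) where

        constraints : LocalConstraints
        constraints = record
          { flags = n ; bits = tiles ; clauses = length (failing V AllowedVec?) ; width = Finite.size S
          ; source = Finite.from S ; bad = λ c → lookup (List.lookup (failing V AllowedVec?) c) }

        module _ (G : Torus) (β : Torus.Cell G → Fin n → Bool) where

          open Torus G

          Tiles : (Cell → A) → Set
          Tiles γ = ∀ c → Good (tabulate (β c)) (γ (shift left c)) (γ c) (γ (shift right c)) (γ (shift down c))

          private
            bitOf : (Cell → Fin tiles → Bool) → Cell → Source → Bool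
            bitOf a c (inj₁ i)       = β c i
            bitOf a c (inj₂ (d , w)) = a (shift d c) w

            value-bitOf : ∀ a c j → value constraints G β a c j ≡ bitOf a c (Finite.from S j)
            value-bitOf a c j with Finite.from S j
            ... | inj₁ i       = refl
            ... | inj₂ (d , w) = refl

            tiles⇒satisfies : ∀ γ → Tiles γ → Satisfies constraints G β (λ c → code (γ c))
            tiles⇒satisfies γ tiling c k all-bad = failing-fails V AllowedVec? k
              (Allowed-cong same (allowed (γ (shift left c)) (γ c) (γ (shift right c)) (γ (shift down c)) (tiling c)
                (λ w → refl) (λ w → cong (λ c → code (γ c) w) (shift-here c)) (λ w → refl) (λ w → refl)))
              where
              same : ∀ s → bitOf (λ c → code (γ c)) c s ≡ lookup (List.lookup (failing V AllowedVec?) k) (Finite.to S s)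
              same s = trans (cong (bitOf (λ c → code (γ c)) c) (sym (Finite.from-to S s)))
                (trans (sym (value-bitOf (λ c → code (γ c)) c (Finite.to S s))) (all-bad (Finite.to S s)))

            module _ (a : Cell → Fin tiles → Bool) (satisfies : Satisfies constraints G β a) where

              bitVec : Cell → Vec Bool (Finite.size S)
              bitVec c = tabulate (value constraints G β a c)

              locally : ∀ c → Allowed (bitOf a c)
              locally c = Allowed-cong (λ s → trans (lookup∘tabulate (value constraints G β a c) (Finite.to S s))
                  (trans (value-bitOf a c (Finite.to S s)) (cong (bitOf a c) (Finite.from-to S s))))
                (failing-complete V AllowedVec? (bitVec c) (λ v∈ → satisfies c (index v∈)
                  (λ j → trans (sym (lookup∘tabulate (value constraints G β a c) j)) (cong (λ v → lookup v j) (lookup-index v∈)))))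

              γ : Cell → A
              γ c = Allowed.h (locally c)

              γ-code : ∀ c w → a c w ≡ code (γ c) w
              γ-code c w = trans (cong (λ c → a c w) (sym (shift-here c))) (Allowed.at-here (locally c) w)

              -- Every cell decodes its neighbours as well as itself; as the code is injective,
              -- these readings agree with those of the neighbours.
              γ-shift : ∀ d c τ → (∀ w → a (shift d c) w ≡ code τ w) → τ ≡ γ (shift d c)
              γ-shift d c τ eq = code-injective τ _ (λ w → trans (sym (eq w)) (γ-code (shift d c) w))

              γ-tiles : Tiles γ
              γ-tiles c = fit (γ-shift left c l (Allowed.at-left (locally c))) (γ-shift right c r (Allowed.at-right (locally c)))
                              (γ-shift down c d (Allowed.at-down (locally c))) ok
                where
                open Allowed (locally c) using (l; h; r; d; ok)
                fit : ∀ {l l′ r r′ d d′ f} → l ≡ l′ → r ≡ r′ → d ≡ d′ → Good f l h r d → Good f l′ h r′ d′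
                fit refl refl refl g = g

          satisfiable⇔tileable : (Σ[ a ∈ _ ] Satisfies constraints G β a) ⇔ (Σ[ γ ∈ _ ] Tiles γ)
          satisfiable⇔tileable = mk⇔ (λ (a , s) → γ a s , γ-tiles a s) (λ (γ , t) → (λ c → code (γ c)) , tiles⇒satisfies γ t)

  cycle cycle⁻ : ∀ {n} → Fin (suc n) → Fin (suc n)
  cycle i with view i
  ... | ‵fromℕ     = zero
  ... | ‵inject₁ j = suc j
  cycle⁻ zero    = fromℕ _
  cycle⁻ (suc i) = inject₁ i

  cycle-cycle⁻ : ∀ {n} (i : Fin (suc n)) → cycle (cycle⁻ i) ≡ i
  cycle-cycle⁻ {n} zero    rewrite view-fromℕ n = refl
  cycle-cycle⁻ (suc i) rewrite view-inject₁ i = refl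

  cycle⁻-cycle : ∀ {n} (i : Fin (suc n)) → cycle⁻ (cycle i) ≡ i
  cycle⁻-cycle i with view i
  ... | ‵fromℕ     = refl
  ... | ‵inject₁ j = refl

  toℕ-cycle : ∀ {n} (i : Fin (suc n)) → toℕ i < n → toℕ (cycle i) ≡ suc (toℕ i)
  toℕ-cycle {n} i i<n with view i
  ... | ‵fromℕ     = contradiction i<n (subst (λ m → ¬ (m < n)) (sym (toℕ-fromℕ n)) (<-irrefl refl))
  ... | ‵inject₁ j = cong suc (sym (toℕ-inject₁ j))

  toℕ-cycle-last : ∀ {n} (i : Fin (suc n)) → toℕ i ≡ n → toℕ (cycle i) ≡ 0
  toℕ-cycle-last i eq with view i
  ... | ‵fromℕ     = refl
  ... | ‵inject₁ j = contradiction (subst (_< _) (trans (sym (toℕ-inject₁ j)) eq) (toℕ<n j)) (<-irrefl refl)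

  toℕ-cycle⁻ : ∀ {n} (i : Fin (suc n)) p → toℕ i ≡ suc p → toℕ (cycle⁻ i) ≡ p
  toℕ-cycle⁻ (suc i) p eq = trans (toℕ-inject₁ i) (suc-injective eq)

  gridTorus : ℕ → ℕ → Torus
  gridTorus T W = record
    { Cell = Fin (suc T) × Fin (suc W)
    ; shift  = λ { here c → c ; left (t , p) → t , cycle⁻ p ; right (t , p) → t , cycle p ; down (t , p) → cycle t , p }
    ; shift⁻ = λ { here c → c ; left (t , p) → t , cycle p ; right (t , p) → t , cycle⁻ p ; down (t , p) → cycle⁻ t , p }
    ; shift-here = λ c → refl
    ; shift-shift⁻ = λ { here c → refl ; left (t , p) → cong (t ,_) (cycle⁻-cycle p) ; right (t , p) → cong (t ,_) (cycle-cycle⁻ p)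
                     ; down (t , p) → cong (_, p) (cycle-cycle⁻ t) }
    ; shift⁻-shift = λ { here c → refl ; left (t , p) → cong (t ,_) (cycle-cycle⁻ p) ; right (t , p) → cong (t ,_) (cycle⁻-cycle p)
                     ; down (t , p) → cong (_, p) (cycle⁻-cycle t) }
    }

  private
    -- The tableau is indexed by natural numbers and the torus by bounded ones; the default value
    -- concerns positions outside the tableau.
    clamp : ∀ n → ℕ → Fin (suc n)
    clamp n p with p ≤? n
    ... | yes p≤n = fromℕ< (s≤s p≤n)
    ... | no  _   = zero

    toℕ-clamp : ∀ n p → p ≤ n → toℕ (clamp n p) ≡ p
    toℕ-clamp n p p≤n with p ≤? n
    ... | yes h = toℕ-fromℕ< (s≤s h)
    ... | no ¬h = contradiction p≤n ¬h

  module _ {k : ℕ} (M : TM (2 + k)) (x : List Bool) (T C : ℕ) where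

    open Grid M x T C

    private
      torus = gridTorus T W
    open Torus torus

    gridFlags : Cell → Fin 8 → Bool
    gridFlags (t , p) = lookup (flagsAt (toℕ t) (toℕ p))

    Tiles : (Cell → Tile M) → Set
    Tiles γ = ∀ c → Ok M (tabulate (gridFlags c)) (γ (shift left c)) (γ c) (γ (shift right c)) (γ (shift down c))

    tileable⇔accepted : (Σ[ γ ∈ _ ] Tiles γ) ⇔ (Σ[ y ∈ List Bool ] length y ≤ C × Accepts y)
    tileable⇔accepted = mk⇔ (λ (γ , t) → forth γ t) (λ (y , y≤C , acc) → back y y≤C acc)
      where
      forth : ∀ γ → Tiles γ → Σ[ y ∈ List Bool ] length y ≤ C × Accepts y
      forth γ tiles = tiling⇒certificate (λ t p → γ (at t p)) λ t p t≤T p≤W →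
        γ (shift left (at t p)) , γ (shift right (at t p)) , γ (shift down (at t p)) ,
        ((λ p′ eq → cong (λ i → γ (clamp T t , i)) (toℕ-injective (trans (toℕ-cycle⁻ (clamp W p) p′ (trans (toℕ-clamp W p p≤W) eq))
                        (sym (toℕ-clamp W p′ (≤-trans (<⇒≤ (subst (p′ <_) (sym eq) ≤-refl)) p≤W)))))) ,
         (λ p<W → cong (λ i → γ (clamp T t , i)) (toℕ-injective (trans (toℕ-cycle (clamp W p) (subst (_< W) (sym (toℕ-clamp W p p≤W)) p<W))
                        (trans (cong suc (toℕ-clamp W p p≤W)) (sym (toℕ-clamp W (suc p) p<W)))))) ,
         (λ t<T → cong (λ i → γ (i , clamp W p)) (toℕ-injective (trans (toℕ-cycle (clamp T t) (subst (_< T) (sym (toℕ-clamp T t t≤T)) t<T))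
                        (trans (cong suc (toℕ-clamp T t t≤T)) (sym (toℕ-clamp T (suc t) t<T))))))) ,
        subst (λ fl → Ok M fl (γ (shift left (at t p))) (γ (at t p)) (γ (shift right (at t p))) (γ (shift down (at t p))))
          (trans (tabulate∘lookup _) (cong₂ flagsAt (toℕ-clamp T t t≤T) (toℕ-clamp W p p≤W))) (tiles (at t p))
        where
        at : ℕ → ℕ → Cell
        at t p = clamp T t , clamp W p
      back : ∀ y → length y ≤ C → Accepts y → Σ[ γ ∈ _ ] Tiles γ
      back y y≤C acc = γ , λ (t , p) →
        subst (λ fl → Ok M fl (γ (shift left (t , p))) (γ (t , p)) (γ (shift right (t , p))) (γ (shift down (t , p))))
          (sym (tabulate∘lookup (flagsAt (toℕ t) (toℕ p))))
          (contents-Ok y y≤C acc (toℕ t) (toℕ p) (≤-pred (toℕ<n t)) (≤-pred (toℕ<n p)) _ _ _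
            ((λ p′ eq → cong (contents y y≤C acc (toℕ t)) (toℕ-cycle⁻ p p′ eq)) ,
             (λ p<W → cong (contents y y≤C acc (toℕ t)) (toℕ-cycle p p<W)) ,
             (λ t<T → cong (λ t → contents y y≤C acc t (toℕ p)) (toℕ-cycle t t<T))))
        where
        γ : Cell → Tile M
        γ (t , p) = contents y y≤C acc (toℕ t) (toℕ p)

-- The decision problem as 3-colourability of triangle systems.

module Colourings where

  open import Data.Bool.Base using (Bool; false; T)
  open import Data.Fin.Base using (Fin)
  open import Data.Product.Base using (Σ-syntax; _×_; _,_; proj₁; proj₂)
  open import Function.Bundles using (_⇔_; mk⇔; Equivalence)
  open import Relation.Binary.PropositionalEquality
  open import Defs
  open Encodings
  open Orientations
  open Membership using (problem)
  open TriangleGraph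
  open RingGadget using (ProperOn; Node; A; transport; wiringSystem; proper⇒solution; solution⇒proper)
  open Rainbow hiding (right; left; here)
  open Satisfaction

  open Equivalence using (to; from)

  private
    -- A word in the language comes with some graph that it encodes. Since the word determines the
    -- order and the edges, a colouring of that graph also colours the constructed one.
    same-colouring : ∀ {w m n} {adj : Fin m → Fin m → Bool} {adj′ : Fin n → Fin n → Bool} → Encodes w m adj → Encodes w n adj′ →
      (c : Fin n → Fin 3) → (∀ u v → T (adj′ u v) → c u ≢ c v) → Σ[ c ∈ (Fin m → Fin 3) ] (∀ u v → T (adj u v) → c u ≢ c v)
    same-colouring E F c proper with refl ← Encodes-order E F =
      c , λ u v p → proper u v (subst T (trans (sym (Encodes.entries E u v)) (Encodes.entries F u v)) p)

  graph∈problem : ∀ {n} (S : TriangleSystem (Fin n)) → problem (encodeGraph (graph S)) ⇔ (Σ[ c ∈ (Fin n → Fin 3) ] ProperOn S c)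
  graph∈problem S = mk⇔ colouring orienting
    where
    colouring : problem (encodeGraph (graph S)) → Σ[ c ∈ _ ] ProperOn S c
    colouring ((G , regular) , eq , small) =
      let D , balanced = to (χ≤3⇔Balanced regular) small
          c′ , proper′ = Balanced-colouring G D balanced
          c , proper = same-colouring (encodeGraph-Encodes (graph S))
                         (subst (λ w → Encodes w (order G) (adj G)) eq (encodeGraph-Encodes G)) c′ proper′
      in c , adjacent-Proper S c proper
    orienting : Σ[ c ∈ _ ] ProperOn S c → problem (encodeGraph (graph S))
    orienting (c , proper) = (graph S , graph-regular S) , refl ,
      from (χ≤3⇔Balanced (graph-regular S)) (orientation S c proper , orientation-Balanced S c proper)

  transport-colouring : ∀ {V W : Set} (f : V → W) (g : W → V) gf fg (S : TriangleSystem V) →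
    (Σ[ c ∈ (V → Fin 3) ] ProperOn S c) ⇔ (Σ[ c ∈ (W → Fin 3) ] ProperOn (transport f g gf fg S) c)
  transport-colouring f g gf fg S = mk⇔
    (λ (c , proper) → (λ w → c (g w)) , λ w →
      (λ eq → proj₁ (proper (g w)) (trans eq (cong c (gf _)))) , (λ eq → proj₂ (proper (g w)) (trans eq (cong c (gf _)))))
    (λ (c , proper) → (λ v → c (f v)) , λ v →
      (λ eq → proj₁ (proper (f v)) (trans eq (cong (λ u → c (f (TriangleSystem.r S u))) (sym (gf v))))) ,
      (λ eq → proj₂ (proper (f v)) (trans eq (cong (λ u → c (f (TriangleSystem.s S u))) (sym (gf v))))))

  module _ (L : LocalConstraints) (G : Torus) (β : Torus.Cell G → Fin (LocalConstraints.flags L) → Bool) where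

    open Local L using (Occ; Var; occurrence)
    open Torus G using (Cell)

    satisfiable⇔colourable : (Σ[ a ∈ (Cell → Fin (LocalConstraints.bits L) → Bool) ] Satisfies L G β a) ⇔
      (Σ[ c ∈ (Node (wiring L G β) → Fin 3) ] ProperOn (wiringSystem (wiring L G β)) c)
    satisfiable⇔colourable = mk⇔
      (λ (a , s) → let f , sol = satisfies⇒solution L G β a s in solution⇒proper (wiring L G β) f sol)
      (λ (c , proper) → assignment L G β (col c) (rainbow c proper) , rainbow⇒satisfies L G β (col c) (rainbow c proper))
      where
      module _ (c : Node (wiring L G β) → Fin 3) where
        f : Cell × Occ → Fin 3
        f y = c (A , (false , y))
        col : Cell → Var → Fin 3
        col d x = f (d , occurrence x)
        rainbow : ProperOn (wiringSystem (wiring L G β)) c → Rainbow L G β col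
        rainbow proper = solution⇒rainbow L G β f (proper⇒solution (wiring L G β) c proper)

-- The constructed graph as a term for its adjacency matrix.

module Adjacency where

  open import Data.Bool.Base using (Bool; true; false; T; _∨_)
  open import Data.Bool.Properties using (T-∨)
  open import Data.Fin.Base using (Fin; zero; suc; toℕ; fromℕ<)
  open import Data.Fin.Properties using (toℕ<n; toℕ-fromℕ<; toℕ-injective; toℕ-combine) renaming (_≟_ to _≟ᶠ_)
  open import Data.List.Base as List using (List; []; _∷_)
  open import Data.List.Membership.Propositional.Properties using (∈-allFin)
  open import Data.List.Relation.Unary.Any using (Any; here)
  import Data.List.Relation.Unary.Any as Any
  import Data.List.Relation.Unary.Any.Properties as Anyₚ
  open import Data.Nat.Base using (ℕ; zero; suc; _+_; _*_; _∸_; _<_; z≤n; s≤s)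
  open import Data.Nat.Properties
  open import Data.Product.Base using (Σ-syntax; ∃-syntax; _×_; _,_; proj₁; proj₂)
  open import Data.Vec.Base as Vec using (Vec; []; _∷_; lookup)
  open import Data.Vec.Properties using (tabulate∘lookup; tabulate-cong)
  open import Function.Base using (_∘_)
  open import Function.Bundles using (_⇔_; mk⇔; Equivalence)
  open import Relation.Binary.PropositionalEquality
  open import Relation.Nullary.Decidable using (Dec; yes; no; does)
  open import Relation.Nullary.Negation using (¬_; contradiction)
  open import Defs using (Graph; adj; encodeGraph)
  open Finiteness
  open Terms
  open PolyTime using (isPositive; matrixWord)
  open Formulas
  open TriangleGraph
  open RingGadget hiding (swap)
  open Rainbow
  open Satisfaction
  open Tiling
  open Encodings using (encodeGraph-matrixWord)
  open Membership using (problem)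
  open Colourings

  open Equivalence using (to; from)

  ⋁ᶠ : ∀ {A m} → Finite A → (A → Term m) → Term m
  ⋁ᶠ F t = ⋁ (List.map (λ i → t (Finite.from F i)) (List.allFin (Finite.size F)))

  ⋀ : ∀ {n m} → (Fin n → Term m) → Term m
  ⋀ {zero}  t = lit 1
  ⋀ {suc n} t = t zero ∧̂ ⋀ (t ∘ suc)

  module _ (words : Vec (List Bool) 2) where

    open Semantics words

    ⋁ᶠ-⇔ : ∀ {A m ρ} (F : Finite A) (t : A → Term m) {P : A → Set} → (∀ a → 0 < ⟦ t a ⟧ ρ ⇔ P a) →
            0 < ⟦ ⋁ᶠ F t ⟧ ρ ⇔ (Σ[ a ∈ A ] P a)
    ⋁ᶠ-⇔ {m = m} {ρ} F t {P} eq = mk⇔ found total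
      where
      ts : List (Term m)
      ts = List.map (λ i → t (Finite.from F i)) (List.allFin (Finite.size F))
      found : 0 < ⟦ ⋁ ts ⟧ ρ → Σ[ a ∈ _ ] P a
      found h = let i , p = Any.satisfied (Anyₚ.map⁻ {xs = List.allFin (Finite.size F)} (to (⋁-⇔ words {ρ} ts) h))
                in Finite.from F i , to (eq (Finite.from F i)) p
      total : Σ[ a ∈ _ ] P a → 0 < ⟦ ⋁ ts ⟧ ρ
      total (a , p) = from (⋁-⇔ words {ρ} ts) (Anyₚ.map⁺ {xs = List.allFin (Finite.size F)}
        (Any.map (λ { refl → subst (λ a → 0 < ⟦ t a ⟧ ρ) (sym (Finite.from-to F a)) (from (eq a) p) })
          (∈-allFin (Finite.to F a))))

    ⋀-⇔ : ∀ {n m ρ} (t : Fin n → Term m) {P : Fin n → Set} → (∀ i → 0 < ⟦ t i ⟧ ρ ⇔ P i) → 0 < ⟦ ⋀ t ⟧ ρ ⇔ (∀ i → P i)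
    ⋀-⇔ {zero}  t eq = mk⇔ (λ _ ()) (λ _ → s≤s z≤n)
    ⋀-⇔ {suc n} t eq = mk⇔ (λ h → let p , q = to both h in λ { zero → p ; (suc i) → q i }) (λ p → from both (p zero , λ i → p (suc i)))
      where both = ∧-⇔ (eq zero) (⋀-⇔ (t ∘ suc) (λ i → eq (suc i)))

  data Direction : Set where
    forward backward : Offset → Direction

  finite-Kind : Finite Kind
  finite-Kind = record
    { size = 4
    ; to = λ { A → zero ; B → suc zero ; C → suc (suc zero) ; S → suc (suc (suc zero)) }
    ; from = λ { zero → A ; (suc zero) → B ; (suc (suc zero)) → C ; (suc (suc (suc zero))) → S }
    ; from-to = λ { A → refl ; B → refl ; C → refl ; S → refl }
    ; to-from = λ { zero → refl ; (suc zero) → refl ; (suc (suc zero)) → refl ; (suc (suc (suc zero))) → refl } }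

  -- Successor and predecessor on the cycle 0 .. n, the wrap-around being done
  -- by multiplication with a truth value.
  sucᵗ predᵗ : ∀ {m} → Term m → Term m → Term m
  sucᵗ n t  = (t ⊕ lit 1) ⊗ ¬̂ (t ≡̂ n)
  predᵗ n t = (t ⊖ lit 1) ⊕ n ⊗ (t ≡̂ lit 0)

  private
    sucⁿ predⁿ : ℕ → ℕ → ℕ
    sucⁿ n t  = (t + 1) * (1 ∸ (1 ∸ ((t ∸ n) + (n ∸ t))))
    predⁿ n t = (t ∸ 1) + n * (1 ∸ ((t ∸ 0) + (0 ∸ t)))

    sucⁿ-cycle : ∀ {n} (i : Fin (suc n)) → sucⁿ n (toℕ i) ≡ toℕ (cycle i)
    sucⁿ-cycle {n} i with toℕ i ≟ n
    ... | yes eq rewrite toℕ-cycle-last i eq | eq | n∸n≡0 n = *-zeroʳ (n + 1)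
    ... | no ne = trans (cong ((toℕ i + 1) *_) (one _ (λ h → ne (to (≡-⇔ (toℕ i) n) h))))
                    (trans (*-identityʳ _) (trans (+-comm (toℕ i) 1) (sym (toℕ-cycle i (≤∧≢⇒< (≤-pred (toℕ<n i)) ne)))))
      where
      one : ∀ a → ¬ (0 < a) → 1 ∸ a ≡ 1
      one zero    _ = refl
      one (suc a) h = contradiction (s≤s z≤n) h

    predⁿ-cycle⁻ : ∀ {n} (i : Fin (suc n)) → predⁿ n (toℕ i) ≡ toℕ (cycle⁻ i)
    predⁿ-cycle⁻ {n} zero = trans (*-identityʳ n) (sym (Data.Fin.Properties.toℕ-fromℕ n))
    predⁿ-cycle⁻ {n} (suc i) rewrite +-identityʳ (toℕ i) | 0∸n≡0 (toℕ i) =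
      trans (cong (toℕ i +_) (*-zeroʳ n)) (trans (+-identityʳ _) (sym (toℕ-cycle⁻ (suc i) (toℕ i) refl)))

  module LocalMoves (L : LocalConstraints) where

    open LocalConstraints L
    open Local L

    -- A vertex without its cell. The number of places is independent of the input, so case
    -- distinctions over them fit into a fixed term.
    Place : Set
    Place = Kind × (Bool × Occ)

    finite-Place : Finite Place
    finite-Place = finite-× finite-Kind (finite-× finite-Bool finite-Occ)

    data Generator : Set where
      rot rot⁻ swp : Generator

    -- The permutations of the triangle system, split into a shift of the cell and a finite table on
    -- places. The input affects the table only through the flags of the cell.
    act : Generator → (Fin flags → Bool) → Place → Direction × Place
    act rot  β (A , x)             = forward here , (B , x)
    act rot  β (B , x)             = forward here , (C , x)
    act rot  β (C , x)             = forward here , (A , x)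
    act rot  β (S , (e , (t , j))) = forward here , (S , (e , (t , turn j)))
    act rot⁻ β (A , x)             = forward here , (C , x)
    act rot⁻ β (B , x)             = forward here , (A , x)
    act rot⁻ β (C , x)             = forward here , (B , x)
    act rot⁻ β (S , (e , (t , j))) = forward here , (S , (e , (t , turn⁻ j)))
    act swp  β (A , (true , o))    = forward here , (C , (false , o))
    act swp  β (A , (false , o))   = forward here , (C , (true , next⁻ o))
    act swp  β (B , (false , o))   = forward here , (A , (true , o))
    act swp  β (B , (true , o))    = forward here , (A , (false , next o))
    act swp  β (C , (e , o))       = backward (offset o) , (S , (e , twist β o))
    act swp  β (S , (e , o))       = forward (offset o) , (B , (e , twist β o))

    module _ (G : Torus) (β : Torus.Cell G → Fin flags → Bool) where

      open Torus G

      N : Set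
      N = Kind × (Bool × (Cell × Occ))

      go : Direction → Cell → Cell
      go (forward d)  = shift d
      go (backward d) = shift⁻ d

      node : Cell → Place → N
      node c (κ , (e , o)) = κ , (e , (c , o))

      apply : Generator → N → N
      apply rot  = TriangleSystem.r (wiringSystem (wiring L G β))
      apply rot⁻ = TriangleSystem.r⁻ (wiringSystem (wiring L G β))
      apply swp  = TriangleSystem.s (wiringSystem (wiring L G β))

      act-apply : ∀ γ c ℓ → apply γ (node c ℓ) ≡ node (go (proj₁ (act γ (β c) ℓ)) c) (proj₂ (act γ (β c) ℓ))
      act-apply rot  c (A , (e , o))       = cong (λ c → node c (B , (e , o))) (sym (shift-here c))
      act-apply rot  c (B , (e , o))       = cong (λ c → node c (C , (e , o))) (sym (shift-here c))
      act-apply rot  c (C , (e , o))       = cong (λ c → node c (A , (e , o))) (sym (shift-here c))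
      act-apply rot  c (S , (e , (t , j))) = cong (λ c → node c (S , (e , (t , turn j)))) (sym (shift-here c))
      act-apply rot⁻ c (A , (e , o))       = cong (λ c → node c (C , (e , o))) (sym (shift-here c))
      act-apply rot⁻ c (B , (e , o))       = cong (λ c → node c (A , (e , o))) (sym (shift-here c))
      act-apply rot⁻ c (C , (e , o))       = cong (λ c → node c (B , (e , o))) (sym (shift-here c))
      act-apply rot⁻ c (S , (e , (t , j))) = cong (λ c → node c (S , (e , (t , turn⁻ j)))) (sym (shift-here c))
      act-apply swp  c (A , (true , o))    = cong (λ c → node c (C , (false , o))) (sym (shift-here c))
      act-apply swp  c (A , (false , o))   = cong (λ c → node c (C , (true , next⁻ o))) (sym (shift-here c))
      act-apply swp  c (B , (false , o))   = cong (λ c → node c (A , (true , o))) (sym (shift-here c))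
      act-apply swp  c (B , (true , o))    = cong (λ c → node c (A , (false , next o))) (sym (shift-here c))
      act-apply swp  c (C , (e , o))       = refl
      act-apply swp  c (S , (e , o))       = refl

  module AdjacencyTerm (L : LocalConstraints) (P : Finite (LocalMoves.Place L)) (tT tW : ∀ {m} → Term m)
                       (flagᵗ : Fin (LocalConstraints.flags L) → Term 4) where

    open LocalConstraints L
    open LocalMoves L
    open Finite P using () renaming (size to K; to to index)

    private
      -- The variables are: column, row, v, u.
      colᵗ rowᵗ vᵗ uᵗ : Term 4
      colᵗ = var zero
      rowᵗ = var (suc zero)
      vᵗ = var (suc (suc zero))
      uᵗ = var (suc (suc (suc zero)))

      -- The mixed-radix number that `finite-N` assigns to a vertex: row, then column, then place.
      position : Term 4 → Term 4 → Place → Term 4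
      position t p ℓ = lit K ⊗ ((lit 1 ⊕ tW) ⊗ t ⊕ p) ⊕ lit (toℕ (index ℓ))

      moved : Direction → Place → Term 4
      moved (forward here)   = position rowᵗ colᵗ
      moved (forward left)   = position rowᵗ (predᵗ tW colᵗ)
      moved (forward right)  = position rowᵗ (sucᵗ tW colᵗ)
      moved (forward down)   = position (sucᵗ tT rowᵗ) colᵗ
      moved (backward here)  = position rowᵗ colᵗ
      moved (backward left)  = position rowᵗ (sucᵗ tW colᵗ)
      moved (backward right) = position rowᵗ (predᵗ tW colᵗ)
      moved (backward down)  = position (predᵗ tT rowᵗ) colᵗ

      match : Bool → Term 4 → Term 4
      match true  t = t
      match false t = ¬̂ t

      Choice : Set
      Choice = Place × Vec Bool flags

      finite-Choice : Finite Choice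
      finite-Choice = finite-× P (finite-Vec finite-Bool flags)

      -- Place and flags are guessed by a finite disjunction, so that the entry of the table is
      -- already known when the term is built; the formula then verifies the guess.
      case : Generator → Term 4 → Term 4 → Choice → Term 4
      case γ a b (ℓ , β) = (a ≡̂ position rowᵗ colᵗ ℓ) ∧̂ ⋀ (λ i → match (lookup β i) (flagᵗ i)) ∧̂
                           (b ≡̂ moved (proj₁ (act γ (lookup β) ℓ)) (proj₂ (act γ (lookup β) ℓ)))

    stepᵗ : Generator → Term 4 → Term 4 → Term 2
    stepᵗ γ a b = ∃̂ (lit 1 ⊕ tT) (∃̂ (lit 1 ⊕ tW) (⋁ᶠ finite-Choice (case γ a b)))

    -- Mirrors the disjunction `near`; a predecessor under s is found by exchanging u and v.
    adjacencyᵗ : Term 2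
    adjacencyᵗ = (stepᵗ rot uᵗ vᵗ ∨̂ stepᵗ rot⁻ uᵗ vᵗ) ∨̂ (stepᵗ swp uᵗ vᵗ ∨̂ stepᵗ swp vᵗ uᵗ)

    orderᵗ : Term 0
    orderᵗ = ((lit 1 ⊕ tT) ⊗ (lit 1 ⊕ tW)) ⊗ lit K

    module _ (words : Vec (List Bool) 2) (T₀ W : ℕ)
             (T-correct : ∀ {m} (ρ : Vec ℕ m) → Semantics.⟦_⟧ words tT ρ ≡ T₀)
             (W-correct : ∀ {m} (ρ : Vec ℕ m) → Semantics.⟦_⟧ words tW ρ ≡ W)
             (βv : Torus.Cell (gridTorus T₀ W) → Vec Bool flags)
             (flag-correct : ∀ t p v u i → 0 < Semantics.⟦_⟧ words (flagᵗ i) (toℕ p ∷ toℕ t ∷ v ∷ u ∷ []) ⇔ lookup (βv (t , p)) i ≡ true)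
             where

      open Semantics words

      torus : Torus
      torus = gridTorus T₀ W

      open Torus torus using (Cell)

      β : Cell → Fin flags → Bool
      β c = lookup (βv c)

      finite-N : Finite (N torus β)
      finite-N = finite-iso (λ { (κ , (e , (c , o))) → c , (κ , (e , o)) }) (λ { (c , ℓ) → node torus β c ℓ })
        (λ { (κ , (e , (c , o))) → refl }) (λ { (c , (κ , (e , o))) → refl })
        (finite-× (finite-× (finite-Fin (suc T₀)) (finite-Fin (suc W))) P)

      private
        module F = Finite finite-N

        numberOf : Cell → Place → ℕ
        numberOf (t , p) ℓ = K * (suc W * toℕ t + toℕ p) + toℕ (index ℓ)

        number : ∀ c ℓ → toℕ (F.to (node torus β c ℓ)) ≡ numberOf c ℓ
        number (t , p) ℓ = trans (toℕ-combine (Data.Fin.Base.combine t p) (index ℓ))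
          (cong (λ n → K * n + toℕ (index ℓ)) (toℕ-combine t p))

        node-at : Fin F.size → Cell × Place
        node-at i with F.from i
        ... | κ , (e , (c , o)) = c , (κ , (e , o))

        node-at-from : ∀ i → node torus β (proj₁ (node-at i)) (proj₂ (node-at i)) ≡ F.from i
        node-at-from i with F.from i
        ... | κ , (e , (c , o)) = refl

      system : TriangleSystem (Fin (Finite.size finite-N))
      system = transport F.to F.from F.from-to F.to-from (wiringSystem (wiring L torus β))

      order≡ : ⟦ orderᵗ ⟧ [] ≡ F.size
      order≡ = cong₂ (λ a b → (suc a * suc b) * K) (T-correct []) (W-correct [])

      private
        position-correct : ∀ (c : Cell) ℓ {v u} tᵗ pᵗ → let ρ = toℕ (proj₂ c) ∷ toℕ (proj₁ c) ∷ v ∷ u ∷ [] in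
          ∀ {t p} → ⟦ tᵗ ⟧ ρ ≡ t → ⟦ pᵗ ⟧ ρ ≡ p →
          ⟦ position tᵗ pᵗ ℓ ⟧ ρ ≡ K * (suc W * t + p) + toℕ (index ℓ)
        position-correct c ℓ {v} {u} tᵗ pᵗ refl refl =
          cong (λ w → K * (suc w * ⟦ tᵗ ⟧ ρ + ⟦ pᵗ ⟧ ρ) + toℕ (index ℓ)) (W-correct ρ)
          where ρ = toℕ (proj₂ c) ∷ toℕ (proj₁ c) ∷ v ∷ u ∷ []

        moved-correct : ∀ d c ℓ {v u} → ⟦ moved d ℓ ⟧ (toℕ (proj₂ c) ∷ toℕ (proj₁ c) ∷ v ∷ u ∷ []) ≡ numberOf (go torus β d c) ℓ
        moved-correct (forward here)   c ℓ = position-correct c ℓ rowᵗ colᵗ refl refl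
        moved-correct (forward left)   c ℓ = position-correct c ℓ rowᵗ (predᵗ tW colᵗ) refl
          (trans (cong (λ n → predⁿ n (toℕ (proj₂ c))) (W-correct _)) (predⁿ-cycle⁻ (proj₂ c)))
        moved-correct (forward right)  c ℓ = position-correct c ℓ rowᵗ (sucᵗ tW colᵗ) refl
          (trans (cong (λ n → sucⁿ n (toℕ (proj₂ c))) (W-correct _)) (sucⁿ-cycle (proj₂ c)))
        moved-correct (forward down)   c ℓ = position-correct c ℓ (sucᵗ tT rowᵗ) colᵗ
          (trans (cong (λ n → sucⁿ n (toℕ (proj₁ c))) (T-correct _)) (sucⁿ-cycle (proj₁ c))) refl
        moved-correct (backward here)  c ℓ = position-correct c ℓ rowᵗ colᵗ refl refl
        moved-correct (backward left)  c ℓ = position-correct c ℓ rowᵗ (sucᵗ tW colᵗ) refl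
          (trans (cong (λ n → sucⁿ n (toℕ (proj₂ c))) (W-correct _)) (sucⁿ-cycle (proj₂ c)))
        moved-correct (backward right) c ℓ = position-correct c ℓ rowᵗ (predᵗ tW colᵗ) refl
          (trans (cong (λ n → predⁿ n (toℕ (proj₂ c))) (W-correct _)) (predⁿ-cycle⁻ (proj₂ c)))
        moved-correct (backward down)  c ℓ = position-correct c ℓ (predᵗ tT rowᵗ) colᵗ
          (trans (cong (λ n → predⁿ n (toℕ (proj₁ c))) (T-correct _)) (predⁿ-cycle⁻ (proj₁ c))) refl

        match-⇔ : ∀ b t {ρ x} → 0 < ⟦ t ⟧ ρ ⇔ x ≡ true → 0 < ⟦ match b t ⟧ ρ ⇔ x ≡ b
        match-⇔ true  t eq = eq
        match-⇔ false t {x = x} eq = mk⇔ (λ h → not-true x (to (¬-⇔ eq) h)) (λ { refl → from (¬-⇔ eq) λ () })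
          where
          not-true : ∀ x → x ≢ true → x ≡ false
          not-true true  ne = contradiction refl ne
          not-true false ne = refl

        lookup-ext : ∀ {n} (a b : Vec Bool n) → (∀ i → lookup a i ≡ lookup b i) → a ≡ b
        lookup-ext a b eq = trans (sym (tabulate∘lookup a)) (trans (tabulate-cong eq) (tabulate∘lookup b))

        module Step (γ : Generator) (aᵗ bᵗ : Term 4) (v u : ℕ) (i j : Fin F.size)
                    (a-correct : ∀ p t → ⟦ aᵗ ⟧ (p ∷ t ∷ v ∷ u ∷ []) ≡ toℕ i)
                    (b-correct : ∀ p t → ⟦ bᵗ ⟧ (p ∷ t ∷ v ∷ u ∷ []) ≡ toℕ j) where

          Case : Cell → Choice → Set
          Case c (ℓ , β′) = (toℕ i ≡ numberOf c ℓ × (∀ n → lookup (βv c) n ≡ lookup β′ n)) ×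
            toℕ j ≡ numberOf (go torus β (proj₁ (act γ (lookup β′) ℓ)) c) (proj₂ (act γ (lookup β′) ℓ))

          case-⇔ : ∀ c x → 0 < ⟦ case γ aᵗ bᵗ x ⟧ (toℕ (proj₂ c) ∷ toℕ (proj₁ c) ∷ v ∷ u ∷ []) ⇔ Case c x
          case-⇔ c (ℓ , β′) =
            ∧-⇔ (∧-⇔ (equal aᵗ (position rowᵗ colᵗ ℓ) (a-correct (toℕ (proj₂ c)) (toℕ (proj₁ c))) (position-correct c ℓ rowᵗ colᵗ refl refl))
                     (⋀-⇔ words (λ n → match (lookup β′ n) (flagᵗ n)) (λ n → match-⇔ (lookup β′ n) (flagᵗ n) (flag-correct (proj₁ c) (proj₂ c) v u n))))
                (equal bᵗ (moved (proj₁ (act γ (lookup β′) ℓ)) (proj₂ (act γ (lookup β′) ℓ))) (b-correct (toℕ (proj₂ c)) (toℕ (proj₁ c))) (moved-correct (proj₁ (act γ (lookup β′) ℓ)) c (proj₂ (act γ (lookup β′) ℓ))))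
            where
            equal : ∀ {m} (s t : Term m) {ρ x y} → ⟦ s ⟧ ρ ≡ x → ⟦ t ⟧ ρ ≡ y → 0 < ⟦ s ≡̂ t ⟧ ρ ⇔ x ≡ y
            equal s t refl refl = ≡-⇔ _ _

          Somewhere : ℕ → ℕ → Set
          Somewhere t p = Σ[ c ∈ Cell ] (toℕ (proj₁ c) ≡ t × toℕ (proj₂ c) ≡ p) × Σ[ x ∈ Choice ] Case c x

          somewhere-⇔ : ∀ t → t < suc T₀ → ∀ p → p < suc W →
            0 < ⟦ ⋁ᶠ finite-Choice (case γ aᵗ bᵗ) ⟧ (p ∷ t ∷ v ∷ u ∷ []) ⇔ Somewhere t p
          somewhere-⇔ t t<T p p<W = mk⇔
            found
            (λ { (c , (refl , refl) , x) → from (⋁ᶠ-⇔ words finite-Choice (case γ aᵗ bᵗ) (case-⇔ c)) x })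

            where
            c₀ : Cell
            c₀ = fromℕ< t<T , fromℕ< p<W
            found : 0 < ⟦ ⋁ᶠ finite-Choice (case γ aᵗ bᵗ) ⟧ (p ∷ t ∷ v ∷ u ∷ []) → Somewhere t p
            found h = c₀ , (toℕ-fromℕ< t<T , toℕ-fromℕ< p<W) ,
              to (⋁ᶠ-⇔ words finite-Choice (case γ aᵗ bᵗ) (case-⇔ c₀))
                 (subst₂ (λ t p → 0 < ⟦ ⋁ᶠ finite-Choice (case γ aᵗ bᵗ) ⟧ (p ∷ t ∷ v ∷ u ∷ [])) (sym (toℕ-fromℕ< t<T)) (sym (toℕ-fromℕ< p<W)) h)

          all-⇔ : 0 < ⟦ stepᵗ γ aᵗ bᵗ ⟧ (v ∷ u ∷ []) ⇔ (∃[ t ] t < suc T₀ × (∃[ p ] p < suc W × Somewhere t p))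
          all-⇔ = bounded (cong suc (T-correct _)) (λ t t<T → bounded (cong suc (W-correct _)) (λ p p<W → somewhere-⇔ t t<T p p<W))
            where
            bounded : ∀ {n n′ f} {Q : ℕ → Set} → n ≡ n′ → (∀ i → i < n′ → 0 < f i ⇔ Q i) → 0 < sumBelow n f ⇔ (∃[ i ] i < n′ × Q i)
            bounded refl eq = ∃-⇔ eq

          step-⇔ : 0 < ⟦ stepᵗ γ aᵗ bᵗ ⟧ (v ∷ u ∷ []) ⇔ j ≡ F.to (apply torus β γ (F.from i))
          step-⇔ = mk⇔ (λ h → let _ , _ , _ , _ , c , _ , x , cs = to all-⇔ h in forth c x cs) back
            where
            forth : ∀ c x → Case c x → j ≡ F.to (apply torus β γ (F.from i))
            forth c (ℓ , β′) ((eqi , eqβ) , eqj) with refl ← lookup-ext (βv c) β′ eqβ =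
              toℕ-injective (trans eqj (trans (sym (number (go torus β (proj₁ (act γ (β c) ℓ)) c) (proj₂ (act γ (β c) ℓ)))) (cong (λ a → toℕ (F.to a))
                (trans (sym (act-apply torus β γ c ℓ)) (cong (apply torus β γ) (trans (sym (F.from-to _)) (cong F.from
                  (sym (toℕ-injective (trans eqi (sym (number c ℓ))))))))))))
            back : j ≡ F.to (apply torus β γ (F.from i)) → 0 < ⟦ stepᵗ γ aᵗ bᵗ ⟧ (v ∷ u ∷ [])
            back eq = from all-⇔ (_ , toℕ<n (proj₁ c) , _ , toℕ<n (proj₂ c) , c , (refl , refl) , (ℓ , βv c) ,
              (trans (cong toℕ (trans (sym (F.to-from i)) (cong F.to (sym (node-at-from i))))) (number c ℓ) , λ n → refl) ,
              trans (cong toℕ (trans eq (cong F.to (trans (cong (apply torus β γ) (sym (node-at-from i))) (act-apply torus β γ c ℓ)))))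
                    (number (go torus β (proj₁ (act γ (β c) ℓ)) c) (proj₂ (act γ (β c) ℓ))))
              where
              c = proj₁ (node-at i)
              ℓ = proj₂ (node-at i)

      reductionGraph : Graph
      reductionGraph = graph system

      private
        does-⇔ : ∀ {Q : Set} (d : Dec Q) {n} → 0 < n ⇔ Q → 0 < n ⇔ T (does d)
        does-⇔ (yes q) eq = mk⇔ (λ _ → _) (λ _ → from eq q)
        does-⇔ (no ¬q) eq = mk⇔ (λ h → ¬q (to eq h)) (λ ())

        or-⇔ : ∀ {a b x y} → 0 < a ⇔ T x → 0 < b ⇔ T y → 0 < a + b ⇔ T (x ∨ y)
        or-⇔ p q = mk⇔ (λ h → from T-∨ (to (∨-⇔ p q) h)) (λ h → from (∨-⇔ p q) (to T-∨ h))

        positive-≡ : ∀ {n b} → 0 < n ⇔ T b → b ≡ isPositive n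
        positive-≡ {zero}  {true}  eq with () ← from eq _
        positive-≡ {zero}  {false} eq = refl
        positive-≡ {suc n} {true}  eq = refl
        positive-≡ {suc n} {false} eq with () ← to eq (s≤s z≤n)

      adjacency-correct : ∀ i j → adj reductionGraph i j ≡ isPositive (⟦ adjacencyᵗ ⟧ (toℕ j ∷ toℕ i ∷ []))
      adjacency-correct i j = positive-≡
        (or-⇔ (or-⇔ (does-⇔ (j ≟ᶠ _) (Step.step-⇔ rot uᵗ vᵗ (toℕ j) (toℕ i) i j (λ _ _ → refl) (λ _ _ → refl)))
                    (does-⇔ (j ≟ᶠ _) (Step.step-⇔ rot⁻ uᵗ vᵗ (toℕ j) (toℕ i) i j (λ _ _ → refl) (λ _ _ → refl))))
              (or-⇔ (does-⇔ (j ≟ᶠ _) (Step.step-⇔ swp uᵗ vᵗ (toℕ j) (toℕ i) i j (λ _ _ → refl) (λ _ _ → refl)))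
                    (does-⇔ (i ≟ᶠ _) (Step.step-⇔ swp vᵗ uᵗ (toℕ j) (toℕ i) j i (λ _ _ → refl) (λ _ _ → refl)))))

      encode-reductionGraph : encodeGraph reductionGraph ≡
        matrixWord (⟦ orderᵗ ⟧ []) (λ u v → isPositive (⟦ adjacencyᵗ ⟧ (v ∷ u ∷ [])))
      encode-reductionGraph =
        trans (encodeGraph-matrixWord reductionGraph (λ u v → isPositive (⟦ adjacencyᵗ ⟧ (v ∷ u ∷ []))) adjacency-correct)
          (cong (λ n → matrixWord n (λ u v → isPositive (⟦ adjacencyᵗ ⟧ (v ∷ u ∷ [])))) (sym order≡))

      satisfiable⇔problem : (Σ[ a ∈ (Cell → Fin bits → Bool) ] Satisfies L torus β a) ⇔
        problem (matrixWord (⟦ orderᵗ ⟧ []) (λ u v → isPositive (⟦ adjacencyᵗ ⟧ (v ∷ u ∷ []))))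
      satisfiable⇔problem = subst (λ w → (Σ[ a ∈ (Cell → Fin bits → Bool) ] Satisfies L torus β a) ⇔ problem w) encode-reductionGraph
        (⇔-trans (satisfiable⇔colourable L torus β)
        (⇔-trans (transport-colouring F.to F.from F.from-to F.to-from (wiringSystem (wiring L torus β)))
                 (⇔-sym (graph∈problem system))))

-- NP-hardness.

module Hardness where

  open import Data.Bool.Base using (Bool; true; false)
  open import Data.Fin.Base using (Fin; zero; suc; toℕ)
  open import Data.List.Base using (List; []; _∷_; length)
  open import Data.Nat.Base using (ℕ; zero; suc; _+_; _*_; _≤_; _<_; z≤n; s≤s)
  open import Data.Nat.Properties
  open import Data.Product.Base using (Σ-syntax; ∃-syntax; _×_; _,_; proj₁; proj₂)
  open import Data.Vec.Base as Vec using (Vec; []; _∷_; lookup)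
  open import Function.Bundles using (_⇔_; mk⇔; Equivalence)
  open import Relation.Binary.PropositionalEquality
  open import Relation.Nullary.Decidable using (Dec; yes; no; does)
  open import Relation.Nullary.Negation using (contradiction)
  open import Defs
  open Finiteness
  open Polynomials
  open Terms
  open PolyTime
  open Formulas
  open Rainbow hiding (right; left; here)
  open Satisfaction
  open Tableau
  open Tiling
  open Membership using (problem)
  open Adjacency

  open Equivalence using (to; from)

  private
    HaltsWithin-mono : ∀ {n} {M : TM n} {s t c d} → s ≤ t → HaltsWithin M s c d → HaltsWithin M t c d
    HaltsWithin-mono s≤t       (halt e)   = halt e
    HaltsWithin-mono (s≤s s≤t) (next e r) = next e (HaltsWithin-mono s≤t r)

    does-⇔ : ∀ {Q : Set} (d : Dec Q) {n} → 0 < n ⇔ Q → 0 < n ⇔ does d ≡ true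
    does-⇔ (yes q) eq = mk⇔ (λ _ → refl) (λ _ → from eq q)
    does-⇔ (no ¬q) eq = mk⇔ (λ h → contradiction (to eq h) ¬q) (λ ())

    bit-true-⇔ : ∀ b → 0 < toNat b ⇔ b ≡ true
    bit-true-⇔ true  = mk⇔ (λ _ → refl) (λ _ → s≤s z≤n)
    bit-true-⇔ false = mk⇔ (λ ()) (λ ())

  polyᵗ : ∀ {m} → Polynomial → Term m → Term m
  polyᵗ []      t = lit 0
  polyᵗ (a ∷ p) t = lit a ⊕ t ⊗ polyᵗ p t

  polyᵗ-correct : ∀ words {m} p (t : Term m) ρ → Semantics.⟦_⟧ words (polyᵗ p t) ρ ≡ eval p (Semantics.⟦_⟧ words t ρ)
  polyᵗ-correct words []      t ρ = refl
  polyᵗ-correct words (a ∷ p) t ρ = cong (λ z → a + Semantics.⟦_⟧ words t ρ * z) (polyᵗ-correct words p t ρ)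

  module Reduction {k : ℕ} (M : TM (2 + k)) (p q : Polynomial) where

    -- The tableau must be large enough for all certificates at once, so the time is p at the length
    -- of the input plus the greatest length of a certificate.
    timeᵗ certᵗ widthᵗ : ∀ {m} → Term m
    certᵗ  = polyᵗ q (len zero)
    timeᵗ  = polyᵗ p (len zero ⊕ certᵗ)
    widthᵗ = timeᵗ ⊕ certᵗ

    -- The order of the entries is that of `flags-of`.
    flagᵗ : Fin 8 → Term 4
    flagᵗ i = lookup ((row ≡̂ lit 0) ∷ (row ≡̂ timeᵗ) ∷ (col ≡̂ lit 0) ∷ (col ≡̂ lit 1) ∷ (col ≡̂ widthᵗ) ∷
                      (col <̂ len zero) ∷ bitAt zero col ∷ (col <̂ certᵗ) ∷ []) i
      where
      col row : Term 4
      col = var zero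
      row = var (suc zero)

    module _ (x : List Bool) where

      words : Vec (List Bool) 2
      words = x ∷ [] ∷ []

      C T₀ : ℕ
      C = eval q (length x)
      T₀ = eval p (length x + C)

      open Semantics words

      certᵗ-correct : ∀ {m} (ρ : Vec ℕ m) → ⟦ certᵗ ⟧ ρ ≡ C
      certᵗ-correct ρ = polyᵗ-correct words q (len zero) ρ

      timeᵗ-correct : ∀ {m} (ρ : Vec ℕ m) → ⟦ timeᵗ ⟧ ρ ≡ T₀
      timeᵗ-correct ρ = trans (polyᵗ-correct words p (len zero ⊕ certᵗ) ρ) (cong (λ c → eval p (length x + c)) (certᵗ-correct ρ))

      widthᵗ-correct : ∀ {m} (ρ : Vec ℕ m) → ⟦ widthᵗ ⟧ ρ ≡ T₀ + C
      widthᵗ-correct ρ = cong₂ _+_ (timeᵗ-correct ρ) (certᵗ-correct ρ)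

      open Grid M x T₀ C

      flagᵗ-correct : ∀ t p v u i → 0 < ⟦ flagᵗ i ⟧ (p ∷ t ∷ v ∷ u ∷ []) ⇔ lookup (flagsAt t p) i ≡ true
      flagᵗ-correct t p v u i = correct i
        where
        at : ∀ {m n} (Q : ℕ → Set) → m ≡ n → Q m → Q n
        at Q refl h = h
        ρ = p ∷ t ∷ v ∷ u ∷ []
        correct : ∀ i → 0 < ⟦ flagᵗ i ⟧ ρ ⇔ lookup (flagsAt t p) i ≡ true
        correct zero                                           = does-⇔ (t ≟ 0) (≡-⇔ t 0)
        correct (suc zero)                                     = does-⇔ (t ≟ T₀)
          (at (λ n → 0 < ⟦ flagᵗ (suc zero) ⟧ ρ ⇔ t ≡ n) (timeᵗ-correct ρ) (≡-⇔ t (⟦ timeᵗ ⟧ ρ)))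
        correct (suc (suc zero))                               = does-⇔ (p ≟ 0) (≡-⇔ p 0)
        correct (suc (suc (suc zero)))                         = does-⇔ (p ≟ 1) (≡-⇔ p 1)
        correct (suc (suc (suc (suc zero))))                   = does-⇔ (p ≟ W)
          (at (λ n → 0 < ⟦ flagᵗ (suc (suc (suc (suc zero)))) ⟧ ρ ⇔ p ≡ n) (widthᵗ-correct ρ) (≡-⇔ p (⟦ widthᵗ ⟧ ρ)))
        correct (suc (suc (suc (suc (suc zero)))))             = does-⇔ (p <? length x) (<-⇔ p (length x))
        correct (suc (suc (suc (suc (suc (suc zero))))))       = bit-true-⇔ (x ‼ p)
        correct (suc (suc (suc (suc (suc (suc (suc zero))))))) = does-⇔ (p <? C)
          (at (λ n → 0 < ⟦ flagᵗ (suc (suc (suc (suc (suc (suc (suc zero))))))) ⟧ ρ ⇔ p < n) (certᵗ-correct ρ) (<-⇔ p (⟦ certᵗ ⟧ ρ)))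

    -- The enumerations are parameters, because unfolding their sizes, which
    -- depend on M, makes conversion checking explode.
    module _ (F : Finite (Tile M)) (S : Finite (Coding.Source F (Ok M) (Ok? M)))
             (V : Finite (Vec Bool (Finite.size S))) where

      open Coding F (Ok M) (Ok? M)
      open Clauses S

      L : LocalConstraints
      L = constraints V

      module _ (P : Finite (LocalMoves.Place L)) where

        open AdjacencyTerm L P timeᵗ widthᵗ flagᵗ

        module _ (x : List Bool) where

          open Grid M x (T₀ x) (C x)

          private
            given : Torus.Cell (gridTorus (T₀ x) W) → Flags M
            given c = flagsAt (toℕ (proj₁ c)) (toℕ (proj₂ c))

            given-correct : ∀ t p v u i → 0 < Semantics.⟦_⟧ (words x) (flagᵗ i) (toℕ p ∷ toℕ t ∷ v ∷ u ∷ []) ⇔ lookup (given (t , p)) i ≡ true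
            given-correct t p v u i = flagᵗ-correct x (toℕ t) (toℕ p) v u i

          accepted⇔problem : (Σ[ y ∈ List Bool ] length y ≤ C x × Accepts y) ⇔
            problem (matrixWord (Semantics.⟦_⟧ (words x) orderᵗ []) (λ u v → isPositive (Semantics.⟦_⟧ (words x) adjacencyᵗ (v ∷ u ∷ []))))
          accepted⇔problem =
            ⇔-trans (⇔-sym (tileable⇔accepted M x (T₀ x) (C x)))
            (⇔-trans (⇔-sym (satisfiable⇔tileable V (gridTorus (T₀ x) W) (gridFlags M x (T₀ x) (C x))))
            (satisfiable⇔problem (words x) (T₀ x) W (timeᵗ-correct x) (widthᵗ-correct x) given given-correct))

        module _ {R : List Bool → List Bool → Bool}
                 (run : ∀ x y → ∃[ c ] HaltsWithin M (eval p (length x + length y)) (initial M (x ∷ y ∷ Vec.replicate k [])) c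
                                     × accepting M (proj₁ c) ≡ R x y) where

          -- A polynomial with natural coefficients is monotone, so with any admissible certificate
          -- the verifier has halted by time `T₀ x` and its final state shows the answer.
          certified⇔accepted : ∀ x → (∃[ y ] length y ≤ eval q (length x) × R x y ≡ true) ⇔
                               (Σ[ y ∈ List Bool ] length y ≤ C x × Grid.Accepts M x (T₀ x) (C x) y)
          certified⇔accepted x = mk⇔ (λ (y , y≤ , r) → y , y≤ , trans (accepts y y≤) r)
                                     (λ (y , y≤ , a) → y , y≤ , trans (sym (accepts y y≤)) a)
            where
            accepts : ∀ y → length y ≤ C x → accepting M (proj₁ (Grid.configAt M x (T₀ x) (C x) y (T₀ x))) ≡ R x y
            accepts y y≤ = let c , halts , acc = run x y in
              trans (cong (λ c → accepting M (proj₁ c))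
                       (after-steps-halts M (HaltsWithin-mono (eval-mono p (+-monoʳ-≤ (length x) y≤)) halts))) acc

          reducible : ∀ {L′ : Language} → (∀ x → L′ x ⇔ (∃[ y ] length y ≤ eval q (length x) × R x y ≡ true)) → L′ ≤ₚ problem
          reducible iff = _ , matrix-PolyTimeFunction orderᵗ adjacencyᵗ ,
            λ x → ⇔-trans (iff x) (⇔-trans (certified⇔accepted x) (accepted⇔problem x))

  problem-NP-hard : NP-hard problem
  problem-NP-hard L′ (R , (k , M , p , run) , q , iff) =
    reducible M p q F S V P run iff
    where
    open Reduction
    F = finite-Tile M
    S = finite-⊎ (finite-Fin 8) (finite-× finite-Offset (finite-Fin (Finite.size F)))
    V = finite-Vec finite-Bool (Finite.size S)
    P = LocalMoves.finite-Place (L M p q F S V)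

open import Data.Product.Base using (_,_)
open import Defs

corollary1 : NP-complete (language (RegularInOutProperOrientation 4 3))
corollary1 = Membership.problem-NP , Hardness.problem-NP-hard
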